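{- Let $(u_1, u_2, \ldots, u_k)$ be a $k$-tuple of positive integers such that $\ell c(u_1)-\ell c(u_1-1)\ge \ell c(u_i)-\ell c(u_i-1)$ for all $2\le i\le k$. Then there is a nonnegative integer $N$ with $$N\le \tfrac{3}{13}\log (u_1-1)+\tfrac{3}{13}\sum_{i=2}^k \log (u_i)+8k+4$$ such that for each integer $n\ge N$ there is an orthogonal design $OD\big(2^n\sum_{j=1}^k u_j;\, 2^nu_1, \ldots, 2^nu_k\big)$.
   Context: Here $\log$ is to base $2$, with the convention $\log(0)=0$. An orthogonal design $OD(n;\,u_1,\ldots,u_k)$, with $u_1,\ldots,u_k$ positive integers, is a square matrix $X$ of order $n$ with entries from $\{0,\pm x_1,\ldots,\pm x_k\}$, where $x_1,\ldots,x_k$ are distinct commuting real variables, such that $XX^{t}=\big(\sum_{i=1}^k u_i x_i^2\big)I_n$. A complex Golay number is a positive integer $m$ for which there is a pair of sequences $A=(a_1,\ldots,a_m)$, $B=(b_1,\ldots,b_m)$ with entries in $\{\pm1,\pm i\}\subset\mathbb{C}$ such that $\sum_{r=1}^{m-j}(a_{r+j}\overline{a_r}+b_{r+j}\overline{b_r})=0$ for all $1\le j\le m-1$. For a positive integer $u$, $\ell c(u)$ is the least number of complex Golay numbers (repetitions allowed) that add up to $u$, and $\ell c(0)=0$. -}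

module Defs where

open import Algebra.Bundles using (CommutativeRing; Semiring)
import Algebra.Definitions.RawSemiring as RawSemiringDefs
open import Data.Bool.Base using (if_then_else_)
open import Data.Fin.Base using (Fin)
open import Data.Fin.Properties using () renaming (_≟_ to _≟ᶠ_)
open import Data.Integer.Base as ℤ using (ℤ; 0ℤ; 1ℤ; -1ℤ; _⊖_)
import Data.Integer.Properties as ℤₚ
open import Data.List.Base using (List; []; _∷_; foldr; zipWith; drop)
open import Data.Nat.Base
open import Data.Nat.Properties
open import Data.Product.Base using (∃; _×_; _,_; proj₁; proj₂)
open import Data.Sum.Base using (inj₁; inj₂)
open import Data.Vec.Base as Vec using (Vec; []; _∷_; toList)
open import Data.Vec.Functional using (Vector)
open import Data.Vec.Relation.Unary.All using (All; []; _∷_)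
open import Level using (0ℓ)
open import Relation.Binary.Definitions using (DecidableEquality)
open import Relation.Binary.PropositionalEquality
open import Relation.Nullary.Decidable
open import Relation.Nullary.Negation using (contradiction)
open import Relation.Unary using (Pred; Decidable)

private
  module ℕ-Ops = RawSemiringDefs +-*-rawSemiring

sumℕ productℕ : ∀ {n} → Vector ℕ n → ℕ
sumℕ     = ℕ-Ops.sum
productℕ = ℕ-Ops.product

------------------------------------------------------------------------
-- Complex Golay numbers

-- ℤ[i] ⊂ ℂ. Autocorrelations of sequences over {±1, ±i} lie in this
-- subring, so no other complex numbers are needed.
record Gaussian : Set where
  constructor _+i_
  field
    re im : ℤ

open Gaussian public

0ᴳ : Gaussian
0ᴳ = 0ℤ +i 0ℤ

infixl 6 _+ᴳ_
infixl 7 _*ᴳ_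

_+ᴳ_ _*ᴳ_ : Gaussian → Gaussian → Gaussian
(a +i b) +ᴳ (c +i d) = (a ℤ.+ c) +i (b ℤ.+ d)
(a +i b) *ᴳ (c +i d) = (a ℤ.* c ℤ.- b ℤ.* d) +i (a ℤ.* d ℤ.+ b ℤ.* c)

conj : Gaussian → Gaussian
conj (a +i b) = a +i (ℤ.- b)

_≟ᴳ_ : DecidableEquality Gaussian
(a +i b) ≟ᴳ (c +i d) =
  map′ (λ { (refl , refl) → refl }) (λ { refl → refl , refl })
       ((a ℤₚ.≟ c) ×-dec (b ℤₚ.≟ d))

data Unit : Set where
  +1ᵘ -1ᵘ +iᵘ -iᵘ : Unit

⟦_⟧ᵘ : Unit → Gaussian
⟦ +1ᵘ ⟧ᵘ = 1ℤ +i 0ℤ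
⟦ -1ᵘ ⟧ᵘ = -1ℤ +i 0ℤ
⟦ +iᵘ ⟧ᵘ = 0ℤ +i 1ℤ
⟦ -iᵘ ⟧ᵘ = 0ℤ +i -1ℤ

-- zipWith truncates to the shorter list drop j A = (a_{j+1}, …, a_m), so
-- this is the sum of a_{r+j} * conj a_r over 1 ≤ r ≤ m - j.
autocorrelation : ℕ → List Unit → Gaussian
autocorrelation j A =
  foldr _+ᴳ_ 0ᴳ (zipWith (λ x y → ⟦ x ⟧ᵘ *ᴳ conj ⟦ y ⟧ᵘ) (drop j A) A)

IsComplexGolayPair : ∀ {m} → Vec Unit m → Vec Unit m → Set
IsComplexGolayPair {m} A B = ∀ j → 1 ≤ j → j < m →
  autocorrelation j (toList A) +ᴳ autocorrelation j (toList B) ≡ 0ᴳ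

IsComplexGolay : ℕ → Set
IsComplexGolay m =
  1 ≤ m × ∃ λ (A : Vec Unit m) → ∃ λ (B : Vec Unit m) → IsComplexGolayPair A B

------------------------------------------------------------------------
-- The function ℓc

IsSumOfGolay : ℕ → ℕ → Set
IsSumOfGolay u ℓ = ∃ λ (ms : Vec ℕ ℓ) → All IsComplexGolay ms × Vec.sum ms ≡ u

-- u = 0 is included: the empty sum forces ℓ = 0.
IsLeastGolayCount : ℕ → ℕ → Set
IsLeastGolayCount u ℓ = IsSumOfGolay u ℓ × (∀ ℓ′ → IsSumOfGolay u ℓ′ → ℓ ≤ ℓ′)

private
  anyUnit? : {P : Pred Unit 0ℓ} → Decidable P → Dec (∃ P)
  anyUnit? P? =
    map′ (λ { (inj₁ p) → +1ᵘ , p ; (inj₂ (inj₁ p)) → -1ᵘ , p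
            ; (inj₂ (inj₂ (inj₁ p))) → +iᵘ , p
            ; (inj₂ (inj₂ (inj₂ p))) → -iᵘ , p })
         (λ { (+1ᵘ , p) → inj₁ p ; (-1ᵘ , p) → inj₂ (inj₁ p)
            ; (+iᵘ , p) → inj₂ (inj₂ (inj₁ p))
            ; (-iᵘ , p) → inj₂ (inj₂ (inj₂ p)) })
         (P? +1ᵘ ⊎-dec P? -1ᵘ ⊎-dec P? +iᵘ ⊎-dec P? -iᵘ)

  anyVec? : ∀ {m} {P : Pred (Vec Unit m) 0ℓ} → Decidable P → Dec (∃ P)
  anyVec? {zero}  P? = map′ ([] ,_) (λ { ([] , p) → p }) (P? [])
  anyVec? {suc m} P? =
    map′ (λ { (x , xs , p) → (x ∷ xs) , p }) (λ { ((x ∷ xs) , p) → x , xs , p })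
         (anyUnit? λ x → anyVec? λ xs → P? (x ∷ xs))

  isComplexGolayPair? : ∀ {m} (A B : Vec Unit m) → Dec (IsComplexGolayPair A B)
  isComplexGolayPair? {m} A B =
    map′ (λ f j 1≤j j<m → f j<m 1≤j) (λ f {j} j<m 1≤j → f j 1≤j j<m)
         (allUpTo? (λ j → (1 ≤? j) →-dec (_ ≟ᴳ 0ᴳ)) m)

  isComplexGolay? : Decidable IsComplexGolay
  isComplexGolay? m =
    (1 ≤? m) ×-dec anyVec? λ A → anyVec? λ B → isComplexGolayPair? A B

  isSumOfGolay? : ∀ u ℓ → Dec (IsSumOfGolay u ℓ)
  isSumOfGolay? u zero =
    map′ (λ { refl → [] , [] , refl }) (λ { ([] , [] , eq) → sym eq }) (u ≟ 0)
  isSumOfGolay? u (suc ℓ) =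
    map′ (λ { (m , s≤s m≤u , g , ms , gs , eq) →
                (m ∷ ms) , (g ∷ gs) , trans (cong (m +_) eq) (m+[n∸m]≡n m≤u) })
         (λ { ((m ∷ ms) , (g ∷ gs) , refl) →
                m , s≤s (m≤m+n m _) , g , ms , gs , sym (m+n∸m≡n m _) })
         (anyUpTo? (λ m → isComplexGolay? m ×-dec isSumOfGolay? (u ∸ m) ℓ) (suc u))

  least : {P : Pred ℕ 0ℓ} → Decidable P → ∀ n → P n →
          ∃ λ ℓ → P ℓ × (∀ ℓ′ → P ℓ′ → ℓ ≤ ℓ′)
  least P? n p with P? 0
  ... | yes p₀ = 0 , p₀ , λ _ _ → z≤n
  least P? zero    p | no ¬p₀ = contradiction p ¬p₀
  least P? (suc n) p | no ¬p₀ with least (λ k → P? (suc k)) n p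
  ... | ℓ , q , min = suc ℓ , q , λ { zero    p₀ → contradiction p₀ ¬p₀
                                    ; (suc k) pₖ → s≤s (min k pₖ) }

  1-isComplexGolay : IsComplexGolay 1
  1-isComplexGolay =
    s≤s z≤n , (+1ᵘ ∷ []) , (+1ᵘ ∷ []) , λ j 1≤j j<1 → contradiction j<1 (≤⇒≯ 1≤j)

  sum-of-ones : ∀ u → IsSumOfGolay u u
  sum-of-ones zero    = [] , [] , refl
  sum-of-ones (suc u) with sum-of-ones u
  ... | ms , gs , eq = (1 ∷ ms) , (1-isComplexGolay ∷ gs) , cong suc eq

leastGolayCount : ∀ u → ∃ (IsLeastGolayCount u)
leastGolayCount u = least (isSumOfGolay? u) u (sum-of-ones u)

ℓc : ℕ → ℕ
ℓc u = proj₁ (leastGolayCount u)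

ℓc-isLeast : ∀ u → IsLeastGolayCount u (ℓc u)
ℓc-isLeast u = proj₂ (leastGolayCount u)

-- ℓc(u) - ℓc(u - 1) as an integer, for u ≥ 1.
Δℓc : ℕ → ℤ
Δℓc u = ℓc u ⊖ ℓc (u ∸ 1)

------------------------------------------------------------------------
-- Orthogonal designs

data Entry (k : ℕ) : Set where
  0ₑ    : Entry k
  +x -x : Fin k → Entry k

DesignMatrix : ℕ → ℕ → Set
DesignMatrix n k = Fin n → Fin n → Entry k

module _ (R : CommutativeRing 0ℓ 0ℓ) where
  open CommutativeRing R using (Carrier; _≈_; 0#; 1#; -_; semiring)
    renaming (_*_ to _*ᴿ_)
  open RawSemiringDefs (Semiring.rawSemiring semiring) using (sum) renaming (_×_ to _·_)

  evalEntry : ∀ {k} → (Fin k → Carrier) → Entry k → Carrier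
  evalEntry x 0ₑ     = 0#
  evalEntry x (+x t) = x t
  evalEntry x (-x t) = - x t

  identityMatrix : ∀ {n} → Fin n → Fin n → Carrier
  identityMatrix i j = if does (i ≟ᶠ j) then 1# else 0#

  GramIdentity : ∀ {n k} → (Fin k → ℕ) → DesignMatrix n k →
                 (Fin k → Carrier) → Set
  GramIdentity u X x = ∀ i j →
    sum (λ l → evalEntry x (X i l) *ᴿ evalEntry x (X j l))
      ≈ sum (λ t → u t · (x t *ᴿ x t)) *ᴿ identityMatrix i j

-- The variables are indeterminates: X Xᵗ = (Σ uₜ xₜ²) Iₙ is an identity of
-- matrices over ℤ[x₁, …, x_k], i.e. it holds for all values of the variables
-- in every commutative ring. X itself is chosen before the ring.
record OD (n : ℕ) {k : ℕ} (u : Fin k → ℕ) : Set₁ where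
  field
    positive : ∀ t → 1 ≤ u t
    X        : DesignMatrix n k
    gram     : ∀ (R : CommutativeRing 0ℓ 0ℓ) (x : Fin k → CommutativeRing.Carrier R) →
               GramIdentity R u X x

------------------------------------------------------------------------
-- The logarithmic bound

-- 2 ^ log₂ m, with log₂ 0 = 0.
2^log : ℕ → ℕ
2^log zero    = 1
2^log (suc m) = suc m

-- N ≤ (3/13) Σ log₂ (v i) + c over the reals: multiply by 13, then apply the
-- strictly increasing function t ↦ 2 ^ t to both sides.
_≤3/13∑log_plus_ : ∀ {k} → ℕ → Vector ℕ k → ℕ → Set
N ≤3/13∑log v plus c =
  2 ^ (13 * N) ≤ productℕ (λ i → 2^log (v i)) ^ 3 * 2 ^ (13 * c)

module Submission where

-- Write u₁ - 1, u₂, …, u_k as sums of L lengths of complex Golay pairs in all, and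
-- let p = u₁ + … + u_k. Over the group ring of a cyclic group of order 4p, start
-- from a Hermitian 2 × 2 matrix with scalar square that is supported on the
-- subgroup of order 4, and add the Golay pairs one at a time by
-- M ↦ M ⊗ E + I ⊗ vK, where E = diag(1, 1, -1, -1) and the Hermitian 4 × 4 matrix
-- K, made from the pair, anticommutes with E and has scalar square. The matrix
-- remains Hermitian with scalar square, and each row contains each group element
-- exactly once, with a unit and a variable as coefficient. Replacing i by a
-- rotation and multiplying by a Walsh matrix on the right therefore fills all
-- zeros. This gives a design of order 2^(2L+4) p, and tensoring with identity
-- matrices before the last step gives all larger powers of 2.
--
-- The lengths of complex Golay pairs include 1, 3, 5, 11, 13 and are closed under
-- (m, n) ↦ 2mn. From 2^40 on, each u is within u / 407 of such a number, and
-- 407^3 > 2^26, so a greedy choice uses at most (3/26) log u + 4 of them.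

-- The mixed terms in the Gram matrix of M ⊗ E + I ⊗ vK are, up to the factor v, M ⊗ EK and M⋆ ⊗ KE.
-- They cancel when M = M⋆, so every stage must be Hermitian and not merely have orthogonal rows. A
-- Hermitian K that uses a group element ζ also uses ζ⁻¹, and its second kind of block, kept on
-- other group elements by an involution J, adds Jζ and Jζ⁻¹. These orbits have size four except on
-- the subgroup of order 4, where they collapse. The base matrix exists to use up those four
-- elements. It accounts for one unit of u₁, which is why u₁ - 1 is what remains to be split. In the
-- exponent 2L + 4, each pair contributes two index bits, the base matrix one, the replacement of i
-- one, and the common factor 4 of all weights two. With at most (3/26) log u + 4 parts for each of
-- the k numbers, doubling gives the coefficient 3/13 and the constant 8k + 4. The number 407 is the
-- least integer whose cube exceeds 2^26.

open import Algebra.Bundles using (AbelianGroup; CommutativeRing)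
import Algebra.Construct.DirectProduct as DirectProduct
import Algebra.Construct.Pointwise as Pointwise
import Algebra.Properties.AbelianGroup
import Algebra.Properties.CommutativeMonoid.Mult
import Algebra.Properties.Ring
import Algebra.Properties.Semiring.Exp
import Algebra.Properties.Semiring.Mult
import Algebra.Properties.Semiring.Mult.TCOptimised
import Algebra.Properties.Semiring.Sum
import Algebra.Solver.Ring
import Algebra.Solver.Ring.AlmostCommutativeRing as ACR
open import Data.Bool.Base using (Bool; true; false; if_then_else_; _xor_; _∧_; not; T)
open import Data.Bool.Properties using (T-≡; T-∧)
open import Data.Fin.Base using (Fin; zero; suc; toℕ; remQuot; combine; opposite; _↑ˡ_; _↑ʳ_)
open import Data.Fin.Patterns using (0F; 1F; 2F; 3F)
open import Data.Fin.Permutation using (permutation)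
import Data.Fin.Properties as Finₚ
open import Data.Integer.Base as ℤ using (ℤ; -[1+_]; _⊖_)
import Data.Integer.Properties as ℤₚ
open import Data.List.Base as List using (List; length)
import Data.List.Properties as Listₚ
open import Data.List.Relation.Unary.All as All using (All)
import Data.Maybe.Base as Maybe
open import Data.Nat.Base as ℕ using (ℕ; zero; suc)
open import Data.Nat.DivMod
  using (_mod_; _/_; _%_; %-distribˡ-+; m<n⇒m%n≡m; n%n≡0; m%n<n; m≡m%n+[m/n]*n)
open import Data.Nat.Induction using (<-rec)
import Data.Nat.Properties as ℕₚ
open import Data.Nat.Tactic.RingSolver using (solve-∀)
open import Data.Product.Base using (_×_; _,_; proj₁; proj₂; ∃; ∃₂)
import Data.Sign.Base as Sign
open import Data.Unit.Base using (tt)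
open import Data.Vec.Base as Vec using (Vec)
import Data.Vec.Properties as Vecₚ
open import Function.Base using (_∘_)
open import Function.Bundles using (module Equivalence)
open import Level using (0ℓ)
open import Relation.Binary.PropositionalEquality as ≡ using (_≡_; _≢_)
import Relation.Binary.Reasoning.Setoid
open import Relation.Nullary.Decidable
  using (yes; no; does; dec-true; dec-false; dec⇒maybe; True; toWitness; _×-dec_)
open import Relation.Nullary.Negation using (contradiction)

-- With coefficients in the ring itself, the solver of the standard library
-- cannot cancel x - x, because equality with 0# is not decidable; with integer
-- coefficients it can.
module IntegerSolver (R : CommutativeRing 0ℓ 0ℓ) where
  open CommutativeRing R
  open Algebra.Properties.Ring ring
  open Algebra.Properties.AbelianGroup +-abelianGroup using (⁻¹-∙-comm; ⁻¹-involutive; ε⁻¹≈ε)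
  open Algebra.Properties.Semiring.Mult.TCOptimised semiring using (1+×; ×-homo-+; ×1-homo-*) renaming (_×_ to _×ᴿ_)
  open Relation.Binary.Reasoning.Setoid setoid

  -- The optimised multiple reduces `1 ×ᴿ 1#` to `1#`, so the constants in solver equations are
  -- definitionally those of the ring.
  fromℤ : ℤ → Carrier
  fromℤ (ℤ.+ n)  = n ×ᴿ 1#
  fromℤ -[1+ n ] = - (suc n ×ᴿ 1#)

  fromℤ-⊖ : ∀ m n → fromℤ (m ⊖ n) ≈ m ×ᴿ 1# - n ×ᴿ 1#
  fromℤ-⊖ zero zero = sym (-‿inverseʳ 0#)
  fromℤ-⊖ zero (suc n) = sym (+-identityˡ _)
  fromℤ-⊖ (suc m) zero = sym (trans (+-congˡ ε⁻¹≈ε) (+-identityʳ _))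
  fromℤ-⊖ (suc m) (suc n) = begin
    fromℤ (suc m ⊖ suc n)                 ≡⟨ ≡.cong fromℤ (ℤₚ.[1+m]⊖[1+n]≡m⊖n m n) ⟩
    fromℤ (m ⊖ n)                         ≈⟨ fromℤ-⊖ m n ⟩
    m ×ᴿ 1# - n ×ᴿ 1#                       ≈⟨ +-congʳ (+-identityʳ _) ⟨
    (m ×ᴿ 1# + 0#) - n ×ᴿ 1#                ≈⟨ +-congʳ (+-congˡ (-‿inverseʳ 1#)) ⟨
    (m ×ᴿ 1# + (1# - 1#)) - n ×ᴿ 1#         ≈⟨ +-congʳ (+-assoc _ _ _) ⟨
    (m ×ᴿ 1# + 1# - 1#) - n ×ᴿ 1#           ≈⟨ +-assoc _ _ _ ⟩
    (m ×ᴿ 1# + 1#) + (- 1# - n ×ᴿ 1#)       ≈⟨ +-cong (+-comm _ _) (⁻¹-∙-comm _ _) ⟩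
    (1# + m ×ᴿ 1#) - (1# + n ×ᴿ 1#)         ≈⟨ +-cong (1+× m 1#) (-‿cong (1+× n 1#)) ⟨
    suc m ×ᴿ 1# - suc n ×ᴿ 1#               ∎

  fromℤ-+ : ∀ i j → fromℤ (i ℤ.+ j) ≈ fromℤ i + fromℤ j
  fromℤ-+ (ℤ.+ m)  (ℤ.+ n)  = ×-homo-+ 1# m n
  fromℤ-+ (ℤ.+ m)  -[1+ n ] = fromℤ-⊖ m (suc n)
  fromℤ-+ -[1+ m ] (ℤ.+ n)  = trans (fromℤ-⊖ n (suc m)) (+-comm _ _)
  fromℤ-+ -[1+ m ] -[1+ n ] = begin
    - (suc (suc (m ℕ.+ n)) ×ᴿ 1#)          ≡⟨ ≡.cong (λ k → - (suc k ×ᴿ 1#)) (≡.sym (ℕₚ.+-suc m n)) ⟩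
    - ((suc m ℕ.+ suc n) ×ᴿ 1#)            ≈⟨ -‿cong (×-homo-+ 1# (suc m) (suc n)) ⟩
    - (suc m ×ᴿ 1# + suc n ×ᴿ 1#)           ≈⟨ ⁻¹-∙-comm _ _ ⟨
    - (suc m ×ᴿ 1#) - (suc n ×ᴿ 1#)         ∎

  fromSign : Sign.Sign → Carrier
  fromSign Sign.+ = 1#
  fromSign Sign.- = - 1#

  fromSign-* : ∀ s t → fromSign (s Sign.* t) ≈ fromSign s * fromSign t
  fromSign-* Sign.+ t = sym (*-identityˡ _)
  fromSign-* Sign.- Sign.+ = sym (*-identityʳ _)
  fromSign-* Sign.- Sign.- = sym (trans (-1*x≈-x _) (⁻¹-involutive _))

  fromℤ-◃ : ∀ s n → fromℤ (s ℤ.◃ n) ≈ fromSign s * (n ×ᴿ 1#)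
  fromℤ-◃ s zero = sym (zeroʳ _)
  fromℤ-◃ Sign.+ (suc n) = sym (*-identityˡ _)
  fromℤ-◃ Sign.- (suc n) = sym (-1*x≈-x _)

  fromℤ-sign : ∀ i → fromℤ i ≈ fromSign (ℤ.sign i) * (ℤ.∣ i ∣ ×ᴿ 1#)
  fromℤ-sign i = trans (reflexive (≡.cong fromℤ (≡.sym (ℤₚ.◃-inverse i)))) (fromℤ-◃ (ℤ.sign i) ℤ.∣ i ∣)

  fromℤ-* : ∀ i j → fromℤ (i ℤ.* j) ≈ fromℤ i * fromℤ j
  fromℤ-* i j = begin
    fromℤ (i ℤ.* j)                               ≈⟨ fromℤ-◃ (ℤ.sign i Sign.* ℤ.sign j) (ℤ.∣ i ∣ ℕ.* ℤ.∣ j ∣) ⟩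
    fromSign (ℤ.sign i Sign.* ℤ.sign j) * ((ℤ.∣ i ∣ ℕ.* ℤ.∣ j ∣) ×ᴿ 1#)
      ≈⟨ *-cong (fromSign-* (ℤ.sign i) (ℤ.sign j)) (×1-homo-* ℤ.∣ i ∣ ℤ.∣ j ∣) ⟩
    (si * sj) * (ni * nj)                         ≈⟨ *-assoc _ _ _ ⟩
    si * (sj * (ni * nj))                         ≈⟨ *-congˡ (*-assoc _ _ _) ⟨
    si * ((sj * ni) * nj)                         ≈⟨ *-congˡ (*-congʳ (*-comm _ _)) ⟩
    si * ((ni * sj) * nj)                         ≈⟨ *-congˡ (*-assoc _ _ _) ⟩
    si * (ni * (sj * nj))                         ≈⟨ *-assoc _ _ _ ⟨
    (si * ni) * (sj * nj)                         ≈⟨ *-cong (fromℤ-sign i) (fromℤ-sign j) ⟨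
    fromℤ i * fromℤ j                             ∎
    where
    si = fromSign (ℤ.sign i)
    sj = fromSign (ℤ.sign j)
    ni = ℤ.∣ i ∣ ×ᴿ 1#
    nj = ℤ.∣ j ∣ ×ᴿ 1#

  fromℤ-neg : ∀ i → fromℤ (ℤ.- i) ≈ - fromℤ i
  fromℤ-neg (ℤ.+ zero)  = sym ε⁻¹≈ε
  fromℤ-neg (ℤ.+ suc n) = refl
  fromℤ-neg -[1+ n ]    = sym (⁻¹-involutive _)

  fromℤ-homomorphism : ℤ.+-*-rawRing ACR.-Raw-AlmostCommutative⟶ ACR.fromCommutativeRing R
  fromℤ-homomorphism = record
    { ⟦_⟧ = fromℤ ; +-homo = fromℤ-+ ; *-homo = fromℤ-* ; -‿homo = fromℤ-neg
    ; 0-homo = refl ; 1-homo = refl }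

  fromℤ≟ : ∀ i j → Maybe.Maybe (fromℤ i ≈ fromℤ j)
  fromℤ≟ i j = Maybe.map (λ p → reflexive (≡.cong fromℤ p)) (dec⇒maybe (i ℤₚ.≟ j))

  open Algebra.Solver.Ring ℤ.+-*-rawRing (ACR.fromCommutativeRing R) fromℤ-homomorphism fromℤ≟
    public using (solve; con; _:=_; _:+_; _:*_; _:-_; :-_; Polynomial)

  :0 :1 : ∀ {n} → Polynomial n
  :0 = con (ℤ.+ 0)
  :1 = con (ℤ.+ 1)

-- Rings with involution, finite sums and signs

record StarRing : Set₁ where
  infix 9 _⋆
  field
    commutativeRing : CommutativeRing 0ℓ 0ℓ
  open CommutativeRing commutativeRing public
  field
    _⋆           : Carrier → Carrier
    ⋆-cong       : ∀ {x y} → x ≈ y → x ⋆ ≈ y ⋆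
    ⋆-+          : ∀ x y → (x + y) ⋆ ≈ x ⋆ + y ⋆
    ⋆-*          : ∀ x y → (x * y) ⋆ ≈ x ⋆ * y ⋆
    ⋆-1          : 1# ⋆ ≈ 1#
    ⋆-involutive : ∀ x → x ⋆ ⋆ ≈ x

  open Algebra.Properties.Ring ring public using (x+x≈x⇒x≈0)
  open Algebra.Properties.AbelianGroup +-abelianGroup using (inverseˡ-unique)

  ⋆-0 : 0# ⋆ ≈ 0#
  ⋆-0 = x+x≈x⇒x≈0 (0# ⋆) (trans (sym (⋆-+ 0# 0#)) (⋆-cong (+-identityˡ 0#)))

  ⋆-neg : ∀ x → (- x) ⋆ ≈ - x ⋆
  ⋆-neg x = inverseˡ-unique _ _
    (trans (sym (⋆-+ (- x) x)) (trans (⋆-cong (-‿inverseˡ x)) ⋆-0))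

module Sums (R : CommutativeRing 0ℓ 0ℓ) where
  open CommutativeRing R hiding (zero)
  open Algebra.Properties.Semiring.Sum semiring public
    using (sum; sum-cong-≋; ∑-comm; ∑-distrib-+; *-distribˡ-sum; *-distribʳ-sum; sum-permute; sum-replicate-zero)

  sum-reindex : ∀ {n} (f : Fin n → Carrier) (σ τ : Fin n → Fin n) →
                (∀ i → σ (τ i) ≡ i) → (∀ i → τ (σ i) ≡ i) → sum f ≈ sum (f ∘ σ)
  sum-reindex f σ τ στ τσ = sum-permute f (permutation σ τ στ τσ)

  sum-zero : ∀ {n} (f : Fin n → Carrier) → (∀ j → f j ≈ 0#) → sum f ≈ 0#
  sum-zero {n} f z = trans (sum-cong-≋ z) (sum-replicate-zero n)

  sum-single : ∀ {n} (f : Fin n → Carrier) i → (∀ j → i ≢ j → f j ≈ 0#) → sum f ≈ f i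
  sum-single f zero z =
    trans (+-congˡ (sum-zero _ λ j → z (suc j) λ ())) (+-identityʳ _)
  sum-single f (suc i) z =
    trans (+-cong (z zero λ ())
                  (sum-single (f ∘ suc) i λ j i≢j → z (suc j) (i≢j ∘ Finₚ.suc-injective)))
          (+-identityˡ _)

  -- In the group ring this is a times the group element i; with a = 1 it is a Kronecker symbol.
  basis : ∀ {n} → Fin n → Carrier → Fin n → Carrier
  basis i a j = if does (i Finₚ.≟ j) then a else 0#

  basis-same : ∀ {n} (i : Fin n) a → basis i a i ≡ a
  basis-same i a = ≡.cong (if_then a else 0#) (dec-true (i Finₚ.≟ i) ≡.refl)

  basis-other : ∀ {n} {i j : Fin n} a → i ≢ j → basis i a j ≡ 0#
  basis-other {i = i} {j} a i≢j = ≡.cong (if_then a else 0#) (dec-false (i Finₚ.≟ j) i≢j)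

  basis-cong : ∀ {n} (i j : Fin n) {a b} → a ≈ b → basis i a j ≈ basis i b j
  basis-cong i j a≈b with does (i Finₚ.≟ j)
  ... | true  = a≈b
  ... | false = refl

module Signs (R : CommutativeRing 0ℓ 0ℓ) where
  open CommutativeRing R hiding (zero)
  open Algebra.Properties.Ring ring using (-1*x≈-x)
  open Algebra.Properties.AbelianGroup +-abelianGroup using (⁻¹-involutive)

  sgn : Bool → Carrier
  sgn false = 1#
  sgn true  = - 1#

  sgn-xor : ∀ s t → sgn (s xor t) ≈ sgn s * sgn t
  sgn-xor false t = sym (*-identityˡ _)
  sgn-xor true false = sym (*-identityʳ _)
  sgn-xor true true = sym (trans (-1*x≈-x _) (⁻¹-involutive _))

-- Adjoining i to a commutative ring

module GaussianRing (R : CommutativeRing 0ℓ 0ℓ) where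
  open CommutativeRing R hiding (zero)
  open IntegerSolver R
  open Algebra.Properties.AbelianGroup +-abelianGroup using (⁻¹-∙-comm; ⁻¹-involutive; ε⁻¹≈ε)

  -- A design identity has to hold in every commutative ring, so i is adjoined formally, whether or
  -- not R already contains a root of -1.
  gaussian : StarRing
  gaussian = record
    { commutativeRing = record
      { Carrier = Carrier × Carrier
      ; _≈_ = λ x y → proj₁ x ≈ proj₁ y × proj₂ x ≈ proj₂ y
      ; _+_ = λ x y → (proj₁ x + proj₁ y) , (proj₂ x + proj₂ y)
      ; _*_ = λ x y → (proj₁ x * proj₁ y - proj₂ x * proj₂ y) , (proj₁ x * proj₂ y + proj₂ x * proj₁ y)
      ; -_ = λ x → - proj₁ x , - proj₂ x
      ; 0# = 0# , 0#
      ; 1# = 1# , 0#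
      ; isCommutativeRing = record
        { isRing = record
          { +-isAbelianGroup = AbelianGroup.isAbelianGroup (DirectProduct.abelianGroup +-abelianGroup +-abelianGroup)
          ; *-cong = λ (p , q) (r , s) →
              +-cong (*-cong p r) (-‿cong (*-cong q s)) , +-cong (*-cong p s) (*-cong q r)
          ; *-assoc = λ (a , b) (c , d) (e , f) →
              solve 6 (λ a b c d e f → (a :* c :- b :* d) :* e :- (a :* d :+ b :* c) :* f
                                    := a :* (c :* e :- d :* f) :- b :* (c :* f :+ d :* e)) refl a b c d e f
            , solve 6 (λ a b c d e f → (a :* c :- b :* d) :* f :+ (a :* d :+ b :* c) :* e
                                    := a :* (c :* f :+ d :* e) :+ b :* (c :* e :- d :* f)) refl a b c d e f
          ; *-identity =
              (λ (a , b) → solve 2 (λ a b → :1 :* a :- :0 :* b := a) refl a b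
                         , solve 2 (λ a b → :1 :* b :+ :0 :* a := b) refl a b)
            , (λ (a , b) → solve 2 (λ a b → a :* :1 :- b :* :0 := a) refl a b
                         , solve 2 (λ a b → a :* :0 :+ b :* :1 := b) refl a b)
          ; distrib =
              (λ (a , b) (c , d) (e , f) →
                 solve 6 (λ a b c d e f → a :* (c :+ e) :- b :* (d :+ f)
                                       := (a :* c :- b :* d) :+ (a :* e :- b :* f)) refl a b c d e f
               , solve 6 (λ a b c d e f → a :* (d :+ f) :+ b :* (c :+ e)
                                       := (a :* d :+ b :* c) :+ (a :* f :+ b :* e)) refl a b c d e f)
            , (λ (a , b) (c , d) (e , f) →
                 solve 6 (λ a b c d e f → (c :+ e) :* a :- (d :+ f) :* b
                                       := (c :* a :- d :* b) :+ (e :* a :- f :* b)) refl a b c d e f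
               , solve 6 (λ a b c d e f → (c :+ e) :* b :+ (d :+ f) :* a
                                       := (c :* b :+ d :* a) :+ (e :* b :+ f :* a)) refl a b c d e f)
          }
        ; *-comm = λ (a , b) (c , d) →
            solve 4 (λ a b c d → a :* c :- b :* d := c :* a :- d :* b) refl a b c d
          , solve 4 (λ a b c d → a :* d :+ b :* c := c :* b :+ d :* a) refl a b c d
        } }
    ; _⋆ = λ x → proj₁ x , - proj₂ x
    ; ⋆-cong = λ (p , q) → p , -‿cong q
    ; ⋆-+ = λ x y → refl , sym (⁻¹-∙-comm _ _)
    ; ⋆-* = λ (a , b) (c , d) →
        solve 4 (λ a b c d → a :* c :- b :* d := a :* c :- (:- b) :* (:- d)) refl a b c d
      , solve 4 (λ a b c d → :- (a :* d :+ b :* c) := a :* (:- d) :+ (:- b) :* c) refl a b c d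
    ; ⋆-1 = refl , ε⁻¹≈ε
    ; ⋆-involutive = λ x → refl , ⁻¹-involutive _
    }

-- Cyclic groups and their group rings

module Cyclic (n′ : ℕ) where
  n : ℕ
  n = suc n′

  infixl 6 _⊕_ _⊝_

  residue : ℕ → Fin n
  residue k = k mod n

  _⊕_ _⊝_ : Fin n → Fin n → Fin n
  a ⊕ b = residue (toℕ a ℕ.+ toℕ b)

  neg : Fin n → Fin n
  neg a = residue (n ℕ.∸ toℕ a)

  a ⊝ b = a ⊕ neg b

  toℕ-residue : ∀ k → toℕ (residue k) ≡ k % n
  toℕ-residue k = Finₚ.toℕ-fromℕ< (m%n<n k n)

  residue-cong : ∀ {k l} → k % n ≡ l % n → residue k ≡ residue l
  residue-cong {k} {l} e =
    Finₚ.toℕ-injective (≡.trans (toℕ-residue k) (≡.trans e (≡.sym (toℕ-residue l))))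

  residue-toℕ : ∀ a → residue (toℕ a) ≡ a
  residue-toℕ a =
    Finₚ.toℕ-injective (≡.trans (toℕ-residue (toℕ a)) (m<n⇒m%n≡m (Finₚ.toℕ<n a)))

  residue-+ : ∀ k l → residue (k ℕ.+ l) ≡ residue k ⊕ residue l
  residue-+ k l = residue-cong {k ℕ.+ l} {toℕ (residue k) ℕ.+ toℕ (residue l)} (≡.trans (%-distribˡ-+ k l n)
    (≡.cong₂ (λ x y → (x ℕ.+ y) % n) (≡.sym (toℕ-residue k)) (≡.sym (toℕ-residue l))))

  ⊕-comm : ∀ a b → a ⊕ b ≡ b ⊕ a
  ⊕-comm a b = ≡.cong residue (ℕₚ.+-comm (toℕ a) (toℕ b))

  ⊕-assoc : ∀ a b c → (a ⊕ b) ⊕ c ≡ a ⊕ (b ⊕ c)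
  ⊕-assoc a b c = begin
    (a ⊕ b) ⊕ c                               ≡⟨ ≡.cong ((a ⊕ b) ⊕_) (residue-toℕ c) ⟨
    (a ⊕ b) ⊕ residue (toℕ c)                 ≡⟨ residue-+ (toℕ a ℕ.+ toℕ b) (toℕ c) ⟨
    residue (toℕ a ℕ.+ toℕ b ℕ.+ toℕ c)       ≡⟨ ≡.cong residue (ℕₚ.+-assoc (toℕ a) (toℕ b) (toℕ c)) ⟩
    residue (toℕ a ℕ.+ (toℕ b ℕ.+ toℕ c))     ≡⟨ residue-+ (toℕ a) _ ⟩
    residue (toℕ a) ⊕ (b ⊕ c)                 ≡⟨ ≡.cong (_⊕ (b ⊕ c)) (residue-toℕ a) ⟩
    a ⊕ (b ⊕ c)                               ∎
    where open ≡.≡-Reasoning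

  ⊕-identityˡ : ∀ a → zero ⊕ a ≡ a
  ⊕-identityˡ = residue-toℕ

  ⊕-identityʳ : ∀ a → a ⊕ zero ≡ a
  ⊕-identityʳ a = ≡.trans (⊕-comm a zero) (⊕-identityˡ a)

  ⊕-inverseʳ : ∀ a → a ⊝ a ≡ zero
  ⊕-inverseʳ a = begin
    a ⊕ residue (n ℕ.∸ toℕ a)               ≡⟨ ≡.cong (_⊕ neg a) (residue-toℕ a) ⟨
    residue (toℕ a) ⊕ neg a                 ≡⟨ residue-+ (toℕ a) _ ⟨
    residue (toℕ a ℕ.+ (n ℕ.∸ toℕ a))       ≡⟨ ≡.cong residue (ℕₚ.m+[n∸m]≡n (ℕₚ.<⇒≤ (Finₚ.toℕ<n a))) ⟩
    residue n                               ≡⟨ residue-cong {n} {0} (n%n≡0 n) ⟩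
    zero                                    ∎
    where open ≡.≡-Reasoning

  cyclicGroup : AbelianGroup 0ℓ 0ℓ
  cyclicGroup = record
    { Carrier = Fin n ; _≈_ = _≡_ ; _∙_ = _⊕_ ; ε = zero ; _⁻¹ = neg
    ; isAbelianGroup = record
      { isGroup = record
        { isMonoid = record
          { isSemigroup = record
            { isMagma = record { isEquivalence = ≡.isEquivalence ; ∙-cong = ≡.cong₂ _⊕_ }
            ; assoc = ⊕-assoc }
          ; identity = ⊕-identityˡ , ⊕-identityʳ }
        ; inverse = (λ a → ≡.trans (⊕-comm (neg a) a) (⊕-inverseʳ a)) , ⊕-inverseʳ
        ; ⁻¹-cong = ≡.cong neg }
      ; comm = ⊕-comm } }

  open Algebra.Properties.AbelianGroup cyclicGroup public
    using () renaming (⁻¹-involutive to neg-involutive; ⁻¹-∙-comm to neg-⊕; ε⁻¹≈ε to neg-zero)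

  ⊝-⊕ : ∀ a b → (a ⊝ b) ⊕ b ≡ a
  ⊝-⊕ a b = ≡.trans (⊕-assoc a (neg b) b)
    (≡.trans (≡.cong (a ⊕_) (≡.trans (⊕-comm (neg b) b) (⊕-inverseʳ b))) (⊕-identityʳ a))

  ⊕-⊝ : ∀ a b → (a ⊕ b) ⊝ b ≡ a
  ⊕-⊝ a b = ≡.trans (⊕-assoc a b (neg b))
    (≡.trans (≡.cong (a ⊕_) (⊕-inverseʳ b)) (⊕-identityʳ a))

  ⊝-⊝ : ∀ a b → a ⊝ (a ⊝ b) ≡ b
  ⊝-⊝ a b = begin
    a ⊕ neg (a ⊕ neg b)         ≡⟨ ≡.cong (a ⊕_) (neg-⊕ a (neg b)) ⟨
    a ⊕ (neg a ⊕ neg (neg b))   ≡⟨ ⊕-assoc a _ _ ⟨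
    (a ⊝ a) ⊕ neg (neg b)       ≡⟨ ≡.cong₂ _⊕_ (⊕-inverseʳ a) (neg-involutive b) ⟩
    zero ⊕ b                    ≡⟨ ⊕-identityˡ b ⟩
    b                           ∎
    where open ≡.≡-Reasoning

  ⊝-⊕-assoc : ∀ a b c → a ⊝ (b ⊕ c) ≡ (a ⊝ c) ⊝ b
  ⊝-⊕-assoc a b c = begin
    a ⊕ neg (b ⊕ c)       ≡⟨ ≡.cong (λ x → a ⊕ neg x) (⊕-comm b c) ⟩
    a ⊕ neg (c ⊕ b)       ≡⟨ ≡.cong (a ⊕_) (neg-⊕ c b) ⟨
    a ⊕ (neg c ⊕ neg b)   ≡⟨ ⊕-assoc a _ _ ⟨
    (a ⊝ c) ⊝ b           ∎
    where open ≡.≡-Reasoning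

  ⊝-zero : ∀ a → a ⊝ zero ≡ a
  ⊝-zero a = ≡.trans (≡.cong (a ⊕_) neg-zero) (⊕-identityʳ a)

  neg-⊝ : ∀ a b → neg (a ⊝ b) ≡ b ⊝ a
  neg-⊝ a b = ≡.trans (≡.sym (neg-⊕ a (neg b)))
    (≡.trans (≡.cong (neg a ⊕_) (neg-involutive b)) (⊕-comm (neg a) b))

module GroupRing (S : StarRing) (n′ : ℕ) where
  open StarRing S hiding (zero)
  open Cyclic n′
  open Sums commutativeRing
  open Relation.Binary.Reasoning.Setoid setoid

  Elem : Set
  Elem = Fin n → Carrier

  infixl 7 _∗_
  _∗_ : Elem → Elem → Elem
  (f ∗ g) k = sum (λ j → f j * g (k ⊝ j))

  ∗-cong : ∀ {f f′ g g′} → (∀ k → f k ≈ f′ k) → (∀ k → g k ≈ g′ k) → ∀ k → (f ∗ g) k ≈ (f′ ∗ g′) k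
  ∗-cong p q k = sum-cong-≋ λ j → *-cong (p j) (q (k ⊝ j))

  ∗-comm : ∀ f g k → (f ∗ g) k ≈ (g ∗ f) k
  ∗-comm f g k = begin
    sum (λ j → f j * g (k ⊝ j))              ≈⟨ sum-reindex (λ j → f j * g (k ⊝ j)) (k ⊝_) (k ⊝_) (⊝-⊝ k) (⊝-⊝ k) ⟩
    sum (λ j → f (k ⊝ j) * g (k ⊝ (k ⊝ j)))  ≈⟨ sum-cong-≋ (λ j → *-congˡ {f (k ⊝ j)} (reflexive (≡.cong g (⊝-⊝ k j)))) ⟩
    sum (λ j → f (k ⊝ j) * g j)              ≈⟨ sum-cong-≋ (λ j → *-comm (f (k ⊝ j)) (g j)) ⟩
    sum (λ j → g j * f (k ⊝ j))              ∎

  ∗-assoc : ∀ f g h k → ((f ∗ g) ∗ h) k ≈ (f ∗ (g ∗ h)) k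
  ∗-assoc f g h k = begin
    sum (λ j → sum (λ i → f i * g (j ⊝ i)) * h (k ⊝ j))
      ≈⟨ sum-cong-≋ (λ j → *-distribʳ-sum (h (k ⊝ j)) (λ i → f i * g (j ⊝ i))) ⟩
    sum (λ j → sum (λ i → f i * g (j ⊝ i) * h (k ⊝ j)))
      ≈⟨ ∑-comm (λ j i → f i * g (j ⊝ i) * h (k ⊝ j)) ⟩
    sum (λ i → sum (λ j → f i * g (j ⊝ i) * h (k ⊝ j)))
      ≈⟨ sum-cong-≋ (λ i → sum-cong-≋ (λ j → *-assoc (f i) (g (j ⊝ i)) (h (k ⊝ j)))) ⟩
    sum (λ i → sum (λ j → f i * (g (j ⊝ i) * h (k ⊝ j))))
      ≈⟨ sum-cong-≋ (λ i → sym (*-distribˡ-sum (f i) (λ j → g (j ⊝ i) * h (k ⊝ j)))) ⟩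
    sum (λ i → f i * sum (λ j → g (j ⊝ i) * h (k ⊝ j)))
      ≈⟨ sum-cong-≋ (λ i → *-congˡ {f i} (shift i)) ⟩
    sum (λ i → f i * sum (λ j → g j * h ((k ⊝ i) ⊝ j)))     ∎
    where
    shift : ∀ i → sum (λ j → g (j ⊝ i) * h (k ⊝ j)) ≈ sum (λ j → g j * h ((k ⊝ i) ⊝ j))
    shift i = trans
      (sum-reindex (λ j → g (j ⊝ i) * h (k ⊝ j)) (_⊕ i) (_⊝ i) (λ j → ⊝-⊕ j i) (λ j → ⊕-⊝ j i))
      (sum-cong-≋ λ j → *-cong (reflexive (≡.cong g {(j ⊕ i) ⊝ i} {j} (⊕-⊝ j i)))
                               (reflexive (≡.cong h (⊝-⊕-assoc k j i))))

  basis-∗ : ∀ i a f k → (basis i a ∗ f) k ≈ a * f (k ⊝ i)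
  basis-∗ i a f k = trans
    (sum-single _ i λ j i≢j → trans (*-congʳ {f (k ⊝ j)} (reflexive (basis-other a i≢j))) (zeroˡ (f (k ⊝ j))))
    (*-congʳ {f (k ⊝ i)} (reflexive (basis-same i a)))

  ∗-identityˡ : ∀ f k → (basis zero 1# ∗ f) k ≈ f k
  ∗-identityˡ f k = trans (basis-∗ zero 1# f k)
    (trans (*-identityˡ _) (reflexive (≡.cong f (⊝-zero k))))

  ∗-distribˡ : ∀ f g h k → (f ∗ (λ j → g j + h j)) k ≈ (f ∗ g) k + (f ∗ h) k
  ∗-distribˡ f g h k = trans
    (sum-cong-≋ λ j → distribˡ (f j) (g (k ⊝ j)) (h (k ⊝ j)))
    (∑-distrib-+ (λ j → f j * g (k ⊝ j)) (λ j → f j * h (k ⊝ j)))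

  -- Inversion in the group is combined with conjugation of coefficients, which makes every group
  -- element unitary.
  star : Elem → Elem
  star f k = f (neg k) ⋆

  sum-⋆ : ∀ {m} (f : Fin m → Carrier) → sum f ⋆ ≈ sum (λ j → f j ⋆)
  sum-⋆ {zero}  f = ⋆-0
  sum-⋆ {suc m} f = trans (⋆-+ _ _) (+-congˡ (sum-⋆ (f ∘ suc)))

  star-∗ : ∀ f g k → star (f ∗ g) k ≈ (star f ∗ star g) k
  star-∗ f g k = begin
    sum (λ j → f j * g (neg k ⊝ j)) ⋆                ≈⟨ sum-⋆ (λ j → f j * g (neg k ⊝ j)) ⟩
    sum (λ j → (f j * g (neg k ⊝ j)) ⋆)              ≈⟨ sum-cong-≋ (λ j → ⋆-* (f j) (g (neg k ⊝ j))) ⟩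
    sum (λ j → f j ⋆ * g (neg k ⊝ j) ⋆)              ≈⟨ sum-reindex (λ j → f j ⋆ * g (neg k ⊝ j) ⋆) neg neg neg-involutive neg-involutive ⟩
    sum (λ j → f (neg j) ⋆ * g (neg k ⊝ neg j) ⋆)
      ≈⟨ sum-cong-≋ (λ j → *-congˡ {f (neg j) ⋆} (reflexive (≡.cong (λ x → g x ⋆) {neg k ⊝ neg j} {neg (k ⊝ j)} (neg-⊕ k (neg j))))) ⟩
    sum (λ j → f (neg j) ⋆ * g (neg (k ⊝ j)) ⋆)      ∎

  star-basis : ∀ i a k → star (basis i a) k ≈ basis (neg i) (a ⋆) k
  star-basis i a k with i Finₚ.≟ neg k
  ... | yes ≡.refl = reflexive (≡.sym (≡.trans (≡.cong (λ x → basis x (a ⋆) k) (neg-involutive k)) (basis-same k (a ⋆))))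
  ... | no i≢-k = trans ⋆-0 (reflexive (≡.sym (basis-other (a ⋆)
          λ e → i≢-k (≡.trans (≡.sym (neg-involutive i)) (≡.cong neg {neg i} {k} e)))))

  groupRing : StarRing
  groupRing = record
    { commutativeRing = record
      { Carrier = Elem
      ; _≈_ = λ f g → ∀ k → f k ≈ g k
      ; _+_ = λ f g k → f k + g k
      ; _*_ = _∗_
      ; -_ = λ f k → - f k
      ; 0# = λ _ → 0#
      ; 1# = basis zero 1#
      ; isCommutativeRing = record
        { isRing = record
          { +-isAbelianGroup = Pointwise.isAbelianGroup (Fin n) +-isAbelianGroup
          ; *-cong = ∗-cong
          ; *-assoc = ∗-assoc
          ; *-identity = ∗-identityˡ , (λ f k → trans (∗-comm f (basis zero 1#) k) (∗-identityˡ f k))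
          ; distrib = ∗-distribˡ
                    , (λ f g h k → trans (∗-comm (λ j → g j + h j) f k)
                        (trans (∗-distribˡ f g h k) (+-cong (∗-comm f g k) (∗-comm f h k)))) }
        ; *-comm = ∗-comm } }
    ; _⋆ = star
    ; ⋆-cong = λ p k → ⋆-cong (p (neg k))
    ; ⋆-+ = λ f g k → ⋆-+ _ _
    ; ⋆-* = star-∗
    ; ⋆-1 = λ k → trans (star-basis zero 1# k)
        (trans (reflexive (≡.cong (λ x → basis x (1# ⋆) k) neg-zero)) (basis-cong zero k ⋆-1))
    ; ⋆-involutive = λ f k → trans (⋆-involutive _) (reflexive (≡.cong f (neg-involutive k)))
    }

-- Complex Golay pairs as norm identities

module GolayPairs where
  open import Data.List.Base using ([]; _∷_)
  open import Data.List.Relation.Unary.All using ([]; _∷_)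
  open import Data.Vec.Base using ([]; _∷_; _++_; _∷ʳ_; concat)

  -- Both R[i] and its group ring are of this kind: the first supplies the coefficients, the second
  -- carries the matrix identities.
  record ComplexRing : Set₁ where
    field
      starRing : StarRing
    open StarRing starRing public
    field
      i     : Carrier
      i*i≈-1 : i * i ≈ - 1#
      i⋆≈-i : i ⋆ ≈ - i

  -- The fourth roots of unity (-1)^negative i^imaginary.
  record Root : Set where
    constructor root
    field
      negative imaginary : Bool

  infixl 7 _·_
  -- The term `b ∧ c` is the sign of i * i.
  _·_ : Root → Root → Root
  root s b · root t c = root ((s xor t) xor (b ∧ c)) (b xor c)

  conjugate negate : Root → Root
  conjugate (root s b) = root (s xor b) b
  negate (root s b) = root (not s) b

  infixr 8 _⊗_
  _⊗_ : ∀ {m n} → Vec Root m → Vec Root n → Vec Root (m ℕ.* n)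
  A ⊗ C = concat (Vec.map (λ a → Vec.map (a ·_) C) A)

  reverseConjugate : ∀ {m} → Vec Root m → Vec Root m
  reverseConjugate [] = []
  reverseConjugate (a ∷ A) = reverseConjugate A ∷ʳ conjugate a

  -- Counting the four roots separately reduces the vanishing of a correlation to two equations
  -- between natural numbers, decidable by computation.
  record Count : Set where
    constructor count
    field
      #1 #-1 #i #-i : ℕ

  open Count

  _⊞_ : Count → Count → Count
  count a b c d ⊞ count a′ b′ c′ d′ = count (a ℕ.+ a′) (b ℕ.+ b′) (c ℕ.+ c′) (d ℕ.+ d′)

  single : Root → Count
  single (root false false) = count 1 0 0 0
  single (root true  false) = count 0 1 0 0
  single (root false true)  = count 0 0 1 0
  single (root true  true)  = count 0 0 0 1

  _⊞*_ : List Count → List Count → List Count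
  [] ⊞* ds = ds
  (c ∷ cs) ⊞* [] = c ∷ cs
  (c ∷ cs) ⊞* (d ∷ ds) = (c ⊞ d) ∷ (cs ⊞* ds)

  -- Entry j counts the roots a_{r+j} * conj a_r.
  correlations : ∀ {m} → Vec Root m → List Count
  correlations [] = []
  correlations (a ∷ A) =
    List.map (λ b → single (conjugate a · b)) (a ∷ Vec.toList A) ⊞* correlations A

  Balanced : Count → Set
  Balanced c = #1 c ≡ #-1 c × #i c ≡ #-i c

  module Evaluation (C : ComplexRing) where
    open ComplexRing C hiding (zero)
    open Algebra.Properties.Ring ring using (-1*x≈-x)
    open Algebra.Properties.AbelianGroup +-abelianGroup using (⁻¹-involutive; ε⁻¹≈ε)
    open Algebra.Properties.Semiring.Exp semiring using (_^_)
    open Algebra.Properties.Semiring.Mult semiring using (×-homo-+) renaming (_×_ to _×ᴿ_)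
    open IntegerSolver commutativeRing
    open Relation.Binary.Reasoning.Setoid setoid

    open Signs commutativeRing public

    power-of-i : Bool → Carrier
    power-of-i false = 1#
    power-of-i true  = i

    ⟦_⟧ : Root → Carrier
    ⟦ root s b ⟧ = sgn s * power-of-i b

    i-xor : ∀ b c → sgn (b ∧ c) * power-of-i (b xor c) ≈ power-of-i b * power-of-i c
    i-xor false c = refl
    i-xor true false = trans (*-identityˡ _) (sym (*-identityʳ _))
    i-xor true true = trans (*-identityʳ _) (sym i*i≈-1)

    ⟦·⟧ : ∀ u v → ⟦ u · v ⟧ ≈ ⟦ u ⟧ * ⟦ v ⟧
    ⟦·⟧ (root s b) (root t c) = begin
      sgn ((s xor t) xor (b ∧ c)) * power-of-i (b xor c)          ≈⟨ *-congʳ (trans (sgn-xor (s xor t) (b ∧ c)) (*-congʳ (sgn-xor s t))) ⟩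
      (sgn s * sgn t) * sgn (b ∧ c) * power-of-i (b xor c)        ≈⟨ *-assoc _ _ _ ⟩
      (sgn s * sgn t) * (sgn (b ∧ c) * power-of-i (b xor c))      ≈⟨ *-congˡ (i-xor b c) ⟩
      (sgn s * sgn t) * (power-of-i b * power-of-i c)
        ≈⟨ solve 4 (λ s t b c → (s :* t) :* (b :* c) := (s :* b) :* (t :* c)) refl (sgn s) (sgn t) (power-of-i b) (power-of-i c) ⟩
      (sgn s * power-of-i b) * (sgn t * power-of-i c)             ∎

    ⟦negate⟧ : ∀ u → ⟦ negate u ⟧ ≈ - ⟦ u ⟧
    ⟦negate⟧ (root false b) = trans (-1*x≈-x _) (-‿cong (sym (*-identityˡ _)))
    ⟦negate⟧ (root true b) = trans (*-identityˡ _)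
      (sym (trans (-‿cong (-1*x≈-x _)) (⁻¹-involutive _)))

    sgn-⋆ : ∀ s → sgn s ⋆ ≈ sgn s
    sgn-⋆ false = ⋆-1
    sgn-⋆ true  = trans (⋆-neg 1#) (-‿cong ⋆-1)

    power-of-i-⋆ : ∀ b → power-of-i b ⋆ ≈ sgn b * power-of-i b
    power-of-i-⋆ false = trans ⋆-1 (sym (*-identityʳ _))
    power-of-i-⋆ true  = trans i⋆≈-i (sym (-1*x≈-x i))

    ⟦conjugate⟧ : ∀ u → ⟦ conjugate u ⟧ ≈ ⟦ u ⟧ ⋆
    ⟦conjugate⟧ (root s b) = begin
      sgn (s xor b) * power-of-i b        ≈⟨ *-congʳ (sgn-xor s b) ⟩
      sgn s * sgn b * power-of-i b        ≈⟨ *-assoc _ _ _ ⟩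
      sgn s * (sgn b * power-of-i b)      ≈⟨ *-cong (sgn-⋆ s) (power-of-i-⋆ b) ⟨
      sgn s ⋆ * power-of-i b ⋆            ≈⟨ ⋆-* _ _ ⟨
      (sgn s * power-of-i b) ⋆            ∎

    ⟦⟧-unitary : ∀ u → ⟦ u ⟧ * ⟦ u ⟧ ⋆ ≈ 1#
    ⟦⟧-unitary u = trans (*-congˡ (sym (⟦conjugate⟧ u)))
      (trans (sym (⟦·⟧ u (conjugate u))) (trivial u))
      where
      trivial : ∀ u → ⟦ u · conjugate u ⟧ ≈ 1#
      trivial (root false false) = *-identityˡ _
      trivial (root false true)  = *-identityˡ _
      trivial (root true false)  = *-identityˡ _
      trivial (root true true)   = *-identityˡ _

    Unitary : Carrier → Set
    Unitary z = z * z ⋆ ≈ 1#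

    *-unitary : ∀ {y z} → Unitary y → Unitary z → Unitary (y * z)
    *-unitary {y} {z} yy zz = begin
      (y * z) * (y * z) ⋆      ≈⟨ *-congˡ (⋆-* y z) ⟩
      (y * z) * (y ⋆ * z ⋆)    ≈⟨ solve 4 (λ a b c d → (a :* b) :* (c :* d) := (a :* c) :* (b :* d)) refl y z (y ⋆) (z ⋆) ⟩
      (y * y ⋆) * (z * z ⋆)    ≈⟨ *-cong yy zz ⟩
      1# * 1#                  ≈⟨ *-identityˡ 1# ⟩
      1#                       ∎

    ⋆-unitary : ∀ {z} → Unitary z → Unitary (z ⋆)
    ⋆-unitary {z} zz = trans (*-congˡ (⋆-involutive z)) (trans (*-comm _ _) zz)

    ^-unitary : ∀ {z} n → Unitary z → Unitary (z ^ n)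
    ^-unitary zero    zz = trans (*-identityˡ _) ⋆-1
    ^-unitary (suc n) zz = *-unitary zz (^-unitary n zz)

    eval : ∀ {m} → Carrier → Vec Root m → Carrier
    eval z []      = 0#
    eval z (a ∷ A) = ⟦ a ⟧ + z * eval z A

    eval-++ : ∀ {m n} z (A : Vec Root m) (B : Vec Root n) →
              eval z (A ++ B) ≈ eval z A + z ^ m * eval z B
    eval-++ z [] B = sym (trans (+-identityˡ _) (*-identityˡ _))
    eval-++ {suc m} z (a ∷ A) B = trans (+-congˡ (*-congˡ (eval-++ z A B)))
      (solve 5 (λ a z e p f → a :+ z :* (e :+ p :* f) := (a :+ z :* e) :+ (z :* p) :* f) refl
        ⟦ a ⟧ z (eval z A) (z ^ m) (eval z B))

    eval-∷ʳ : ∀ {m} z (A : Vec Root m) b → eval z (A ∷ʳ b) ≈ eval z A + z ^ m * ⟦ b ⟧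
    eval-∷ʳ z [] b = solve 2 (λ b z → b :+ z :* :0 := :0 :+ :1 :* b) refl ⟦ b ⟧ z
    eval-∷ʳ {suc m} z (a ∷ A) b = trans (+-congˡ (*-congˡ (eval-∷ʳ z A b)))
      (solve 5 (λ a z e p f → a :+ z :* (e :+ p :* f) := (a :+ z :* e) :+ (z :* p) :* f) refl
        ⟦ a ⟧ z (eval z A) (z ^ m) ⟦ b ⟧)

    eval-scale : ∀ {m} z u (A : Vec Root m) → eval z (Vec.map (u ·_) A) ≈ ⟦ u ⟧ * eval z A
    eval-scale z u [] = sym (zeroʳ _)
    eval-scale z u (a ∷ A) = trans (+-cong (⟦·⟧ u a) (*-congˡ (eval-scale z u A)))
      (solve 4 (λ u a z e → u :* a :+ z :* (u :* e) := u :* (a :+ z :* e)) refl ⟦ u ⟧ ⟦ a ⟧ z (eval z A))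

    eval-negate : ∀ {m} z (A : Vec Root m) → eval z (Vec.map negate A) ≈ - eval z A
    eval-negate z [] = sym ε⁻¹≈ε
    eval-negate z (a ∷ A) = trans (+-cong (⟦negate⟧ a) (*-congˡ (eval-negate z A)))
      (solve 3 (λ a z e → :- a :+ z :* (:- e) := :- (a :+ z :* e)) refl ⟦ a ⟧ z (eval z A))

    eval-⊗ : ∀ {m n} z (A : Vec Root m) (C : Vec Root n) → eval z (A ⊗ C) ≈ eval (z ^ n) A * eval z C
    eval-⊗ z [] C = sym (zeroˡ _)
    eval-⊗ {n = n} z (a ∷ A) C = begin
      eval z (Vec.map (a ·_) C ++ (A ⊗ C))                      ≈⟨ eval-++ z (Vec.map (a ·_) C) (A ⊗ C) ⟩
      eval z (Vec.map (a ·_) C) + z ^ n * eval z (A ⊗ C)        ≈⟨ +-cong (eval-scale z a C) (*-congˡ (eval-⊗ z A C)) ⟩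
      ⟦ a ⟧ * eval z C + z ^ n * (eval (z ^ n) A * eval z C)
        ≈⟨ solve 4 (λ a c p e → a :* c :+ p :* (e :* c) := (a :+ p :* e) :* c) refl ⟦ a ⟧ (eval z C) (z ^ n) (eval (z ^ n) A) ⟩
      (⟦ a ⟧ + z ^ n * eval (z ^ n) A) * eval z C               ∎

    eval-∷-⋆ : ∀ {m} z a (A : Vec Root m) → eval z (a ∷ A) ⋆ ≈ ⟦ a ⟧ ⋆ + z ⋆ * eval z A ⋆
    eval-∷-⋆ z a A = trans (⋆-+ _ _) (+-congˡ (⋆-* _ _))

    -- The factor is z^(m-1), which turns the negative powers of z in the conjugate back into a
    -- polynomial. Writing it as z⋆ z^m avoids the subtraction.
    eval-reverseConjugate : ∀ {m} z → Unitary z → (A : Vec Root m) →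
      eval z (reverseConjugate A) ≈ z ⋆ * z ^ m * eval z A ⋆
    eval-reverseConjugate z zz [] = sym (trans (*-congˡ ⋆-0) (zeroʳ _))
    eval-reverseConjugate {suc m} z zz (a ∷ A) = begin
      eval z (reverseConjugate A ∷ʳ conjugate a)
        ≈⟨ eval-∷ʳ z (reverseConjugate A) (conjugate a) ⟩
      eval z (reverseConjugate A) + z ^ m * ⟦ conjugate a ⟧
        ≈⟨ +-cong (eval-reverseConjugate z zz A) (*-congˡ (⟦conjugate⟧ a)) ⟩
      z ⋆ * z ^ m * eval z A ⋆ + z ^ m * ⟦ a ⟧ ⋆
        ≈⟨ +-cong (*-identityˡ _) (*-identityˡ _) ⟨
      1# * (z ⋆ * z ^ m * eval z A ⋆) + 1# * (z ^ m * ⟦ a ⟧ ⋆)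
        ≈⟨ +-cong (*-congʳ zz) (*-congʳ zz) ⟨
      z * z ⋆ * (z ⋆ * z ^ m * eval z A ⋆) + z * z ⋆ * (z ^ m * ⟦ a ⟧ ⋆)
        ≈⟨ solve 5 (λ z z′ p e a → z :* z′ :* (z′ :* p :* e) :+ z :* z′ :* (p :* a)
                                := z′ :* (z :* p) :* (a :+ z′ :* e)) refl z (z ⋆) (z ^ m) (eval z A ⋆) (⟦ a ⟧ ⋆) ⟩
      z ⋆ * z ^ suc m * (⟦ a ⟧ ⋆ + z ⋆ * eval z A ⋆)
        ≈⟨ *-congˡ (eval-∷-⋆ z a A) ⟨
      z ⋆ * z ^ suc m * eval z (a ∷ A) ⋆ ∎

    difference : ℕ → ℕ → Carrier
    difference m n = m ×ᴿ 1# - n ×ᴿ 1#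

    difference-+ : ∀ a b c d → difference (a ℕ.+ b) (c ℕ.+ d) ≈ difference a c + difference b d
    difference-+ a b c d = trans (+-cong (×-homo-+ 1# a b) (-‿cong (×-homo-+ 1# c d)))
      (solve 4 (λ a b c d → (a :+ b) :- (c :+ d) := (a :- c) :+ (b :- d)) refl (a ×ᴿ 1#) (b ×ᴿ 1#) (c ×ᴿ 1#) (d ×ᴿ 1#))

    ⟦_⟧ᶜ : Count → Carrier
    ⟦ c ⟧ᶜ = difference (#1 c) (#-1 c) + difference (#i c) (#-i c) * i

    ⟦⊞⟧ : ∀ c d → ⟦ c ⊞ d ⟧ᶜ ≈ ⟦ c ⟧ᶜ + ⟦ d ⟧ᶜ
    ⟦⊞⟧ c d = trans (+-cong (difference-+ (#1 c) (#1 d) (#-1 c) (#-1 d)) (*-congʳ (difference-+ (#i c) (#i d) (#-i c) (#-i d))))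
      (solve 5 (λ a b c d i → (a :+ b) :+ (c :+ d) :* i := (a :+ c :* i) :+ (b :+ d :* i)) refl
        (difference (#1 c) (#-1 c)) (difference (#1 d) (#-1 d)) (difference (#i c) (#-i c)) (difference (#i d) (#-i d)) i)

    ⟦single⟧ : ∀ u → ⟦ single u ⟧ᶜ ≈ ⟦ u ⟧
    ⟦single⟧ (root false false) = solve 1 (λ i → ((:1 :+ :0) :- :0) :+ (:0 :- :0) :* i := :1 :* :1) refl i
    ⟦single⟧ (root true false)  = solve 1 (λ i → (:0 :- (:1 :+ :0)) :+ (:0 :- :0) :* i := :- :1 :* :1) refl i
    ⟦single⟧ (root false true)  = solve 1 (λ i → (:0 :- :0) :+ ((:1 :+ :0) :- :0) :* i := :1 :* i) refl i
    ⟦single⟧ (root true true)   = solve 1 (λ i → (:0 :- :0) :+ (:0 :- (:1 :+ :0)) :* i := :- :1 :* i) refl i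

    evalᶜ : Carrier → List Count → Carrier
    evalᶜ z []       = 0#
    evalᶜ z (c ∷ cs) = ⟦ c ⟧ᶜ + z * evalᶜ z cs

    evalᶜ-⊞* : ∀ z cs ds → evalᶜ z (cs ⊞* ds) ≈ evalᶜ z cs + evalᶜ z ds
    evalᶜ-⊞* z [] ds = sym (+-identityˡ _)
    evalᶜ-⊞* z (c ∷ cs) [] = sym (+-identityʳ _)
    evalᶜ-⊞* z (c ∷ cs) (d ∷ ds) = trans (+-cong (⟦⊞⟧ c d) (*-congˡ (evalᶜ-⊞* z cs ds)))
      (solve 5 (λ c d z e f → (c :+ d) :+ z :* (e :+ f) := (c :+ z :* e) :+ (d :+ z :* f)) refl
        ⟦ c ⟧ᶜ ⟦ d ⟧ᶜ z (evalᶜ z cs) (evalᶜ z ds))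

    evalᶜ-single : ∀ {m} z u (A : Vec Root m) →
                   evalᶜ z (List.map (λ b → single (u · b)) (Vec.toList A)) ≈ ⟦ u ⟧ * eval z A
    evalᶜ-single z u [] = sym (zeroʳ _)
    evalᶜ-single z u (a ∷ A) = trans
      (+-cong (trans (⟦single⟧ (u · a)) (⟦·⟧ u a)) (*-congˡ (evalᶜ-single z u A)))
      (solve 4 (λ u a z e → u :* a :+ z :* (u :* e) := u :* (a :+ z :* e)) refl ⟦ u ⟧ ⟦ a ⟧ z (eval z A))

    -- The coefficient of z^j in A A⋆ is the conjugate of that of z^{-j}, so A A⋆
    -- is the sum of its part P of nonnegative degree and P⋆, less the constant m.
    eval-correlations : ∀ {m} z → Unitary z → (A : Vec Root m) →
      eval z A * eval z A ⋆ + m ×ᴿ 1# ≈ evalᶜ z (correlations A) + evalᶜ z (correlations A) ⋆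
    eval-correlations z zz [] = trans (+-congʳ (zeroˡ _)) (+-congˡ (sym ⋆-0))
    eval-correlations {suc m} z zz (a ∷ A) = begin
      (a₁ + z * e) * (eval z (a ∷ A)) ⋆ + (1# + m₁)
        ≈⟨ +-congʳ (*-congˡ (eval-∷-⋆ z a A)) ⟩
      (a₁ + z * e) * (a₁ ⋆ + z ⋆ * e ⋆) + (1# + m₁)
        -- The solver sees only ring identities, so the unitarity of z and of the first root enters
        -- through multiples of zz⋆ - 1 and aa⋆ - 1, which the next step removes.
        ≈⟨ solve 7 (λ a a′ z z′ e e′ m →
             (a :+ z :* e) :* (a′ :+ z′ :* e′) :+ (:1 :+ m)
          := (a′ :* (a :+ z :* e) :+ a :* (a′ :+ z′ :* e′)) :+ (e :* e′ :+ m) :+ ((z :* z′ :- :1) :* (e :* e′) :- (a :* a′ :- :1)))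
             refl a₁ (a₁ ⋆) z (z ⋆) e (e ⋆) m₁ ⟩
      (a₁ ⋆ * (a₁ + z * e) + a₁ * (a₁ ⋆ + z ⋆ * e ⋆)) + (e * e ⋆ + m₁) + ((z * z ⋆ - 1#) * (e * e ⋆) - (a₁ * a₁ ⋆ - 1#))
        ≈⟨ +-cong (+-congˡ (eval-correlations z zz A)) (trans (+-cong (trans (*-congʳ (vanish zz)) (zeroˡ _)) (trans (-‿cong (vanish (⟦⟧-unitary a))) ε⁻¹≈ε)) (+-identityˡ _)) ⟩
      (a₁ ⋆ * (a₁ + z * e) + a₁ * (a₁ ⋆ + z ⋆ * e ⋆)) + (p + p ⋆) + 0#
        ≈⟨ +-identityʳ _ ⟩
      (a₁ ⋆ * (a₁ + z * e) + a₁ * (a₁ ⋆ + z ⋆ * e ⋆)) + (p + p ⋆)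
        ≈⟨ solve 4 (λ a b c d → (a :+ b) :+ (c :+ d) := (a :+ c) :+ (b :+ d)) refl _ _ _ _ ⟩
      (a₁ ⋆ * (a₁ + z * e) + p) + (a₁ * (a₁ ⋆ + z ⋆ * e ⋆) + p ⋆)
        ≈⟨ +-cong expand (trans (⋆-cong expand) star) ⟨
      evalᶜ z (correlations (a ∷ A)) + evalᶜ z (correlations (a ∷ A)) ⋆ ∎
      where
      a₁ = ⟦ a ⟧
      e = eval z A
      m₁ = m ×ᴿ 1#
      p = evalᶜ z (correlations A)
      vanish : ∀ {x} → x ≈ 1# → x - 1# ≈ 0#
      vanish x≈1 = trans (+-congʳ x≈1) (-‿inverseʳ 1#)
      expand : evalᶜ z (correlations (a ∷ A)) ≈ a₁ ⋆ * (a₁ + z * e) + p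
      expand = trans (evalᶜ-⊞* z (List.map (λ b → single (conjugate a · b)) (a ∷ Vec.toList A)) (correlations A))
        (+-congʳ (trans (evalᶜ-single z (conjugate a) (a ∷ A)) (*-congʳ (⟦conjugate⟧ a))))
      star : (a₁ ⋆ * (a₁ + z * e) + p) ⋆ ≈ a₁ * (a₁ ⋆ + z ⋆ * e ⋆) + p ⋆
      star = trans (⋆-+ _ _) (+-congʳ (trans (⋆-* _ _) (*-cong (⋆-involutive a₁) (eval-∷-⋆ z a A))))

    evalᶜ-balanced : ∀ z {cs} → All Balanced cs → evalᶜ z cs ≈ 0#
    evalᶜ-balanced z [] = refl
    evalᶜ-balanced z {count a .a b .b ∷ cs} ((≡.refl , ≡.refl) ∷ bs) =
      trans (+-cong (trans (+-cong (-‿inverseʳ _) (trans (*-congʳ (-‿inverseʳ _)) (zeroˡ _))) (+-identityˡ _))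
                    (trans (*-congˡ (evalᶜ-balanced z bs)) (zeroʳ z)))
            (+-identityˡ _)

    ×1-⋆ : ∀ n → (n ×ᴿ 1#) ⋆ ≈ n ×ᴿ 1#
    ×1-⋆ zero    = ⋆-0
    ×1-⋆ (suc n) = trans (⋆-+ _ _) (+-cong ⋆-1 (×1-⋆ n))

  -- The conditions for all shifts become a single norm identity. Quantifying over rings and unitary
  -- z allows the substitution of z^n in products and of a group element in the matrices.
  IsGolayPair : ∀ {m} → Vec Root m → Vec Root m → Set₁
  IsGolayPair {m} A B = ∀ (C : ComplexRing) → let open ComplexRing C in let open Evaluation C in
    ∀ z → Unitary z →
    eval z A * eval z A ⋆ + eval z B * eval z B ⋆
      ≈ Algebra.Properties.Semiring.Mult._×_ semiring (m ℕ.+ m) 1#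

  GolayPair : ℕ → Set₁
  GolayPair m = ∃₂ λ (A B : Vec Root m) → IsGolayPair A B

  balanced? : ∀ c → _
  balanced? c = (#1 c ℕₚ.≟ #-1 c) ×-dec (#i c ℕₚ.≟ #-i c)

  -- The added list subtracts 2m from the entry of shift 0, after which all entries must balance.
  -- Hence the parts p and q of nonnegative degree have sum 2m; adding the conjugates and cancelling
  -- the constant 2m leaves the norm identity.
  golayFromCorrelations : ∀ {m} (A B : Vec Root m) →
    {True (All.all? balanced? ((count 0 (m ℕ.+ m) 0 0 ∷ []) ⊞* (correlations A ⊞* correlations B)))} →
    GolayPair m
  golayFromCorrelations {m} A B {t} = A , B , sums
    where
    sums : IsGolayPair A B
    sums C z zz = ∙-cancelʳ m₂ _ _ (begin
      (eval z A * eval z A ⋆ + eval z B * eval z B ⋆) + m₂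
        ≈⟨ +-congˡ (×-homo-+ 1# m m) ⟩
      (eval z A * eval z A ⋆ + eval z B * eval z B ⋆) + (m ×ᴿ 1# + m ×ᴿ 1#)
        ≈⟨ interchange _ _ _ _ ⟩
      (eval z A * eval z A ⋆ + m ×ᴿ 1#) + (eval z B * eval z B ⋆ + m ×ᴿ 1#)
        ≈⟨ +-cong (eval-correlations z zz A) (eval-correlations z zz B) ⟩
      (p + p ⋆) + (q + q ⋆)
        ≈⟨ interchange _ _ _ _ ⟩
      (p + q) + (p ⋆ + q ⋆)
        ≈⟨ +-congˡ (⋆-+ p q) ⟨
      (p + q) + (p + q) ⋆
        ≈⟨ +-cong p+q (trans (⋆-cong p+q) (×1-⋆ (m ℕ.+ m))) ⟩
      m₂ + m₂ ∎)
      where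
      open ComplexRing C hiding (zero)
      open Evaluation C
      open Algebra.Properties.AbelianGroup +-abelianGroup using (∙-cancelʳ)
      open Algebra.Properties.Semiring.Mult semiring using (×-homo-+) renaming (_×_ to _×ᴿ_)
      open IntegerSolver commutativeRing
      open Relation.Binary.Reasoning.Setoid setoid
      p = evalᶜ z (correlations A)
      q = evalᶜ z (correlations B)
      m₂ = (m ℕ.+ m) ×ᴿ 1#
      interchange : ∀ a b c d → (a + b) + (c + d) ≈ (a + c) + (b + d)
      interchange = solve 4 (λ a b c d → (a :+ b) :+ (c :+ d) := (a :+ c) :+ (b :+ d)) refl
      total : ((0# - m₂) + (0# - 0#) * i + z * 0#) + (p + q) ≈ 0#
      total = trans (+-congˡ (sym (evalᶜ-⊞* z (correlations A) (correlations B))))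
        (trans (sym (evalᶜ-⊞* z (count 0 (m ℕ.+ m) 0 0 ∷ []) (correlations A ⊞* correlations B))) (evalᶜ-balanced z (toWitness t)))
      p+q : p + q ≈ m₂
      p+q = begin
        p + q                                               ≈⟨ solve 4 (λ m i z s → s := m :+ (((:0 :- m) :+ (:0 :- :0) :* i :+ z :* :0) :+ s)) refl m₂ i z (p + q) ⟩
        m₂ + (((0# - m₂) + (0# - 0#) * i + z * 0#) + (p + q))  ≈⟨ +-congˡ total ⟩
        m₂ + 0#                                             ≈⟨ +-identityʳ _ ⟩
        m₂                                                  ∎

  -- With a = A(z^n), b = B(z^n), c = C(z), d = D(z) and w = z^(mn), the new polynomials are ac +
  -- wbd and, up to a unitary factor, ad⋆ - wbc⋆. The mixed terms in ab⋆ cancel and the norms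
  -- multiply, as for quaternions. Using z^n in A and B keeps the summands on disjoint powers of z,
  -- so all coefficients are again roots of unity.
  golayProduct : ∀ {m n} → GolayPair m → GolayPair n → GolayPair (m ℕ.* n ℕ.+ m ℕ.* n)
  golayProduct {m} {n} (A , B , AB) (C , D , CD) =
    (A ⊗ C ++ B ⊗ D) , (A ⊗ reverseConjugate D ++ Vec.map negate (B ⊗ reverseConjugate C)) , product
    where
    product : IsGolayPair (A ⊗ C ++ B ⊗ D) (A ⊗ reverseConjugate D ++ Vec.map negate (B ⊗ reverseConjugate C))
    product K z zz = begin
      X * X ⋆ + Y * Y ⋆
        ≈⟨ +-cong (*-cong X≈ (trans (⋆-cong X≈) X⋆)) (*-cong Y≈ (trans (⋆-cong Y≈) Y⋆)) ⟩
      (a * c + w * (b * d)) * (a ⋆ * c ⋆ + w ⋆ * (b ⋆ * d ⋆))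
        + (a * (y * d ⋆) + w * (- (b * (y * c ⋆)))) * (a ⋆ * (y ⋆ * d) + w ⋆ * (- (b ⋆ * (y ⋆ * c))))
        ≈⟨ solve 12 (λ a a′ b b′ c c′ d d′ w w′ y y′ →
             (a :* c :+ w :* (b :* d)) :* (a′ :* c′ :+ w′ :* (b′ :* d′))
               :+ (a :* (y :* d′) :+ w :* (:- (b :* (y :* c′)))) :* (a′ :* (y′ :* d) :+ w′ :* (:- (b′ :* (y′ :* c))))
          := (a :* a′ :+ b :* b′) :* (c :* c′ :+ d :* d′)
             :+ ((w :* w′ :- :1) :* (b :* b′ :* (d :* d′ :+ y :* y′ :* (c :* c′)))
             :+ (y :* y′ :- :1) :* (a :* a′ :* (d :* d′) :+ b :* b′ :* (c :* c′)
                   :- (w′ :* (a :* b′ :* (c :* d′)) :+ w :* (b :* a′ :* (d :* c′))))))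
             refl a (a ⋆) b (b ⋆) c (c ⋆) d (d ⋆) w (w ⋆) y (y ⋆) ⟩
      (a * a ⋆ + b * b ⋆) * (c * c ⋆ + d * d ⋆) + ((w * w ⋆ - 1#) * _ + (y * y ⋆ - 1#) * _)
        ≈⟨ +-cong (*-cong (AB K (z ^ n) (^-unitary n zz)) (CD K z zz))
                  (trans (+-cong (vanish ww) (vanish yy)) (+-identityˡ _)) ⟩
      ((m ℕ.+ m) ×ᴿ 1#) * ((n ℕ.+ n) ×ᴿ 1#) + 0#
        ≈⟨ +-identityʳ _ ⟩
      ((m ℕ.+ m) ×ᴿ 1#) * ((n ℕ.+ n) ×ᴿ 1#)
        ≈⟨ ×1-homo-* (m ℕ.+ m) (n ℕ.+ n) ⟨
      ((m ℕ.+ m) ℕ.* (n ℕ.+ n)) ×ᴿ 1#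
        ≡⟨ ≡.cong (_×ᴿ 1#) (≡.trans (ℕₚ.*-distribˡ-+ (m ℕ.+ m) n n) (≡.cong₂ ℕ._+_ (ℕₚ.*-distribʳ-+ n m m) (ℕₚ.*-distribʳ-+ n m m))) ⟩
      ((m ℕ.* n ℕ.+ m ℕ.* n) ℕ.+ (m ℕ.* n ℕ.+ m ℕ.* n)) ×ᴿ 1# ∎
      where
      open ComplexRing K hiding (zero)
      open Evaluation K
      open Algebra.Properties.Semiring.Exp semiring using (_^_)
      open Algebra.Properties.Semiring.Mult semiring using (×1-homo-*) renaming (_×_ to _×ᴿ_)
      open IntegerSolver commutativeRing
      open Relation.Binary.Reasoning.Setoid setoid
      X = eval z (A ⊗ C ++ B ⊗ D)
      Y = eval z (A ⊗ reverseConjugate D ++ Vec.map negate (B ⊗ reverseConjugate C))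
      a = eval (z ^ n) A
      b = eval (z ^ n) B
      c = eval z C
      d = eval z D
      w = z ^ (m ℕ.* n)
      y = z ⋆ * z ^ n
      ww : Unitary w
      ww = ^-unitary (m ℕ.* n) zz
      yy : Unitary y
      yy = *-unitary (⋆-unitary zz) (^-unitary n zz)
      vanish : ∀ {x r} → x ≈ 1# → (x - 1#) * r ≈ 0#
      vanish x≈1 = trans (*-congʳ (trans (+-congʳ x≈1) (-‿inverseʳ 1#))) (zeroˡ _)
      X≈ : X ≈ a * c + w * (b * d)
      X≈ = trans (eval-++ z (A ⊗ C) (B ⊗ D)) (+-cong (eval-⊗ z A C) (*-congˡ (eval-⊗ z B D)))
      X⋆ : (a * c + w * (b * d)) ⋆ ≈ a ⋆ * c ⋆ + w ⋆ * (b ⋆ * d ⋆)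
      X⋆ = trans (⋆-+ _ _) (+-cong (⋆-* _ _) (trans (⋆-* _ _) (*-congˡ (⋆-* _ _))))
      Y≈ : Y ≈ a * (y * d ⋆) + w * (- (b * (y * c ⋆)))
      Y≈ = trans (eval-++ z (A ⊗ reverseConjugate D) _)
        (+-cong (trans (eval-⊗ z A (reverseConjugate D)) (*-congˡ (eval-reverseConjugate z zz D)))
                (*-congˡ (trans (eval-negate z (B ⊗ reverseConjugate C))
                  (-‿cong (trans (eval-⊗ z B (reverseConjugate C)) (*-congˡ (eval-reverseConjugate z zz C)))))))
      y-⋆ : ∀ e x → (e * (y * x ⋆)) ⋆ ≈ e ⋆ * (y ⋆ * x)
      y-⋆ e x = trans (⋆-* _ _) (*-congˡ (trans (⋆-* _ _) (*-congˡ (⋆-involutive x))))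
      Y⋆ : (a * (y * d ⋆) + w * (- (b * (y * c ⋆)))) ⋆ ≈ a ⋆ * (y ⋆ * d) + w ⋆ * (- (b ⋆ * (y ⋆ * c)))
      Y⋆ = trans (⋆-+ _ _) (+-cong (y-⋆ a d)
        (trans (⋆-* _ _) (*-congˡ (trans (⋆-neg _) (-‿cong (y-⋆ b c))))))

  pattern 𝟙 = root false false
  pattern -𝟙 = root true false
  pattern 𝕚 = root false true
  pattern -𝕚 = root true true

  golay₁ : GolayPair 1
  golay₁ = golayFromCorrelations (𝟙 ∷ []) (𝟙 ∷ [])

  golay₃ : GolayPair 3
  golay₃ = golayFromCorrelations (𝟙 ∷ 𝟙 ∷ -𝟙 ∷ []) (𝟙 ∷ 𝕚 ∷ 𝟙 ∷ [])

  golay₅ : GolayPair 5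
  golay₅ = golayFromCorrelations (𝟙 ∷ 𝟙 ∷ 𝟙 ∷ 𝕚 ∷ -𝕚 ∷ []) (𝟙 ∷ 𝕚 ∷ -𝕚 ∷ -𝟙 ∷ 𝕚 ∷ [])

  golay₁₁ : GolayPair 11
  golay₁₁ = golayFromCorrelations
    (𝟙 ∷ 𝕚 ∷ -𝟙 ∷ 𝟙 ∷ -𝟙 ∷ 𝕚 ∷ -𝕚 ∷ -𝟙 ∷ 𝕚 ∷ 𝕚 ∷ 𝟙 ∷ [])
    (𝟙 ∷ 𝟙 ∷ -𝕚 ∷ -𝕚 ∷ -𝕚 ∷ 𝟙 ∷ 𝟙 ∷ 𝕚 ∷ -𝟙 ∷ 𝟙 ∷ -𝟙 ∷ [])

  golay₁₃ : GolayPair 13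
  golay₁₃ = golayFromCorrelations
    (𝟙 ∷ 𝟙 ∷ 𝟙 ∷ 𝕚 ∷ -𝟙 ∷ 𝟙 ∷ 𝟙 ∷ -𝕚 ∷ 𝟙 ∷ -𝟙 ∷ 𝟙 ∷ -𝕚 ∷ 𝕚 ∷ [])
    (𝟙 ∷ 𝕚 ∷ -𝟙 ∷ -𝟙 ∷ -𝟙 ∷ 𝕚 ∷ -𝟙 ∷ 𝟙 ∷ 𝟙 ∷ -𝕚 ∷ -𝟙 ∷ 𝟙 ∷ -𝕚 ∷ [])

-- Hermitian matrices with scalar square over the group ring

module Patterns where
  open GolayPairs
  open import Data.List.Base using ([]; _∷_)
  open import Data.Vec.Base using ([]; _∷_; _++_)

  fourfold : ∀ m → (m ℕ.+ m) ℕ.+ (m ℕ.+ m) ≡ 4 ℕ.* m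
  fourfold m = ≡.trans (ℕₚ.+-assoc m m (m ℕ.+ m))
    (≡.cong (λ j → m ℕ.+ (m ℕ.+ (m ℕ.+ j))) (≡.sym (ℕₚ.+-identityʳ m)))

  -- A row restricted to one group element has a single nonzero entry, so its position `column` and
  -- its value replace the whole row vector.
  record Monomial (k t : ℕ) : Set where
    constructor monomial
    field
      unit     : Root
      var : Fin k
      column   : Vec Bool t

  open Monomial

  -- Over the group ring of the cyclic group of order 4p generated by z, a row of
  -- a matrix is a choice of one monomial for each group element. A cell at
  -- ζ = z^r collects those at ζ, J ζ⁻¹, J ζ and ζ⁻¹, where J = z^{2p}; the
  -- center collects those at 1, z^p, J and z^{-p}.
  Cell : ℕ → ℕ → Set
  Cell k t = Fin 4 → Vec Bool t → Monomial k t

  record Pattern (k t h : ℕ) : Set where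
    constructor mkPattern
    field
      center : Cell k t
      cells  : Vec (Cell k t) h

  open Pattern

  -- One Golay length in the decomposition of some u_i, or of u₁ - 1 for the first variable.
  record Block (k : ℕ) : Set₁ where
    constructor block
    field
      {size}   : ℕ
      var : Fin k
      pair     : GolayPair size

  open Block

  twist : Bool → Root → Root
  twist a (root s b) = root (a xor s) b

  -- The part M ⊗ E: both new bits are preserved, and the first one carries the sign of E = diag(1,
  -- 1, -1, -1).
  liftCell : ∀ {k t} → Cell k t → Cell k (suc (suc t))
  liftCell c q (a ∷ b ∷ ρ) = let m = c q ρ in
    monomial (twist a (unit m)) (var m) (a ∷ b ∷ column m)

  -- The rows of K, one group element at a time: ζ and ζ⁻¹ (0 and 3) carry the coefficients of the
  -- block X or X⋆ of the row, Jζ and Jζ⁻¹ (2 and 1) those of the block Y or Y⋆ with its sign.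
  newUnit : Root → Root → Bool → Bool → Fin 4 → Root
  newUnit α β false false 0F = α
  newUnit α β false false 1F = negate (conjugate β)
  newUnit α β false false 2F = α
  newUnit α β false false 3F = conjugate β
  newUnit α β false true  0F = β
  newUnit α β false true  1F = negate (conjugate α)
  newUnit α β false true  2F = β
  newUnit α β false true  3F = conjugate α
  newUnit α β true  false 0F = β
  newUnit α β true  false 1F = conjugate β
  newUnit α β true  false 2F = negate α
  newUnit α β true  false 3F = conjugate α
  newUnit α β true  true  0F = α
  newUnit α β true  true  1F = conjugate α
  newUnit α β true  true  2F = negate β
  newUnit α β true  true  3F = conjugate β

  crosses : Fin 4 → Bool
  crosses 0F = false
  crosses 1F = true
  crosses 2F = true
  crosses 3F = false

  newCell : ∀ {k t} → Fin k → Root → Root → Cell k (suc (suc t))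
  newCell v α β q (a ∷ b ∷ ρ) = monomial (newUnit α β a b q) v (not a ∷ (b xor crosses q) ∷ ρ)

  -- M ↦ ( M  0   X  Y
  --       0  M  -Y⋆ X⋆
  --       X⋆ -Y -M  0
  --       Y⋆ X   0 -M ), where X = P + N and Y = J (P - N) with P = ζ A(z) and
  -- N = (ζ B(z))⋆, so that X X⋆ + Y Y⋆ = 2 (A A⋆ + B B⋆), J being an involution.
  -- In each row, every group element occurs in exactly one of the new entries.
  extend : ∀ {k t h} (b : Block k) → Pattern k t h → Pattern k (suc (suc t)) (size b ℕ.+ h)
  extend (block v (A , B , _)) (mkPattern c cs) =
    mkPattern (liftCell c) (Vec.zipWith (newCell v) A B ++ Vec.map liftCell cs)

  padCell : ∀ {k t} → Cell k t → Cell k (suc t)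
  padCell c q (b ∷ ρ) = let m = c q ρ in monomial (unit m) (var m) (b ∷ column m)

  pad : ∀ {k t h} → Pattern k t h → Pattern k (suc t) h
  pad (mkPattern c cs) = mkPattern (padCell c) (Vec.map padCell cs)

  baseColumn : Fin 4 → Bool → Bool
  baseColumn q b = b xor parity q
    where
    parity : Fin 4 → Bool
    parity 0F = false
    parity 1F = true
    parity 2F = false
    parity 3F = true

  baseSign : Fin 4 → Bool → Bool
  baseSign 3F b = not b
  baseSign _  b = b

  -- The matrix with rows (1 + J, c - c⁻¹) and (c⁻¹ - c, -(1 + J)), times the variable, where c =
  -- z^p. Since c² = c⁻² = J, its square is (2 + 2J) + (2 - 2J) = 4 times the square of the
  -- variable.
  base : ∀ {k} → Fin k → Pattern k 1 0
  base v = mkPattern (λ { q (b ∷ []) → monomial (root (baseSign q b) false) v (baseColumn q b ∷ []) }) []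

  -- Abstracting the arithmetic lets one description of E and K be read both in a ring and as solver
  -- polynomials; for fixed bits the two readings agree by computation.
  record Operations (A : Set) : Set where
    infixl 6 _⊹_
    infixl 7 _⋅_
    field
      𝟎 𝟏 : A
      _⊹_ _⋅_ : A → A → A
      ⊖_ : A → A

    δᵇ : Bool → Bool → A
    δᵇ a b = if a xor b then 𝟎 else 𝟏

    sign : Bool → A
    sign false = 𝟏
    sign true  = ⊖ 𝟏

    diagonal : Bool → Bool → Bool → Bool → A
    diagonal a b c d = sign a ⋅ (δᵇ a c ⋅ δᵇ b d)

    module _ (X X′ Y Y′ : A) where
      straight crossed : Bool → Bool → A
      straight false false = X
      straight false true  = X′
      straight true  false = X′
      straight true  true  = X
      crossed false false = Y
      crossed false true  = ⊖ Y′
      crossed true  false = ⊖ Y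
      crossed true  true  = Y′

      -- The matrix K with row bits a, b and column bits c, d. Here X′ and Y′ stand for X⋆ and Y⋆,
      -- which solver polynomials can treat only as further variables.
      kernel : Bool → Bool → Bool → Bool → A
      kernel a b c d = δᵇ (not a) c ⋅ (δᵇ b d ⋅ straight a b ⊹ δᵇ (not b) d ⋅ crossed a b)

    Σ₄ : (Bool → Bool → A) → A
    Σ₄ f = (f false false ⊹ f false true) ⊹ (f true false ⊹ f true true)

  module BooleanSums (R : CommutativeRing 0ℓ 0ℓ) where
    open CommutativeRing R hiding (zero)
    open IntegerSolver R

    operations : Operations Carrier
    operations = record { 𝟎 = 0# ; 𝟏 = 1# ; _⊹_ = _+_ ; _⋅_ = _*_ ; ⊖_ = -_ }

    polynomials : ∀ n → Operations (Polynomial n)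
    polynomials n = record { 𝟎 = :0 ; 𝟏 = :1 ; _⊹_ = _:+_ ; _⋅_ = _:*_ ; ⊖_ = :-_ }

    open Operations operations public
    module Poly {n} = Operations (polynomials n)

    δ : ∀ {t} → Vec Bool t → Vec Bool t → Carrier
    δ [] [] = 1#
    δ (a ∷ ρ) (b ∷ σ) = δᵇ a b * δ ρ σ

    ∑ : ∀ t → (Vec Bool t → Carrier) → Carrier
    ∑ zero f = f []
    ∑ (suc t) f = ∑ t (λ σ → f (false ∷ σ)) + ∑ t (λ σ → f (true ∷ σ))

    ∑-cong : ∀ t {f g} → (∀ σ → f σ ≈ g σ) → ∑ t f ≈ ∑ t g
    ∑-cong zero e = e []
    ∑-cong (suc t) e = +-cong (∑-cong t λ σ → e (false ∷ σ)) (∑-cong t λ σ → e (true ∷ σ))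

    ∑-+ : ∀ t f g → ∑ t (λ σ → f σ + g σ) ≈ ∑ t f + ∑ t g
    ∑-+ zero f g = refl
    ∑-+ (suc t) f g = trans (+-cong (∑-+ t _ _) (∑-+ t _ _))
      (solve 4 (λ a b c d → (a :+ b) :+ (c :+ d) := (a :+ c) :+ (b :+ d)) refl _ _ _ _)

    ∑-* : ∀ t r f → ∑ t (λ σ → r * f σ) ≈ r * ∑ t f
    ∑-* zero r f = refl
    ∑-* (suc t) r f = trans (+-cong (∑-* t r _) (∑-* t r _)) (sym (distribˡ r _ _))

    ∑-δ : ∀ t ρ f → ∑ t (λ σ → δ ρ σ * f σ) ≈ f ρ
    ∑-δ zero [] f = *-identityˡ _
    ∑-δ (suc t) (false ∷ ρ) f = trans
      (+-cong (trans (∑-cong t λ σ → *-congʳ (*-identityˡ (δ ρ σ))) (∑-δ t ρ (λ σ → f (false ∷ σ))))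
              (trans (∑-cong t λ σ → *-assoc 0# (δ ρ σ) (f (true ∷ σ))) (trans (∑-* t 0# _) (zeroˡ _))))
      (+-identityʳ _)
    ∑-δ (suc t) (true ∷ ρ) f = trans
      (+-cong (trans (∑-cong t λ σ → *-assoc 0# (δ ρ σ) (f (false ∷ σ))) (trans (∑-* t 0# _) (zeroˡ _)))
              (trans (∑-cong t λ σ → *-congʳ (*-identityˡ (δ ρ σ))) (∑-δ t ρ (λ σ → f (true ∷ σ)))))
      (+-identityˡ _)

    δᵇ-sym : ∀ a b → δᵇ a b ≡ δᵇ b a
    δᵇ-sym false false = ≡.refl
    δᵇ-sym false true  = ≡.refl
    δᵇ-sym true  false = ≡.refl
    δᵇ-sym true  true  = ≡.refl

    δ-sym : ∀ {t} (ρ σ : Vec Bool t) → δ ρ σ ≡ δ σ ρ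
    δ-sym [] [] = ≡.refl
    δ-sym (a ∷ ρ) (b ∷ σ) = ≡.cong₂ _*_ (δᵇ-sym a b) (δ-sym ρ σ)

  pattern O = false
  pattern I = true

  module Matrices (C : ComplexRing) {k : ℕ} (x : Fin k → ComplexRing.Carrier C) where
    open ComplexRing C hiding (zero)
    open Evaluation C
    open Algebra.Properties.Semiring.Exp semiring using (_^_)
    open Algebra.Properties.Semiring.Mult semiring using (×-homo-+; ×-comm-*; ×-congʳ) renaming (_×_ to _×ᴿ_)
    open IntegerSolver commutativeRing
    open Relation.Binary.Reasoning.Setoid setoid

    open BooleanSums commutativeRing public

    δᵇ-⋆ : ∀ a b → δᵇ a b ⋆ ≈ δᵇ a b
    δᵇ-⋆ false false = ⋆-1
    δᵇ-⋆ false true  = ⋆-0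
    δᵇ-⋆ true  false = ⋆-0
    δᵇ-⋆ true  true  = ⋆-1

    δ-⋆ : ∀ {t} (ρ σ : Vec Bool t) → δ ρ σ ⋆ ≈ δ ρ σ
    δ-⋆ [] [] = ⋆-1
    δ-⋆ (a ∷ ρ) (b ∷ σ) = trans (⋆-* _ _) (*-cong (δᵇ-⋆ a b) (δ-⋆ ρ σ))

    entry : ∀ {t} → Monomial k t → Vec Bool t → Carrier
    entry m σ = ⟦ unit m ⟧ * x (var m) * δ (column m) σ

    sgn-twist : ∀ a u → ⟦ twist a u ⟧ ≈ sgn a * ⟦ u ⟧
    sgn-twist a (root s b) = trans (*-congʳ (sgn-xor a s)) (*-assoc _ _ _)

    sign≡sgn : ∀ a → sign a ≡ sgn a
    sign≡sgn false = ≡.refl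
    sign≡sgn true  = ≡.refl

    -- The induction needs of c only that it is unitary and that c² is fixed by the star. That c is
    -- z^p matters only when the powers of z are collected.
    module At (z c : Carrier) where
      J : Carrier
      J = c * c

      centerEval : ∀ {t} → Cell k t → Vec Bool t → Vec Bool t → Carrier
      centerEval m ρ σ = entry (m 0F ρ) σ * 1# + entry (m 1F ρ) σ * c + entry (m 2F ρ) σ * J + entry (m 3F ρ) σ * c ⋆

      cellEval : ∀ {t} → Carrier → Cell k t → Vec Bool t → Vec Bool t → Carrier
      cellEval ζ m ρ σ = entry (m 0F ρ) σ * ζ + entry (m 1F ρ) σ * (J * ζ ⋆) + entry (m 2F ρ) σ * (J * ζ) + entry (m 3F ρ) σ * ζ ⋆

      -- Successive cells belong to ζ, ζz, ζz² and so on. The free start ζ absorbs the shift that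
      -- occurs when a pair is put in front.
      cellsEval : ∀ {t h} → Carrier → Vec (Cell k t) h → Vec Bool t → Vec Bool t → Carrier
      cellsEval ζ [] ρ σ = 0#
      cellsEval ζ (m ∷ ms) ρ σ = cellEval ζ m ρ σ + cellsEval (ζ * z) ms ρ σ

      cellsEval-cong : ∀ {t h ζ ξ} (ms : Vec (Cell k t) h) ρ σ → ζ ≈ ξ → cellsEval ζ ms ρ σ ≈ cellsEval ξ ms ρ σ
      cellsEval-cong [] ρ σ e = refl
      cellsEval-cong (m ∷ ms) ρ σ e = +-cong
        (+-cong (+-cong (+-cong (*-congˡ e) (*-congˡ (*-congˡ (⋆-cong e)))) (*-congˡ (*-congˡ e))) (*-congˡ (⋆-cong e)))
        (cellsEval-cong ms ρ σ (*-congʳ e))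

      cellsEval-++ : ∀ {t h l} ζ (ms : Vec (Cell k t) h) (ns : Vec (Cell k t) l) ρ σ →
        cellsEval ζ (ms ++ ns) ρ σ ≈ cellsEval ζ ms ρ σ + cellsEval (ζ * z ^ h) ns ρ σ
      cellsEval-++ ζ [] ns ρ σ = trans (cellsEval-cong ns ρ σ (sym (*-identityʳ ζ))) (sym (+-identityˡ _))
      cellsEval-++ {h = suc h} ζ (m ∷ ms) ns ρ σ = trans
        (+-congˡ (trans (cellsEval-++ (ζ * z) ms ns ρ σ)
          (+-congˡ (cellsEval-cong ns ρ σ (*-assoc ζ z (z ^ h))))))
        (sym (+-assoc _ _ _))

      matrix : ∀ {t h} → Carrier → Pattern k t h → Vec Bool t → Vec Bool t → Carrier
      matrix ζ D ρ σ = centerEval (center D) ρ σ + cellsEval ζ (cells D) ρ σ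

      combine-scaled : ∀ s a b c d p q r u {a′ b′ c′ d′} →
        a′ ≈ s * a → b′ ≈ s * b → c′ ≈ s * c → d′ ≈ s * d →
        a′ * p + b′ * q + c′ * r + d′ * u ≈ s * (a * p + b * q + c * r + d * u)
      combine-scaled s a b c d p q r u ea eb ec ed = trans
        (+-cong (+-cong (+-cong (*-congʳ ea) (*-congʳ eb)) (*-congʳ ec)) (*-congʳ ed))
        (solve 9 (λ s a b c d p q r u → s :* a :* p :+ s :* b :* q :+ s :* c :* r :+ s :* d :* u
                                     := s :* (a :* p :+ b :* q :+ c :* r :+ d :* u)) refl s a b c d p q r u)

      -- Lifting and padding change an entry by a factor that is the same at all group elements, so
      -- they multiply whole matrix entries by it.
      module Scaled {t t′} (f : Cell k t → Cell k t′) (ρ σ : Vec Bool t) (ρ′ σ′ : Vec Bool t′) (s : Carrier)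
                    (scaled : ∀ c q → entry (f c q ρ′) σ′ ≈ s * entry (c q ρ) σ) where

        cell-scaled : ∀ ζ m → cellEval ζ (f m) ρ′ σ′ ≈ s * cellEval ζ m ρ σ
        cell-scaled ζ m = combine-scaled s _ _ _ _ _ _ _ _ (scaled m 0F) (scaled m 1F) (scaled m 2F) (scaled m 3F)

        center-scaled : ∀ m → centerEval (f m) ρ′ σ′ ≈ s * centerEval m ρ σ
        center-scaled m = combine-scaled s _ _ _ _ _ _ _ _ (scaled m 0F) (scaled m 1F) (scaled m 2F) (scaled m 3F)

        cells-scaled : ∀ {h} ζ (ms : Vec (Cell k t) h) → cellsEval ζ (Vec.map f ms) ρ′ σ′ ≈ s * cellsEval ζ ms ρ σ
        cells-scaled ζ [] = sym (zeroʳ s)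
        cells-scaled ζ (m ∷ ms) = trans (+-cong (cell-scaled ζ m) (cells-scaled (ζ * z) ms)) (sym (distribˡ s _ _))

      lift-entry : ∀ {t} a b c d (ρ σ : Vec Bool t) m q →
        entry (liftCell m q (a ∷ b ∷ ρ)) (c ∷ d ∷ σ) ≈ diagonal a b c d * entry (m q ρ) σ
      lift-entry a b c d ρ σ m q = trans (*-congʳ (*-congʳ (sgn-twist a (unit (m q ρ)))))
        (trans (reflexive (≡.cong (λ s → s * ⟦ unit (m q ρ) ⟧ * x (var (m q ρ)) * δ (a ∷ b ∷ column (m q ρ)) (c ∷ d ∷ σ)) (≡.sym (sign≡sgn a))))
        (solve 6 (λ s u x e f d → s :* u :* x :* (e :* (f :* d)) := s :* (e :* f) :* (u :* x :* d)) refl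
          (sign a) ⟦ unit (m q ρ) ⟧ (x (var (m q ρ))) (δᵇ a c) (δᵇ b d) (δ (column (m q ρ)) σ)))


      kern : Carrier → Carrier → Carrier → Carrier → Bool → Bool → Bool → Bool → Carrier
      kern P P′ N N′ = kernel (P + N) (P′ + N′) (J * (P - N)) (J * (P′ - N′))

      kernel-cong : ∀ {X X₁ X′ X′₁ Y Y₁ Y′ Y′₁} a b c d → X ≈ X₁ → X′ ≈ X′₁ → Y ≈ Y₁ → Y′ ≈ Y′₁ →
                    kernel X X′ Y Y′ a b c d ≈ kernel X₁ X′₁ Y₁ Y′₁ a b c d
      kernel-cong false false c d e e′ f f′ = *-congˡ (+-cong (*-congˡ e) (*-congˡ f))
      kernel-cong false true  c d e e′ f f′ = *-congˡ (+-cong (*-congˡ e′) (*-congˡ (-‿cong f′)))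
      kernel-cong true  false c d e e′ f f′ = *-congˡ (+-cong (*-congˡ e′) (*-congˡ (-‿cong f)))
      kernel-cong true  true  c d e e′ f f′ = *-congˡ (+-cong (*-congˡ e) (*-congˡ f′))

      kern-cong : ∀ {P P₁ P′ P′₁ N N₁ N′ N′₁} a b c d → P ≈ P₁ → P′ ≈ P′₁ → N ≈ N₁ → N′ ≈ N′₁ →
                  kern P P′ N N′ a b c d ≈ kern P₁ P′₁ N₁ N′₁ a b c d
      kern-cong a b c d p p′ n n′ = kernel-cong a b c d (+-cong p n) (+-cong p′ n′)
        (*-congˡ (+-cong p (-‿cong n))) (*-congˡ (+-cong p′ (-‿cong n′)))

      kern-0 : ∀ a b c d → kern 0# 0# 0# 0# a b c d ≈ 0#
      kern-0 a b c d = trans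
        (kernel-cong {X₁ = 0#} {X′₁ = 0#} {Y₁ = 0#} {Y′₁ = 0#} a b c d
           (+-identityˡ 0#) (+-identityˡ 0#) 0Y 0Y)
        (zeroes a b)
        where
        0Y : J * (0# - 0#) ≈ 0#
        0Y = trans (*-congˡ (-‿inverseʳ 0#)) (zeroʳ J)
        z3 = solve 3 (λ e f g → e :* (f :* :0 :+ g :* :0) := :0) refl
        z3′ = solve 3 (λ e f g → e :* (f :* :0 :+ g :* (:- :0)) := :0) refl
        zeroes : ∀ a b → kernel 0# 0# 0# 0# a b c d ≈ 0#
        zeroes false false = z3 (δᵇ true c) (δᵇ false d) (δᵇ true d)
        zeroes false true  = z3′ (δᵇ true c) (δᵇ true d) (δᵇ false d)
        zeroes true  false = z3′ (δᵇ false c) (δᵇ false d) (δᵇ true d)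
        zeroes true  true  = z3 (δᵇ false c) (δᵇ true d) (δᵇ false d)

      -- With the Kronecker symbols as variables, only a and b need to be split.
      kernᴾ : ∀ {n} → Bool → Bool → (J P P′ N N′ e f g : Polynomial n) → Polynomial n
      kernᴾ a b J P P′ N N′ e f g =
        e :* (f :* Poly.straight (P :+ N) (P′ :+ N′) (J :* (P :- N)) (J :* (P′ :- N′)) a b
           :+ g :* Poly.crossed (P :+ N) (P′ :+ N′) (J :* (P :- N)) (J :* (P′ :- N′)) a b)

      kern-+ᴾ : Bool → Bool → _
      kern-+ᴾ a b = λ J P P′ N N′ Q Q′ R R′ e f g →
        kernᴾ {12} a b J P P′ N N′ e f g :+ kernᴾ a b J Q Q′ R R′ e f g
          := kernᴾ a b J (P :+ Q) (P′ :+ Q′) (N :+ R) (N′ :+ R′) e f g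

      kern-+ : ∀ P P′ N N′ Q Q′ R R′ a b c d →
        kern P P′ N N′ a b c d + kern Q Q′ R R′ a b c d ≈ kern (P + Q) (P′ + Q′) (N + R) (N′ + R′) a b c d
      kern-+ P P′ N N′ Q Q′ R R′ false false c d = solve 12 (kern-+ᴾ false false) refl J P P′ N N′ Q Q′ R R′ (δᵇ true c) (δᵇ false d) (δᵇ true d)
      kern-+ P P′ N N′ Q Q′ R R′ false true c d = solve 12 (kern-+ᴾ false true) refl J P P′ N N′ Q Q′ R R′ (δᵇ true c) (δᵇ true d) (δᵇ false d)
      kern-+ P P′ N N′ Q Q′ R R′ true  false c d = solve 12 (kern-+ᴾ true false) refl J P P′ N N′ Q Q′ R R′ (δᵇ false c) (δᵇ false d) (δᵇ true d)
      kern-+ P P′ N N′ Q Q′ R R′ true  true c d = solve 12 (kern-+ᴾ true true) refl J P P′ N N′ Q Q′ R R′ (δᵇ false c) (δᵇ true d) (δᵇ false d)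

      module _ {t} (v : Fin k) (ρ σ : Vec Bool t) where

        ⟦negate-conjugate⟧ : ∀ u → ⟦ negate (conjugate u) ⟧ ≈ - ⟦ u ⟧ ⋆
        ⟦negate-conjugate⟧ u = trans (⟦negate⟧ (conjugate u)) (-‿cong (⟦conjugate⟧ u))

        NewCellEval : Carrier → Root → Root → Bool → Bool → Bool → Bool → Set
        NewCellEval ζ α β a b c d =
          cellEval ζ (newCell v α β) (a ∷ b ∷ ρ) (c ∷ d ∷ σ)
            ≈ x v * (kern (ζ * ⟦ α ⟧) (ζ ⋆ * ⟦ α ⟧ ⋆) (ζ ⋆ * ⟦ β ⟧ ⋆) (ζ * ⟦ β ⟧) a b c d * δ ρ σ)

        newCell-eval : ∀ ζ α β a b c d → NewCellEval ζ α β a b c d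
        newCell-eval ζ α β a b c d = go a b
          where
          -- The roots of the table are first replaced by their values, because the solver treats a
          -- root and its conjugate as independent variables.
          four : ∀ e f g {u₀ u₁ u₂ u₃ w₀ w₁ w₂ w₃} → u₀ ≈ w₀ → u₁ ≈ w₁ → u₂ ≈ w₂ → u₃ ≈ w₃ →
            u₀ * x v * (e * (f * δ ρ σ)) * ζ + u₁ * x v * (e * (g * δ ρ σ)) * (J * ζ ⋆)
              + u₂ * x v * (e * (g * δ ρ σ)) * (J * ζ) + u₃ * x v * (e * (f * δ ρ σ)) * ζ ⋆
            ≈ w₀ * x v * (e * (f * δ ρ σ)) * ζ + w₁ * x v * (e * (g * δ ρ σ)) * (J * ζ ⋆)
              + w₂ * x v * (e * (g * δ ρ σ)) * (J * ζ) + w₃ * x v * (e * (f * δ ρ σ)) * ζ ⋆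
          four e f g p q r s = +-cong (+-cong (+-cong
            (*-congʳ (*-congʳ (*-congʳ p))) (*-congʳ (*-congʳ (*-congʳ q))))
            (*-congʳ (*-congʳ (*-congʳ r)))) (*-congʳ (*-congʳ (*-congʳ s)))
          eq : ∀ {n} → Bool → Bool → (u₀ u₁ u₂ u₃ J α α′ β β′ ζ ζ′ x e f g δ : Polynomial n) → _
          eq a b u₀ u₁ u₂ u₃ J α α′ β β′ ζ ζ′ x e f g δ =
            u₀ :* x :* (e :* (f :* δ)) :* ζ :+ u₁ :* x :* (e :* (g :* δ)) :* (J :* ζ′)
              :+ u₂ :* x :* (e :* (g :* δ)) :* (J :* ζ) :+ u₃ :* x :* (e :* (f :* δ)) :* ζ′
              := x :* (kernᴾ a b J (ζ :* α) (ζ′ :* α′) (ζ′ :* β′) (ζ :* β) e f g :* δ)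
          go : ∀ a b → NewCellEval ζ α β a b c d
          go false false = trans (four (δᵇ true c) (δᵇ false d) (δᵇ true d) refl (⟦negate-conjugate⟧ β) refl (⟦conjugate⟧ β))
            (solve 12 (λ J α α′ β β′ → eq false false α (:- β′) α β′ J α α′ β β′) refl
              J ⟦ α ⟧ (⟦ α ⟧ ⋆) ⟦ β ⟧ (⟦ β ⟧ ⋆) ζ (ζ ⋆) (x v) (δᵇ true c) (δᵇ false d) (δᵇ true d) (δ ρ σ))
          go false true = trans (four (δᵇ true c) (δᵇ true d) (δᵇ false d) refl (⟦negate-conjugate⟧ α) refl (⟦conjugate⟧ α))
            (solve 12 (λ J α α′ β β′ → eq false true β (:- α′) β α′ J α α′ β β′) refl
              J ⟦ α ⟧ (⟦ α ⟧ ⋆) ⟦ β ⟧ (⟦ β ⟧ ⋆) ζ (ζ ⋆) (x v) (δᵇ true c) (δᵇ true d) (δᵇ false d) (δ ρ σ))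
          go true false = trans (four (δᵇ false c) (δᵇ false d) (δᵇ true d) refl (⟦conjugate⟧ β) (⟦negate⟧ α) (⟦conjugate⟧ α))
            (solve 12 (λ J α α′ β β′ → eq true false β β′ (:- α) α′ J α α′ β β′) refl
              J ⟦ α ⟧ (⟦ α ⟧ ⋆) ⟦ β ⟧ (⟦ β ⟧ ⋆) ζ (ζ ⋆) (x v) (δᵇ false c) (δᵇ false d) (δᵇ true d) (δ ρ σ))
          go true true = trans (four (δᵇ false c) (δᵇ true d) (δᵇ false d) refl (⟦conjugate⟧ α) (⟦negate⟧ β) (⟦conjugate⟧ β))
            (solve 12 (λ J α α′ β β′ → eq true true α α′ (:- β) β′ J α α′ β β′) refl
              J ⟦ α ⟧ (⟦ α ⟧ ⋆) ⟦ β ⟧ (⟦ β ⟧ ⋆) ζ (ζ ⋆) (x v) (δᵇ false c) (δᵇ true d) (δᵇ false d) (δ ρ σ))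

        -- K is additive in P, N and their conjugates, so the single cells add up to the values of
        -- the two Golay polynomials.
        newCells-eval : ∀ {m} ζ (A B : Vec Root m) a b c d →
          cellsEval ζ (Vec.zipWith (newCell v) A B) (a ∷ b ∷ ρ) (c ∷ d ∷ σ)
            ≈ x v * (kern (ζ * eval z A) (ζ ⋆ * eval z A ⋆) (ζ ⋆ * eval z B ⋆) (ζ * eval z B) a b c d * δ ρ σ)
        newCells-eval ζ [] [] a b c d = sym (trans (*-congˡ (trans (*-congʳ
          (trans (kern-cong a b c d (zeroʳ ζ) 0⋆ 0⋆ (zeroʳ ζ)) (kern-0 a b c d))) (zeroˡ _))) (zeroʳ _))
          where
          0⋆ : ζ ⋆ * 0# ⋆ ≈ 0#
          0⋆ = trans (*-congˡ ⋆-0) (zeroʳ _)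
        newCells-eval ζ (α ∷ A) (β ∷ B) a b c d = begin
          cellEval ζ (newCell v α β) (a ∷ b ∷ ρ) (c ∷ d ∷ σ) + cellsEval (ζ * z) (Vec.zipWith (newCell v) A B) (a ∷ b ∷ ρ) (c ∷ d ∷ σ)
            ≈⟨ +-cong (newCell-eval ζ α β a b c d) (newCells-eval (ζ * z) A B a b c d) ⟩
          x v * (k₁ * δ ρ σ) + x v * (k₂ * δ ρ σ)
            ≈⟨ solve 4 (λ x p q d → x :* (p :* d) :+ x :* (q :* d) := x :* ((p :+ q) :* d)) refl (x v) k₁ k₂ (δ ρ σ) ⟩
          x v * ((k₁ + k₂) * δ ρ σ)
            ≈⟨ *-congˡ (*-congʳ (trans (kern-+ _ _ _ _ _ _ _ _ a b c d)
                 (kern-cong a b c d (plain α A) (starred α A) (starred β B) (plain β B)))) ⟩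
          x v * (kern (ζ * eval z (α ∷ A)) (ζ ⋆ * eval z (α ∷ A) ⋆) (ζ ⋆ * eval z (β ∷ B) ⋆) (ζ * eval z (β ∷ B)) a b c d * δ ρ σ) ∎
          where
          k₁ = kern (ζ * ⟦ α ⟧) (ζ ⋆ * ⟦ α ⟧ ⋆) (ζ ⋆ * ⟦ β ⟧ ⋆) (ζ * ⟦ β ⟧) a b c d
          k₂ = kern (ζ * z * eval z A) ((ζ * z) ⋆ * eval z A ⋆) ((ζ * z) ⋆ * eval z B ⋆) (ζ * z * eval z B) a b c d
          plain : ∀ {m} γ (G : Vec Root m) → ζ * ⟦ γ ⟧ + ζ * z * eval z G ≈ ζ * eval z (γ ∷ G)
          plain γ G = trans (+-congˡ (*-assoc _ _ _)) (sym (distribˡ _ _ _))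
          starred : ∀ {m} γ (G : Vec Root m) → ζ ⋆ * ⟦ γ ⟧ ⋆ + (ζ * z) ⋆ * eval z G ⋆ ≈ ζ ⋆ * eval z (γ ∷ G) ⋆
          starred γ G = trans (+-congˡ (trans (*-congʳ (⋆-* ζ z)) (*-assoc _ _ _)))
            (trans (sym (distribˡ _ _ _)) (*-congˡ (sym (eval-∷-⋆ z γ G))))

      Hermitian : ∀ {t} → (Vec Bool t → Vec Bool t → Carrier) → Set
      Hermitian M = ∀ ρ σ → M ρ σ ⋆ ≈ M σ ρ

      -- For Hermitian M this says that M² is the scalar W.
      HasGram : ∀ {t} → Carrier → (Vec Bool t → Vec Bool t → Carrier) → Set
      HasGram {t} W M = ∀ ρ ρ′ → ∑ t (λ σ → M ρ σ * M ρ′ σ ⋆) ≈ W * δ ρ ρ′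

      module Extension {t} (M : Vec Bool t → Vec Bool t → Carrier) (W v X X′ Y Y′ : Carrier)
        (hermitian : Hermitian M) (gram : HasGram W M) (v-real : v ⋆ ≈ v)
        (X⋆ : X ⋆ ≈ X′) (X′⋆ : X′ ⋆ ≈ X) (Y⋆ : Y ⋆ ≈ Y′) (Y′⋆ : Y′ ⋆ ≈ Y) where

        extended : Vec Bool (suc (suc t)) → Vec Bool (suc (suc t)) → Carrier
        extended (a ∷ b ∷ ρ) (c ∷ d ∷ σ) = diagonal a b c d * M ρ σ + v * (kernel X X′ Y Y′ a b c d * δ ρ σ)

        straight-⋆ : ∀ a b → straight X X′ Y Y′ a b ⋆ ≈ straight X′ X Y′ Y a b
        straight-⋆ false false = X⋆
        straight-⋆ false true  = X′⋆
        straight-⋆ true  false = X′⋆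
        straight-⋆ true  true  = X⋆

        crossed-⋆ : ∀ a b → crossed X X′ Y Y′ a b ⋆ ≈ crossed X′ X Y′ Y a b
        crossed-⋆ false false = Y⋆
        crossed-⋆ false true  = trans (⋆-neg _) (-‿cong Y′⋆)
        crossed-⋆ true  false = trans (⋆-neg _) (-‿cong Y⋆)
        crossed-⋆ true  true  = Y′⋆

        kernel-⋆ : ∀ a b c d → kernel X X′ Y Y′ a b c d ⋆ ≈ kernel X′ X Y′ Y a b c d
        kernel-⋆ a b c d = trans (⋆-* _ _) (*-cong (δᵇ-⋆ (not a) c) (trans (⋆-+ _ _)
          (+-cong (trans (⋆-* _ _) (*-cong (δᵇ-⋆ b d) (straight-⋆ a b)))
                  (trans (⋆-* _ _) (*-cong (δᵇ-⋆ (not b) d) (crossed-⋆ a b))))))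

        diagonal-⋆ : ∀ a b c d → diagonal a b c d ⋆ ≈ diagonal a b c d
        diagonal-⋆ a b c d = trans (⋆-* _ _) (*-cong
          (trans (⋆-cong (reflexive (sign≡sgn a))) (trans (sgn-⋆ a) (reflexive (≡.sym (sign≡sgn a)))))
          (trans (⋆-* _ _) (*-cong (δᵇ-⋆ a c) (δᵇ-⋆ b d))))

        extended-⋆ : ∀ a b c d ρ σ → extended (a ∷ b ∷ ρ) (c ∷ d ∷ σ) ⋆
                       ≈ diagonal a b c d * M ρ σ ⋆ + v * (kernel X′ X Y′ Y a b c d * δ ρ σ)
        extended-⋆ a b c d ρ σ = trans (⋆-+ _ _) (+-cong
          (trans (⋆-* _ _) (*-congʳ (diagonal-⋆ a b c d)))
          (trans (⋆-* _ _) (*-cong v-real (trans (⋆-* _ _) (*-cong (kernel-⋆ a b c d) (δ-⋆ ρ σ))))))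

        Transposed : Bool → Bool → Bool → Bool → Carrier → Carrier → Set
        Transposed a b c d M D =
          diagonal a b c d * M + v * (kernel X′ X Y′ Y a b c d * D)
            ≈ diagonal c d a b * M + v * (kernel X X′ Y Y′ c d a b * D)

        transposed : ∀ a b c d M D → Transposed a b c d M D
        transposed a b c d M D = go a b c d
          where
          eq : (a b c d : Bool) (v X X′ Y Y′ M D : Polynomial 7) → _
          eq a b c d v X X′ Y Y′ M D =
            Poly.diagonal a b c d :* M :+ v :* (Poly.kernel X′ X Y′ Y a b c d :* D)
              := Poly.diagonal c d a b :* M :+ v :* (Poly.kernel X X′ Y Y′ c d a b :* D)
          go : ∀ a b c d → Transposed a b c d M D
          go O O O O = solve 7 (eq O O O O) refl v X X′ Y Y′ M D
          go O O O I = solve 7 (eq O O O I) refl v X X′ Y Y′ M D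
          go O O I O = solve 7 (eq O O I O) refl v X X′ Y Y′ M D
          go O O I I = solve 7 (eq O O I I) refl v X X′ Y Y′ M D
          go O I O O = solve 7 (eq O I O O) refl v X X′ Y Y′ M D
          go O I O I = solve 7 (eq O I O I) refl v X X′ Y Y′ M D
          go O I I O = solve 7 (eq O I I O) refl v X X′ Y Y′ M D
          go O I I I = solve 7 (eq O I I I) refl v X X′ Y Y′ M D
          go I O O O = solve 7 (eq I O O O) refl v X X′ Y Y′ M D
          go I O O I = solve 7 (eq I O O I) refl v X X′ Y Y′ M D
          go I O I O = solve 7 (eq I O I O) refl v X X′ Y Y′ M D
          go I O I I = solve 7 (eq I O I I) refl v X X′ Y Y′ M D
          go I I O O = solve 7 (eq I I O O) refl v X X′ Y Y′ M D
          go I I O I = solve 7 (eq I I O I) refl v X X′ Y Y′ M D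
          go I I I O = solve 7 (eq I I I O) refl v X X′ Y Y′ M D
          go I I I I = solve 7 (eq I I I I) refl v X X′ Y Y′ M D

        extended-hermitian : Hermitian extended
        extended-hermitian (a ∷ b ∷ ρ) (c ∷ d ∷ σ) = begin
          extended (a ∷ b ∷ ρ) (c ∷ d ∷ σ) ⋆
            ≈⟨ extended-⋆ a b c d ρ σ ⟩
          diagonal a b c d * M ρ σ ⋆ + v * (kernel X′ X Y′ Y a b c d * δ ρ σ)
            ≈⟨ transposed a b c d (M ρ σ ⋆) (δ ρ σ) ⟩
          diagonal c d a b * M ρ σ ⋆ + v * (kernel X X′ Y Y′ c d a b * δ ρ σ)
            ≈⟨ +-cong (*-congˡ (hermitian ρ σ)) (*-congˡ (*-congˡ (reflexive (δ-sym ρ σ)))) ⟩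
          diagonal c d a b * M σ ρ + v * (kernel X X′ Y Y′ c d a b * δ σ ρ) ∎

        -- Within one block, a row of the extended matrix is s times a row of M plus vy times a unit
        -- vector. Because M is Hermitian, both mixed sums are multiples of the same entry `M ρ ρ′`,
        -- which is what allows them to cancel between blocks.
        innerProduct : ∀ ρ ρ′ s y s′ y′ →
          ∑ t (λ σ → (s * M ρ σ + v * (y * δ ρ σ)) * (s′ * M ρ′ σ ⋆ + v * (y′ * δ ρ′ σ)))
            ≈ (s * s′ * W + v * v * (y * y′)) * δ ρ ρ′ + v * (s * y′ + y * s′) * M ρ ρ′
        innerProduct ρ ρ′ s y s′ y′ = begin
          ∑ t (λ σ → (s * M ρ σ + v * (y * δ ρ σ)) * (s′ * M ρ′ σ ⋆ + v * (y′ * δ ρ′ σ)))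
            ≈⟨ ∑-cong t (λ σ → solve 9 (λ v s y s′ y′ m d m′ d′ →
                 (s :* m :+ v :* (y :* d)) :* (s′ :* m′ :+ v :* (y′ :* d′))
                   := s :* s′ :* (m :* m′) :+ (v :* v :* (y :* y′) :* (d :* d′)
                      :+ (v :* (s :* y′) :* (d′ :* m) :+ v :* (y :* s′) :* (d :* m′))))
                 refl v s y s′ y′ (M ρ σ) (δ ρ σ) (M ρ′ σ ⋆) (δ ρ′ σ)) ⟩
          ∑ t (λ σ → s * s′ * (M ρ σ * M ρ′ σ ⋆) + (v * v * (y * y′) * (δ ρ σ * δ ρ′ σ)
                      + (v * (s * y′) * (δ ρ′ σ * M ρ σ) + v * (y * s′) * (δ ρ σ * M ρ′ σ ⋆))))
            ≈⟨ trans (∑-+ t _ _) (+-cong (∑-* t _ _) (trans (∑-+ t _ _) (+-cong (∑-* t _ _) (trans (∑-+ t _ _) (+-cong (∑-* t _ _) (∑-* t _ _)))))) ⟩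
          s * s′ * ∑ t (λ σ → M ρ σ * M ρ′ σ ⋆) + (v * v * (y * y′) * ∑ t (λ σ → δ ρ σ * δ ρ′ σ)
            + (v * (s * y′) * ∑ t (λ σ → δ ρ′ σ * M ρ σ) + v * (y * s′) * ∑ t (λ σ → δ ρ σ * M ρ′ σ ⋆)))
            ≈⟨ +-cong (*-congˡ (gram ρ ρ′)) (+-cong (*-congˡ (trans (∑-δ t ρ (δ ρ′)) (reflexive (δ-sym ρ′ ρ))))
                 (+-cong (*-congˡ (∑-δ t ρ′ (M ρ))) (*-congˡ (trans (∑-δ t ρ (λ σ → M ρ′ σ ⋆)) (hermitian ρ′ ρ))))) ⟩
          s * s′ * (W * δ ρ ρ′) + (v * v * (y * y′) * δ ρ ρ′ + (v * (s * y′) * M ρ ρ′ + v * (y * s′) * M ρ ρ′))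
            ≈⟨ solve 8 (λ v s y s′ y′ W d m → s :* s′ :* (W :* d) :+ (v :* v :* (y :* y′) :* d :+ (v :* (s :* y′) :* m :+ v :* (y :* s′) :* m))
                 := (s :* s′ :* W :+ v :* v :* (y :* y′)) :* d :+ v :* (s :* y′ :+ y :* s′) :* m)
                 refl v s y s′ y′ W (δ ρ ρ′) (M ρ ρ′) ⟩
          (s * s′ * W + v * v * (y * y′)) * δ ρ ρ′ + v * (s * y′ + y * s′) * M ρ ρ′ ∎

        -- The diagonal and the kernel anticommute, and each has orthogonal rows.
        Orthogonal : Bool → Bool → Bool → Bool → Carrier → Carrier → Set
        Orthogonal a b c d D M =
          Σ₄ (λ e f → (diagonal a b e f * diagonal c d e f * W + v * v * (kernel X X′ Y Y′ a b e f * kernel X′ X Y′ Y c d e f)) * D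
                      + v * (diagonal a b e f * kernel X′ X Y′ Y c d e f + kernel X X′ Y Y′ a b e f * diagonal c d e f) * M)
            ≈ (W + v * v * (X * X′ + Y * Y′)) * (δᵇ a c * (δᵇ b d * D))

        orthogonality : ∀ a b c d D M → Orthogonal a b c d D M
        orthogonality a b c d D M = go a b c d
          where
          eq : (a b c d : Bool) (W v X X′ Y Y′ D M : Polynomial 8) → _
          eq a b c d W v X X′ Y Y′ D M =
            Poly.Σ₄ (λ e f → (Poly.diagonal a b e f :* Poly.diagonal c d e f :* W :+ v :* v :* (Poly.kernel X X′ Y Y′ a b e f :* Poly.kernel X′ X Y′ Y c d e f)) :* D
                      :+ v :* (Poly.diagonal a b e f :* Poly.kernel X′ X Y′ Y c d e f :+ Poly.kernel X X′ Y Y′ a b e f :* Poly.diagonal c d e f) :* M)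
              := (W :+ v :* v :* (X :* X′ :+ Y :* Y′)) :* (Poly.δᵇ a c :* (Poly.δᵇ b d :* D))
          go : ∀ a b c d → Orthogonal a b c d D M
          go O O O O = solve 8 (eq O O O O) refl W v X X′ Y Y′ D M
          go O O O I = solve 8 (eq O O O I) refl W v X X′ Y Y′ D M
          go O O I O = solve 8 (eq O O I O) refl W v X X′ Y Y′ D M
          go O O I I = solve 8 (eq O O I I) refl W v X X′ Y Y′ D M
          go O I O O = solve 8 (eq O I O O) refl W v X X′ Y Y′ D M
          go O I O I = solve 8 (eq O I O I) refl W v X X′ Y Y′ D M
          go O I I O = solve 8 (eq O I I O) refl W v X X′ Y Y′ D M
          go O I I I = solve 8 (eq O I I I) refl W v X X′ Y Y′ D M
          go I O O O = solve 8 (eq I O O O) refl W v X X′ Y Y′ D M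
          go I O O I = solve 8 (eq I O O I) refl W v X X′ Y Y′ D M
          go I O I O = solve 8 (eq I O I O) refl W v X X′ Y Y′ D M
          go I O I I = solve 8 (eq I O I I) refl W v X X′ Y Y′ D M
          go I I O O = solve 8 (eq I I O O) refl W v X X′ Y Y′ D M
          go I I O I = solve 8 (eq I I O I) refl W v X X′ Y Y′ D M
          go I I I O = solve 8 (eq I I I O) refl W v X X′ Y Y′ D M
          go I I I I = solve 8 (eq I I I I) refl W v X X′ Y Y′ D M

        extended-gram : HasGram (W + v * v * (X * X′ + Y * Y′)) extended
        extended-gram (a ∷ b ∷ ρ) (c ∷ d ∷ ρ′) = trans
          (+-cong (+-cong (part false false) (part false true)) (+-cong (part true false) (part true true)))
          (orthogonality a b c d (δ ρ ρ′) (M ρ ρ′))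
          where
          part : ∀ e f → ∑ t (λ σ → extended (a ∷ b ∷ ρ) (e ∷ f ∷ σ) * extended (c ∷ d ∷ ρ′) (e ∷ f ∷ σ) ⋆) ≈ _
          part e f = trans (∑-cong t λ σ → *-congˡ (extended-⋆ c d e f ρ′ σ))
            (innerProduct ρ ρ′ (diagonal a b e f) (kernel X X′ Y Y′ a b e f) (diagonal c d e f) (kernel X′ X Y′ Y c d e f))

      matrix-extend : ∀ {t h} ζ (b : Block k) (D : Pattern k t h) → let open Block b renaming (size to m; var to v; pair to AB) in
        ∀ a d e f ρ σ → let P = ζ * eval z (proj₁ AB); N = ζ * eval z (proj₁ (proj₂ AB)); P′ = ζ ⋆ * eval z (proj₁ AB) ⋆; N′ = ζ ⋆ * eval z (proj₁ (proj₂ AB)) ⋆ in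
        matrix ζ (extend b D) (a ∷ d ∷ ρ) (e ∷ f ∷ σ)
          ≈ diagonal a d e f * matrix (ζ * z ^ m) D ρ σ + x v * (kern P P′ N′ N a d e f * δ ρ σ)
      matrix-extend {t} ζ (block {m} v (A , B , _)) D@(mkPattern c₀ cs) a d e f ρ σ = begin
        centerEval (liftCell c₀) (a ∷ d ∷ ρ) (e ∷ f ∷ σ) + cellsEval ζ (Vec.zipWith (newCell v) A B ++ Vec.map liftCell cs) (a ∷ d ∷ ρ) (e ∷ f ∷ σ)
          ≈⟨ +-cong (center-scaled c₀)
               (trans (cellsEval-++ ζ (Vec.zipWith (newCell v) A B) (Vec.map liftCell cs) (a ∷ d ∷ ρ) (e ∷ f ∷ σ))
                 (+-cong (newCells-eval v ρ σ ζ A B a d e f) (cells-scaled (ζ * z ^ m) cs))) ⟩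
        s * centerEval c₀ ρ σ + (x v * (_ * δ ρ σ) + s * cellsEval (ζ * z ^ m) cs ρ σ)
          ≈⟨ solve 4 (λ s p q r → s :* p :+ (r :+ s :* q) := s :* (p :+ q) :+ r) refl s (centerEval c₀ ρ σ) (cellsEval (ζ * z ^ m) cs ρ σ) _ ⟩
        s * matrix (ζ * z ^ m) D ρ σ + x v * (_ * δ ρ σ) ∎
        where
        s = diagonal a d e f
        open Scaled liftCell ρ σ (a ∷ d ∷ ρ) (e ∷ f ∷ σ) s (λ m q → lift-entry a d e f ρ σ m q)

      module _ (z-unitary : Unitary z) (c-unitary : Unitary c) (J⋆≈J : J ⋆ ≈ J) (real : ∀ v → x v ⋆ ≈ x v) where

        J*J≈1 : J * J ≈ 1#
        J*J≈1 = trans (*-congˡ (sym J⋆≈J)) (*-unitary c-unitary c-unitary)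

        -- The start ζ is universally quantified because adding a pair of length m uses the previous
        -- matrix at ζz^m.
        IsWeighing : ∀ {t h} → Carrier → Pattern k t h → Set
        IsWeighing W D = ∀ ζ → Unitary ζ → Hermitian (matrix ζ D) × HasGram W (matrix ζ D)

        transfer : ∀ {t W W′} {M M′ : Vec Bool t → Vec Bool t → Carrier} → W ≈ W′ → (∀ ρ σ → M′ ρ σ ≈ M ρ σ) →
                   Hermitian M × HasGram W M → Hermitian M′ × HasGram W′ M′
        transfer {t} w e (h , g) =
          (λ ρ σ → trans (⋆-cong (e ρ σ)) (trans (h ρ σ) (sym (e σ ρ)))) ,
          (λ ρ ρ′ → trans (∑-cong t λ σ → *-cong (e ρ σ) (⋆-cong (e ρ′ σ))) (trans (g ρ ρ′) (*-congʳ w)))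

        extend-isWeighing : ∀ {t h W} (b : Block k) (D : Pattern k t h) → IsWeighing W D →
          IsWeighing (W + (4 ℕ.* size b) ×ᴿ (x (var b) * x (var b))) (extend b D)
        extend-isWeighing {W = W} b@(block {m} v (A , B , AB)) D weighing ζ ζ-unitary =
          transfer (+-congˡ weight) (λ { (a ∷ d ∷ ρ) (e ∷ f ∷ σ) → matrix-extend ζ b D a d e f ρ σ })
            (E.extended-hermitian , E.extended-gram)
          where
          P = ζ * eval z A
          P′ = ζ ⋆ * eval z A ⋆
          N = ζ ⋆ * eval z B ⋆
          N′ = ζ * eval z B
          P⋆ : P ⋆ ≈ P′
          P⋆ = ⋆-* _ _
          P′⋆ : P′ ⋆ ≈ P
          P′⋆ = trans (⋆-* _ _) (*-cong (⋆-involutive _) (⋆-involutive _))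
          N⋆ : N ⋆ ≈ N′
          N⋆ = trans (⋆-* _ _) (*-cong (⋆-involutive _) (⋆-involutive _))
          N′⋆ : N′ ⋆ ≈ N
          N′⋆ = ⋆-* _ _
          sum-⋆ : ∀ {P P′ N N′} → P ⋆ ≈ P′ → N ⋆ ≈ N′ → (P + N) ⋆ ≈ P′ + N′
          sum-⋆ p n = trans (⋆-+ _ _) (+-cong p n)
          difference-⋆ : ∀ {P P′ N N′} → P ⋆ ≈ P′ → N ⋆ ≈ N′ → (J * (P - N)) ⋆ ≈ J * (P′ - N′)
          difference-⋆ p n = trans (⋆-* _ _) (*-cong J⋆≈J (trans (⋆-+ _ _) (+-cong p (trans (⋆-neg _) (-‿cong n)))))
          shifted = weighing (ζ * z ^ m) (*-unitary ζ-unitary (^-unitary m z-unitary))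
          module E = Extension (matrix (ζ * z ^ m) D) W (x v) (P + N) (P′ + N′) (J * (P - N)) (J * (P′ - N′))
            (proj₁ shifted) (proj₂ shifted) (real v)
            (sum-⋆ P⋆ N⋆) (sum-⋆ P′⋆ N′⋆) (difference-⋆ P⋆ N⋆) (difference-⋆ P′⋆ N′⋆)
          -- The parallelogram law: as J² = 1, the mixed terms of P + N and P - N cancel, and 2(PP⋆
          -- + NN⋆) = 2 * 2m remains.
          norm : (P + N) * (P′ + N′) + J * (P - N) * (J * (P′ - N′)) ≈ (4 ℕ.* m) ×ᴿ 1#
          norm = begin
            (P + N) * (P′ + N′) + J * (P - N) * (J * (P′ - N′))
              ≈⟨ solve 7 (λ J α α′ β β′ ζ ζ′ →
                   (ζ :* α :+ ζ′ :* β′) :* (ζ′ :* α′ :+ ζ :* β) :+ J :* (ζ :* α :- ζ′ :* β′) :* (J :* (ζ′ :* α′ :- ζ :* β))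
                     := ζ :* ζ′ :* (α :* α′ :+ β :* β′) :+ ζ :* ζ′ :* (α :* α′ :+ β :* β′)
                        :+ (J :* J :- :1) :* ((ζ :* α :- ζ′ :* β′) :* (ζ′ :* α′ :- ζ :* β)))
                   refl J (eval z A) (eval z A ⋆) (eval z B) (eval z B ⋆) ζ (ζ ⋆) ⟩
            ζ * ζ ⋆ * g + ζ * ζ ⋆ * g + (J * J - 1#) * _
              ≈⟨ +-cong (+-cong half half) (trans (*-congʳ (trans (+-congʳ J*J≈1) (-‿inverseʳ 1#))) (zeroˡ _)) ⟩
            (m ℕ.+ m) ×ᴿ 1# + (m ℕ.+ m) ×ᴿ 1# + 0#
              ≈⟨ +-identityʳ _ ⟩
            (m ℕ.+ m) ×ᴿ 1# + (m ℕ.+ m) ×ᴿ 1#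
              ≈⟨ ×-homo-+ 1# (m ℕ.+ m) (m ℕ.+ m) ⟨
            ((m ℕ.+ m) ℕ.+ (m ℕ.+ m)) ×ᴿ 1#
              ≡⟨ ≡.cong (_×ᴿ 1#) (fourfold m) ⟩
            (4 ℕ.* m) ×ᴿ 1# ∎
            where
            g = eval z A * eval z A ⋆ + eval z B * eval z B ⋆
            half : ζ * ζ ⋆ * g ≈ (m ℕ.+ m) ×ᴿ 1#
            half = trans (*-cong ζ-unitary (AB C z z-unitary)) (*-identityˡ _)
          weight : x v * x v * ((P + N) * (P′ + N′) + J * (P - N) * (J * (P′ - N′))) ≈ (4 ℕ.* m) ×ᴿ (x v * x v)
          weight = trans (*-congˡ norm) (trans (×-comm-* (4 ℕ.* m) _ 1#) (×-congʳ (4 ℕ.* m) (*-identityʳ _)))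

        pad-isWeighing : ∀ {t h W} (D : Pattern k t h) → IsWeighing W D → IsWeighing W (pad D)
        pad-isWeighing {t} {W = W} D@(mkPattern c₀ cs) weighing ζ ζ-unitary =
          transfer refl (λ { (a ∷ ρ) (b ∷ σ) → matrix-pad a b ρ σ }) (padded-hermitian , padded-gram)
          where
          M = matrix ζ D
          hermitian = proj₁ (weighing ζ ζ-unitary)
          gram = proj₂ (weighing ζ ζ-unitary)
          padded : Vec Bool (suc t) → Vec Bool (suc t) → Carrier
          padded (a ∷ ρ) (b ∷ σ) = δᵇ a b * M ρ σ
          matrix-pad : ∀ a b ρ σ → matrix ζ (pad D) (a ∷ ρ) (b ∷ σ) ≈ δᵇ a b * M ρ σ
          matrix-pad a b ρ σ = trans (+-cong (center-scaled c₀) (cells-scaled ζ cs)) (sym (distribˡ _ _ _))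
            where
            open Scaled padCell ρ σ (a ∷ ρ) (b ∷ σ) (δᵇ a b) (λ m q →
              solve 4 (λ u x d e → u :* x :* (d :* e) := d :* (u :* x :* e)) refl
                ⟦ unit (m q ρ) ⟧ (x (var (m q ρ))) (δᵇ a b) (δ (column (m q ρ)) σ))
          padded-hermitian : Hermitian padded
          padded-hermitian (a ∷ ρ) (b ∷ σ) = trans (⋆-* _ _)
            (*-cong (trans (δᵇ-⋆ a b) (reflexive (δᵇ-sym a b))) (hermitian ρ σ))
          padded-gram : HasGram W padded
          padded-gram (a ∷ ρ) (b ∷ ρ′) = trans (+-cong (part false) (part true)) (total a b)
            where
            G = W * δ ρ ρ′
            part : ∀ e → ∑ t (λ σ → padded (a ∷ ρ) (e ∷ σ) * padded (b ∷ ρ′) (e ∷ σ) ⋆) ≈ δᵇ a e * δᵇ b e * G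
            part e = trans (∑-cong t λ σ → trans (*-congˡ (trans (⋆-* _ _) (*-congʳ (δᵇ-⋆ b e))))
                (solve 4 (λ p m q n → p :* m :* (q :* n) := p :* q :* (m :* n)) refl (δᵇ a e) (M ρ σ) (δᵇ b e) (M ρ′ σ ⋆)))
              (trans (∑-* t _ _) (*-congˡ (gram ρ ρ′)))
            total : ∀ a b → δᵇ a false * δᵇ b false * G + δᵇ a true * δᵇ b true * G ≈ W * (δᵇ a b * δ ρ ρ′)
            total a b = go a b
              where
              eq : (a b : Bool) (W D : Polynomial 2) → _
              eq a b W D = Poly.δᵇ a false :* Poly.δᵇ b false :* (W :* D) :+ Poly.δᵇ a true :* Poly.δᵇ b true :* (W :* D)
                := W :* (Poly.δᵇ a b :* D)
              go : ∀ a b → δᵇ a false * δᵇ b false * G + δᵇ a true * δᵇ b true * G ≈ W * (δᵇ a b * δ ρ ρ′)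
              go false false = solve 2 (eq false false) refl W (δ ρ ρ′)
              go false true  = solve 2 (eq false true) refl W (δ ρ ρ′)
              go true  false = solve 2 (eq true false) refl W (δ ρ ρ′)
              go true  true  = solve 2 (eq true true) refl W (δ ρ ρ′)

        base-isWeighing : ∀ v → IsWeighing (4 ×ᴿ (x v * x v)) (base v)
        base-isWeighing v ζ ζ-unitary = transfer refl pattern-eval (hermitian , gram)
          where
          y = x v
          M : Vec Bool 1 → Vec Bool 1 → Carrier
          M (false ∷ []) (false ∷ []) = y * (1# + J)
          M (false ∷ []) (true ∷ [])  = y * (c - c ⋆)
          M (true ∷ [])  (false ∷ []) = y * (c ⋆ - c)
          M (true ∷ [])  (true ∷ [])  = y * (- (1# + J))
          baseᴾ : Bool → Bool → (y c c′ : Polynomial 3) → Polynomial 3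
          baseᴾ a b y c c′ = term 0F :* :1 :+ term 1F :* c :+ term 2F :* (c :* c) :+ term 3F :* c′ :+ :0
            where
            sgnᴾ : Bool → Polynomial 3
            sgnᴾ false = :1
            sgnᴾ true = :- :1
            term : Fin 4 → Polynomial 3
            term q = sgnᴾ (baseSign q a) :* :1 :* y :* (Poly.δᵇ (baseColumn q a) b :* :1)
          pattern-eval : ∀ ρ σ → matrix ζ (base v) ρ σ ≈ M ρ σ
          pattern-eval (false ∷ []) (false ∷ []) = solve 3 (λ y c c′ → baseᴾ false false y c c′ := y :* (:1 :+ c :* c)) refl y c (c ⋆)
          pattern-eval (false ∷ []) (true ∷ [])  = solve 3 (λ y c c′ → baseᴾ false true y c c′ := y :* (c :- c′)) refl y c (c ⋆)
          pattern-eval (true ∷ [])  (false ∷ []) = solve 3 (λ y c c′ → baseᴾ true false y c c′ := y :* (c′ :- c)) refl y c (c ⋆)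
          pattern-eval (true ∷ [])  (true ∷ [])  = solve 3 (λ y c c′ → baseᴾ true true y c c′ := y :* (:- (:1 :+ c :* c))) refl y c (c ⋆)
          1+J⋆ : (1# + J) ⋆ ≈ 1# + J
          1+J⋆ = trans (⋆-+ _ _) (+-cong ⋆-1 J⋆≈J)
          hermitian : Hermitian M
          hermitian (false ∷ []) (false ∷ []) = trans (⋆-* _ _) (*-cong (real v) 1+J⋆)
          hermitian (false ∷ []) (true ∷ [])  = trans (⋆-* _ _) (*-cong (real v) (trans (⋆-+ _ _)
            (+-congˡ (trans (⋆-neg _) (-‿cong (⋆-involutive c))))))
          hermitian (true ∷ [])  (false ∷ []) = trans (⋆-* _ _) (*-cong (real v) (trans (⋆-+ _ _)
            (+-cong (⋆-involutive c) (⋆-neg c))))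
          hermitian (true ∷ [])  (true ∷ [])  = trans (⋆-* _ _) (*-cong (real v) (trans (⋆-neg _) (-‿cong 1+J⋆)))
          vanish : ∀ {r s} → r ≈ s → ∀ w → (r - s) * w ≈ 0#
          vanish e w = trans (*-congʳ (trans (+-congʳ e) (-‿inverseʳ _))) (zeroˡ w)
          simplify : ∀ {r s w₁ w₂} → r ≈ s + ((c * c ⋆ - 1#) * w₁ + (J * J - 1#) * w₂) → r ≈ s
          simplify {w₁ = w₁} {w₂} e = trans e (trans (+-congˡ (trans
            (+-cong (vanish c-unitary w₁) (vanish J*J≈1 w₂)) (+-identityˡ _))) (+-identityʳ _))
          -- Apart from multiples of cc⋆ - 1 and J² - 1, the error is a multiple of c² - c⋆², which
          -- vanishes because J is fixed by the star.
          norm-F : ∀ y c c′ → _ 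
          norm-F = solve 3 (λ y c c′ →
            y :* (:1 :+ c :* c) :* (y :* (:1 :+ c :* c)) :+ y :* (c :- c′) :* (y :* (c′ :- c))
              := (y :* y :+ (y :* y :+ (y :* y :+ (y :* y :+ :0)))) :* (:1 :* :1)
                :+ ((c :* c′ :- :1) :* (con (ℤ.+ 2) :* y :* y) :+ (c :* c :* (c :* c) :- :1) :* (y :* y))
                :+ y :* y :* (c :* c :- c′ :* c′)) refl
          c′c′≈J : c ⋆ * c ⋆ ≈ J
          c′c′≈J = trans (sym (⋆-* c c)) J⋆≈J
          gram : HasGram (4 ×ᴿ (y * y)) M
          gram (false ∷ []) (false ∷ []) = simplify (trans
            (+-cong (*-congˡ (hermitian (false ∷ []) (false ∷ []))) (*-congˡ (hermitian (false ∷ []) (true ∷ []))))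
            (trans (norm-F y c (c ⋆)) (trans (+-congˡ (trans (*-congˡ (trans (+-congˡ (-‿cong c′c′≈J)) (-‿inverseʳ J))) (zeroʳ _))) (+-identityʳ _))))
          gram (false ∷ []) (true ∷ [])  = trans
            (+-cong (*-congˡ (hermitian (true ∷ []) (false ∷ []))) (*-congˡ (hermitian (true ∷ []) (true ∷ []))))
            (solve 3 (λ y c c′ →
              y :* (:1 :+ c :* c) :* (y :* (c :- c′)) :+ y :* (c :- c′) :* (y :* (:- (:1 :+ c :* c)))
                := (y :* y :+ (y :* y :+ (y :* y :+ (y :* y :+ :0)))) :* (:0 :* :1)) refl y c (c ⋆))
          gram (true ∷ []) (false ∷ [])  = trans
            (+-cong (*-congˡ (hermitian (false ∷ []) (false ∷ []))) (*-congˡ (hermitian (false ∷ []) (true ∷ []))))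
            (solve 3 (λ y c c′ →
              y :* (c′ :- c) :* (y :* (:1 :+ c :* c)) :+ y :* (:- (:1 :+ c :* c)) :* (y :* (c′ :- c))
                := (y :* y :+ (y :* y :+ (y :* y :+ (y :* y :+ :0)))) :* (:0 :* :1)) refl y c (c ⋆))
          gram (true ∷ []) (true ∷ []) = trans
            (+-cong (*-congˡ (hermitian (true ∷ []) (false ∷ []))) (*-congˡ (hermitian (true ∷ []) (true ∷ []))))
            (trans (solve 3 (λ y c c′ →
                y :* (c′ :- c) :* (y :* (c :- c′)) :+ y :* (:- (:1 :+ c :* c)) :* (y :* (:- (:1 :+ c :* c)))
                  := y :* (:1 :+ c :* c) :* (y :* (:1 :+ c :* c)) :+ y :* (c :- c′) :* (y :* (c′ :- c))) refl y c (c ⋆))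
              (trans (sym (+-cong (*-congˡ (hermitian (false ∷ []) (false ∷ []))) (*-congˡ (hermitian (false ∷ []) (true ∷ [])))))
                (gram (false ∷ []) (false ∷ []))))

  -- Reading the matrices as coefficients of powers of z

  reverses : Fin 4 → Bool
  reverses 0F = false
  reverses 1F = true
  reverses 2F = false
  reverses 3F = true

  -- The exponent of z is pq + r with 0 ≤ r < p, and r = 0 belongs to the center. Since z^(2p) = J
  -- and z^(4p) = 1, quarters 1 and 3 contain Jζ⁻¹ and ζ⁻¹, where growing exponents mean falling
  -- powers ζ; the cells are therefore read backwards. Thus every one of the 4p group elements is
  -- met exactly once.
  monomialAt : ∀ {k t h} → Pattern k t h → Fin 4 → Fin (suc h) → Vec Bool t → Monomial k t
  monomialAt D q zero = center D q
  monomialAt D q (suc r) = Vec.lookup (cells D) (if reverses q then opposite r else r) q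

  coefficient : ∀ {k t h} → Pattern k t h → Fin (4 ℕ.* suc h) → Vec Bool t → Monomial k t
  coefficient {h = h} D g = let q , r = remQuot (suc h) g in monomialAt D q r

  module CombineSum (R : CommutativeRing 0ℓ 0ℓ) where
    open CommutativeRing R hiding (zero)
    open Sums R

    sum-++ : ∀ m {n} (f : Fin (m ℕ.+ n) → Carrier) → sum f ≈ sum (λ i → f (i ↑ˡ n)) + sum (λ j → f (m ↑ʳ j))
    sum-++ zero f = sym (+-identityˡ _)
    sum-++ (suc m) f = trans (+-congˡ (sum-++ m (λ i → f (suc i)))) (sym (+-assoc _ _ _))

    sum-combine : ∀ m {n} (f : Fin (m ℕ.* n) → Carrier) → sum f ≈ sum (λ i → sum (λ j → f (combine {m} i j)))
    sum-combine zero f = refl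
    sum-combine (suc m) {n} f = trans (sum-++ n f) (+-congˡ (sum-combine m (λ i → f (n ↑ʳ i))))

  module Expansion (C : ComplexRing) {k : ℕ} (x : Fin k → ComplexRing.Carrier C) {t h} (D : Pattern k t h)
                   (z : ComplexRing.Carrier C) (z-unitary : Evaluation.Unitary C z) where
    open ComplexRing C hiding (zero)
    open Evaluation C
    open Matrices C x
    open Algebra.Properties.Semiring.Exp semiring using (_^_; ^-homo-*)
    open Sums commutativeRing
    open CombineSum commutativeRing
    open IntegerSolver commutativeRing
    open Relation.Binary.Reasoning.Setoid setoid

    p : ℕ
    p = suc h

    c : Carrier
    c = z ^ p

    open At z c

    cellsEval-sum : ∀ {h} ζ (ms : Vec (Cell k t) h) ρ σ →
      cellsEval ζ ms ρ σ ≈ sum (λ r → cellEval (ζ * z ^ toℕ r) (Vec.lookup ms r) ρ σ)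
    cellsEval-sum ζ [] ρ σ = refl
    cellsEval-sum ζ (m ∷ ms) ρ σ = +-cong (cellEval-cong m (sym (*-identityʳ ζ)))
      (trans (cellsEval-sum (ζ * z) ms ρ σ)
        (sum-cong-≋ λ r → cellEval-cong (Vec.lookup ms r) (*-assoc ζ z (z ^ toℕ r))))
      where
      cellEval-cong : ∀ {ζ ξ} m → ζ ≈ ξ → cellEval ζ m ρ σ ≈ cellEval ξ m ρ σ
      cellEval-cong m e =
        +-cong (+-cong (+-cong (*-congˡ e) (*-congˡ (*-congˡ (⋆-cong e)))) (*-congˡ (*-congˡ e))) (*-congˡ (⋆-cong e))

    centerPosition : Fin 4 → Carrier
    centerPosition 0F = 1#
    centerPosition 1F = c
    centerPosition 2F = J
    centerPosition 3F = c ⋆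

    cellPosition : Carrier → Fin 4 → Carrier
    cellPosition ζ 0F = ζ
    cellPosition ζ 1F = J * ζ ⋆
    cellPosition ζ 2F = J * ζ
    cellPosition ζ 3F = ζ ⋆

    module _ (period : z ^ (4 ℕ.* p) ≈ 1#) where

      -- Unitarity trades a conjugated power for one with a natural exponent.
      z^-⋆ : ∀ a b {w} → z ^ (a ℕ.+ b) ≈ w → z ^ a ≈ w * (z ^ b) ⋆
      z^-⋆ a b {w} e = begin
        z ^ a                                ≈⟨ *-identityʳ _ ⟨
        z ^ a * 1#                           ≈⟨ *-congˡ (^-unitary b z-unitary) ⟨
        z ^ a * (z ^ b * (z ^ b) ⋆)          ≈⟨ *-assoc _ _ _ ⟨
        z ^ a * z ^ b * (z ^ b) ⋆            ≈⟨ *-congʳ (^-homo-* z a b) ⟨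
        z ^ (a ℕ.+ b) * (z ^ b) ⋆            ≈⟨ *-congʳ e ⟩
        w * (z ^ b) ⋆                        ∎

      J≈ : z ^ (p ℕ.* 2) ≈ J
      J≈ = trans (reflexive (≡.cong (z ^_) (≡.trans (ℕₚ.*-comm p 2) (≡.cong (p ℕ.+_) (ℕₚ.+-identityʳ p))))) (^-homo-* z p p)

      center-power : ∀ q → z ^ (p ℕ.* toℕ q ℕ.+ 0) ≈ centerPosition q
      center-power 0F = reflexive (≡.cong (λ j → z ^ (j ℕ.+ 0)) (ℕₚ.*-zeroʳ p))
      center-power 1F = reflexive (≡.cong (z ^_) (≡.trans (ℕₚ.+-identityʳ (p ℕ.* 1)) (ℕₚ.*-identityʳ p)))
      center-power 2F = trans (reflexive (≡.cong (z ^_) (ℕₚ.+-identityʳ (p ℕ.* 2)))) J≈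
      center-power 3F = trans (z^-⋆ (p ℕ.* 3 ℕ.+ 0) p (trans (reflexive (≡.cong (z ^_) total)) period)) (*-identityˡ _)
        where
        total : p ℕ.* 3 ℕ.+ 0 ℕ.+ p ≡ 4 ℕ.* p
        total = ≡.trans (≡.cong (ℕ._+ p) (≡.trans (ℕₚ.+-identityʳ (p ℕ.* 3)) (ℕₚ.*-comm p 3))) (ℕₚ.+-comm (3 ℕ.* p) p)

      opposite-sum : (r : Fin h) → suc (toℕ (opposite r)) ℕ.+ suc (toℕ r) ≡ p
      opposite-sum r = ≡.trans (≡.cong (λ j → suc j ℕ.+ suc (toℕ r)) (Finₚ.opposite-prop r))
        (≡.cong suc (ℕₚ.m∸n+n≡m (Finₚ.toℕ<n r)))

      cell-power : ∀ q (r : Fin h) → z ^ (p ℕ.* toℕ q ℕ.+ suc (toℕ (if reverses q then opposite r else r)))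
        ≈ cellPosition (z * z ^ toℕ r) q
      cell-power 0F r = reflexive (≡.cong (λ j → z ^ (j ℕ.+ suc (toℕ r))) (ℕₚ.*-zeroʳ p))
      cell-power 1F r = z^-⋆ (p ℕ.* 1 ℕ.+ suc (toℕ (opposite r))) (suc (toℕ r))
        (trans (reflexive (≡.cong (z ^_) (≡.trans (ℕₚ.+-assoc (p ℕ.* 1) _ _) (≡.trans (≡.cong (p ℕ.* 1 ℕ.+_) (opposite-sum r))
          (≡.trans (ℕₚ.+-comm (p ℕ.* 1) p) (≡.sym (ℕₚ.*-suc p 1))))))) J≈)
      cell-power 2F r = trans (^-homo-* z (p ℕ.* 2) (suc (toℕ r))) (*-congʳ J≈)
      cell-power 3F r = trans (z^-⋆ (p ℕ.* 3 ℕ.+ suc (toℕ (opposite r))) (suc (toℕ r))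
        (trans (reflexive (≡.cong (z ^_) (≡.trans (ℕₚ.+-assoc (p ℕ.* 3) _ _) (≡.trans (≡.cong (p ℕ.* 3 ℕ.+_) (opposite-sum r))
          (≡.trans (ℕₚ.+-comm (p ℕ.* 3) p) (≡.trans (≡.sym (ℕₚ.*-suc p 3)) (ℕₚ.*-comm p 4))))))) period)) (*-identityˡ _)

      matrix-expansion : ∀ ρ σ →
        matrix z D ρ σ ≈ sum (λ g → entry (coefficient D g ρ) σ * z ^ toℕ g)
      matrix-expansion ρ σ = sym (begin
        sum (λ g → entry (coefficient D g ρ) σ * z ^ toℕ g)
          ≈⟨ sum-combine 4 {p} (λ g → entry (coefficient D g ρ) σ * z ^ toℕ g) ⟩
        sum (λ q → sum (λ (r : Fin p) → entry (coefficient D (combine {4} q r) ρ) σ * z ^ toℕ (combine {4} q r)))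
          ≈⟨ sum-cong-≋ (λ q → sum-cong-≋ (λ r → reflexive (≡.cong₂ (λ (q , r) e → entry (monomialAt D q r ρ) σ * z ^ e)
               (Finₚ.remQuot-combine q r) (Finₚ.toℕ-combine q r)))) ⟩
        sum (λ q → e₀ q * z₀ q + sum (λ r → entry (monomialAt D q (suc r) ρ) σ * z ^ (p ℕ.* toℕ q ℕ.+ suc (toℕ r))))
          ≈⟨ sum-cong-≋ (λ q → +-congˡ {e₀ q * z₀ q} (unreverse q)) ⟩
        sum (λ q → e₀ q * z₀ q + sum (λ r → e q r * z₁ q r))
          ≈⟨ ∑-distrib-+ (λ q → e₀ q * z₀ q) (λ q → sum (λ r → e q r * z₁ q r)) ⟩
        sum (λ q → e₀ q * z₀ q) + sum (λ q → sum (λ r → e q r * z₁ q r))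
          ≈⟨ +-cong (trans (sum-cong-≋ (λ q → *-congˡ {e₀ q} (center-power q))) (reassociate _ _ _ _))
               (trans (∑-comm (λ q r → e q r * z₁ q r))
                 (sum-cong-≋ (λ r → trans (sum-cong-≋ (λ q → *-congˡ {e q r} {z₁ q r} {cellPosition (z * z ^ toℕ r) q} (cell-power q r))) (reassociate _ _ _ _)))) ⟩
        centerEval (center D) ρ σ + sum (λ r → cellEval (z * z ^ toℕ r) (Vec.lookup (cells D) r) ρ σ)
          ≈⟨ +-congˡ (cellsEval-sum z (cells D) ρ σ) ⟨
        matrix z D ρ σ ∎)
        where
        e₀ z₀ : Fin 4 → Carrier
        e₀ q = entry (center D q ρ) σ
        z₀ q = z ^ (p ℕ.* toℕ q ℕ.+ 0)
        e z₁ : Fin 4 → Fin h → Carrier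
        e q r = entry (Vec.lookup (cells D) r q ρ) σ
        z₁ q r = z ^ (p ℕ.* toℕ q ℕ.+ suc (toℕ (if reverses q then opposite r else r)))
        reassociate : ∀ a b c d → a + (b + (c + (d + 0#))) ≈ a + b + c + d
        reassociate = solve 4 (λ a b c d → a :+ (b :+ (c :+ (d :+ :0))) := a :+ b :+ c :+ d) refl
        flip : ∀ q → sum (λ r → entry (Vec.lookup (cells D) (opposite r) q ρ) σ * z ^ (p ℕ.* toℕ q ℕ.+ suc (toℕ r)))
                   ≈ sum (λ r → entry (Vec.lookup (cells D) r q ρ) σ * z ^ (p ℕ.* toℕ q ℕ.+ suc (toℕ (opposite r))))
        flip q = trans
          (sum-reindex (λ r → entry (Vec.lookup (cells D) (opposite r) q ρ) σ * z ^ (p ℕ.* toℕ q ℕ.+ suc (toℕ r))) opposite opposite Finₚ.opposite-involutive Finₚ.opposite-involutive)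
          (sum-cong-≋ λ r → reflexive (≡.cong (λ s → entry (Vec.lookup (cells D) s q ρ) σ * z ^ (p ℕ.* toℕ q ℕ.+ suc (toℕ (opposite r)))) (Finₚ.opposite-involutive r)))
        unreverse : ∀ q → sum (λ r → entry (monomialAt D q (suc r) ρ) σ * z ^ (p ℕ.* toℕ q ℕ.+ suc (toℕ r)))
          ≈ sum (λ r → e q r * z₁ q r)
        unreverse 0F = refl
        unreverse 1F = flip 1F
        unreverse 2F = refl
        unreverse 3F = flip 3F

  bits : ∀ {k} → List (Block k) → ℕ
  bits [] = 1
  bits (b ∷ bs) = suc (suc (bits bs))

  cellCount : ∀ {k} → List (Block k) → ℕ
  cellCount [] = 0
  cellCount (b ∷ bs) = size b ℕ.+ cellCount bs

  build : ∀ {k} → Fin k → (bs : List (Block k)) → Pattern k (bits bs) (cellCount bs)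
  build v [] = base v
  build v (b ∷ bs) = extend b (build v bs)

  padBy : ∀ {k t h} e → Pattern k t h → Pattern k (e ℕ.+ t) h
  padBy zero D = D
  padBy (suc e) D = pad (padBy e D)

  module Weight (R : CommutativeRing 0ℓ 0ℓ) {k} (y : Fin k → CommutativeRing.Carrier R) where
    open CommutativeRing R hiding (zero)
    open Algebra.Properties.Semiring.Mult semiring renaming (_×_ to _×ᴿ_)

    -- The argument `y v` stands for the square of the variable v. Every cell counts four times,
    -- once for each of its group elements, and so does the center.
    weight : Fin k → List (Block k) → Carrier
    weight v [] = 4 ×ᴿ y v
    weight v (b ∷ bs) = weight v bs + (4 ℕ.* size b) ×ᴿ y (var b)

  -- Group rings over R[i] and their constants

  module GaussianComplex (R : CommutativeRing 0ℓ 0ℓ) where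
    open CommutativeRing R hiding (zero)
    open IntegerSolver R

    gaussianComplex : ComplexRing
    gaussianComplex = record
      { starRing = GaussianRing.gaussian R
      ; i = 0# , 1#
      ; i*i≈-1 = solve 0 (:0 :* :0 :- :1 :* :1 := :- :1) refl
               , solve 0 (:0 :* :1 :+ :1 :* :0 := :- :0) refl
      ; i⋆≈-i = solve 0 (:0 := :- :0) refl , refl
      }

  module GroupRingComplex (K : ComplexRing) (n′ : ℕ) where
    open ComplexRing K hiding (zero)
    open Cyclic n′
    open Sums commutativeRing
    open GroupRing starRing n′
    open Algebra.Properties.AbelianGroup +-abelianGroup using (ε⁻¹≈ε)

    private
      module Λ = StarRing groupRing

    const : Carrier → Elem
    const = basis zero

    basis-shift : ∀ i a j k → basis i a (k ⊝ j) ≡ basis (j ⊕ i) a k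
    basis-shift i a j k with i Finₚ.≟ k ⊝ j
    ... | yes ≡.refl = ≡.sym (≡.trans (≡.cong (λ l → basis l a k) (≡.trans (⊕-comm j (k ⊝ j)) (⊝-⊕ k j))) (basis-same k a))
    ... | no i≢ = ≡.sym (basis-other a λ e → i≢ (≡.trans (≡.sym (⊕-⊝ i j))
                    (≡.cong (_⊝ j) {i ⊕ j} {k} (≡.trans (⊕-comm i j) e))))

    basis-basis : ∀ i a j b k → (basis i a ∗ basis j b) k ≈ basis (i ⊕ j) (a * b) k
    basis-basis i a j b k = trans (basis-∗ i a (basis j b) k)
      (trans (*-congˡ (reflexive (basis-shift j b i k))) (scale (i ⊕ j)))
      where
      scale : ∀ l → a * basis l b k ≈ basis l (a * b) k
      scale l with does (l Finₚ.≟ k)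
      ... | true  = refl
      ... | false = zeroʳ a

    const-* : ∀ a b → Λ._≈_ (const a ∗ const b) (const (a * b))
    const-* a b = basis-basis zero a zero b

    const-+ : ∀ a b → Λ._≈_ (Λ._+_ (const a) (const b)) (const (a + b))
    const-+ a b k with does (zero Finₚ.≟ k)
    ... | true  = refl
    ... | false = +-identityˡ 0#

    const-0 : Λ._≈_ Λ.0# (const 0#)
    const-0 k with does (zero Finₚ.≟ k)
    ... | true  = refl
    ... | false = refl

    const-neg : ∀ a → Λ._≈_ (Λ.-_ (const a)) (const (- a))
    const-neg a k with does (zero Finₚ.≟ k)
    ... | true  = refl
    ... | false = ε⁻¹≈ε

    const-cong : ∀ {a b} → a ≈ b → Λ._≈_ (const a) (const b)
    const-cong e k = basis-cong zero k e

    const-⋆ : ∀ a → Λ._≈_ (star (const a)) (const (a ⋆))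
    const-⋆ a k = trans (star-basis zero a k) (reflexive (≡.cong (λ l → basis l (a ⋆) k) neg-zero))

    groupRingComplex : ComplexRing
    groupRingComplex = record
      { starRing = groupRing
      ; i = const i
      ; i*i≈-1 = Λ.trans (const-* i i) (Λ.trans (const-cong i*i≈-1) (Λ.sym (const-neg 1#)))
      ; i⋆≈-i = Λ.trans (const-⋆ i) (Λ.trans (const-cong i⋆≈-i) (Λ.sym (const-neg i)))
      }

    open Algebra.Properties.Semiring.Exp Λ.semiring using (_^_)

    z : Elem
    z = basis (residue 1) 1#

    z^ : ∀ m → Λ._≈_ (z ^ m) (basis (residue m) 1#)
    z^ zero    k = refl
    z^ (suc m) = Λ.trans (Λ.*-congˡ {z} (z^ m)) (λ k → trans (basis-basis (residue 1) 1# (residue m) 1# k)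
      (trans (basis-cong (residue 1 ⊕ residue m) k (*-identityˡ 1#)) (reflexive (≡.cong (λ l → basis l 1# k) (≡.sym (residue-+ 1 m))))))

    z-unitary : Λ._≈_ (z ∗ star z) Λ.1#
    z-unitary k = trans (∗-cong {z} {z} {star z} {basis (neg (residue 1)) (1# ⋆)} (λ _ → refl) (star-basis (residue 1) 1#) k)
      (trans (basis-basis (residue 1) 1# (neg (residue 1)) (1# ⋆) k)
      (trans (basis-cong (residue 1 ⊕ neg (residue 1)) k (trans (*-identityˡ _) ⋆-1)) (reflexive (≡.cong (λ l → basis l 1# k) (⊕-inverseʳ (residue 1))))))

    z-period : Λ._≈_ (z ^ n) Λ.1#
    z-period = Λ.trans (z^ n) λ k → reflexive (≡.cong (λ l → basis l 1# k) (residue-cong {n} {0} (n%n≡0 n)))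

    sum-at : ∀ {m} (f : Fin m → Elem) k → Sums.sum Λ.commutativeRing f k ≡ sum (λ j → f j k)
    sum-at {zero}  f k = ≡.refl
    sum-at {suc m} f k = ≡.cong (f zero k +_) (sum-at (f ∘ suc) k)

    ∑-at : ∀ t (f : Vec Bool t → Elem) k → BooleanSums.∑ Λ.commutativeRing t f k ≡ BooleanSums.∑ commutativeRing t (λ σ → f σ k)
    ∑-at zero f k = ≡.refl
    ∑-at (suc t) f k = ≡.cong₂ _+_ (∑-at t _ k) (∑-at t _ k)

    -- The powers of z run through the group, so they recover f from its coefficients. With
    -- `matrix-expansion` this converts the matrix identity into one about coefficient functions.
    expand : ∀ f → Λ._≈_ (Sums.sum Λ.commutativeRing (λ g → const (f g) ∗ z ^ toℕ g)) f
    expand f k = trans (reflexive (sum-at (λ g → const (f g) ∗ z ^ toℕ g) k))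
      (trans (sum-cong-≋ term)
        (trans (sum-single (λ g → f g * basis g 1# k) k λ j k≢j → trans (*-congˡ {f j} (reflexive (basis-other {i = j} {k} 1# (k≢j ∘ ≡.sym)))) (zeroʳ (f j)))
          (trans (*-congˡ {f k} (reflexive (basis-same k 1#))) (*-identityʳ (f k)))))
      where
      term : ∀ g → (const (f g) ∗ z ^ toℕ g) k ≈ f g * basis g 1# k
      term g = trans (basis-∗ zero (f g) (z ^ toℕ g) k) (*-congˡ {f g}
        (trans (reflexive (≡.cong (z ^ toℕ g) (⊝-zero k)))
          (trans (z^ (toℕ g) k) (reflexive (≡.cong (λ l → basis l 1# k) (residue-toℕ g))))))

    module _ {k} (x : Fin k → Carrier) where
      open Evaluation K
      open Matrices K x
      private
        module E = Evaluation groupRingComplex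
        module M = Matrices groupRingComplex (const ∘ x)

      sgn-const : ∀ s → Λ._≈_ (E.sgn s) (const (sgn s))
      sgn-const false = Λ.refl
      sgn-const true = const-neg 1#

      power-of-i-const : ∀ b → Λ._≈_ (E.power-of-i b) (const (power-of-i b))
      power-of-i-const false = Λ.refl
      power-of-i-const true = Λ.refl

      ⟦⟧-const : ∀ u → Λ._≈_ (E.⟦ u ⟧) (const ⟦ u ⟧)
      ⟦⟧-const (root s b) = Λ.trans (Λ.*-cong (sgn-const s) (power-of-i-const b)) (const-* (sgn s) (power-of-i b))

      δᵇ-const : ∀ a b → Λ._≈_ (Operations.δᵇ M.operations a b) (const (Operations.δᵇ operations a b))
      δᵇ-const false false = Λ.refl
      δᵇ-const false true  = const-0
      δᵇ-const true  false = const-0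
      δᵇ-const true  true  = Λ.refl

      δ-const : ∀ {t} (ρ σ : Vec Bool t) → Λ._≈_ (M.δ ρ σ) (const (δ ρ σ))
      δ-const [] [] = Λ.refl
      δ-const (a ∷ ρ) (b ∷ σ) = Λ.trans (Λ.*-cong (δᵇ-const a b) (δ-const ρ σ)) (const-* _ (δ ρ σ))

      entry-const : ∀ {t} (m : Monomial k t) σ → Λ._≈_ (M.entry m σ) (const (entry m σ))
      entry-const m σ = Λ.trans (Λ.*-cong (Λ.trans (Λ.*-congʳ {const (x (var m))} (⟦⟧-const (unit m))) (const-* ⟦ unit m ⟧ (x (var m)))) (δ-const (column m) σ))
        (const-* (⟦ unit m ⟧ * x (var m)) (δ (column m) σ))

      open Algebra.Properties.Semiring.Mult semiring using () renaming (_×_ to _×ᴿ_)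
      open Algebra.Properties.Semiring.Mult Λ.semiring using () renaming (_×_ to _×ᴸ_; ×-congʳ to ×ᴸ-congʳ)

      ×-const : ∀ m a → Λ._≈_ (m ×ᴸ const a) (const (m ×ᴿ a))
      ×-const zero a = const-0
      ×-const (suc m) a = Λ.trans (Λ.+-congˡ {const a} (×-const m a)) (const-+ a (m ×ᴿ a))

      weight-const : ∀ v bs → Λ._≈_ (Weight.weight Λ.commutativeRing (λ v → const (x v) ∗ const (x v)) v bs)
                                    (const (Weight.weight commutativeRing (λ v → x v * x v) v bs))
      weight-const v [] = Λ.trans (×ᴸ-congʳ 4 (const-* (x v) (x v))) (×-const 4 (x v * x v))
      weight-const v (b ∷ bs) = Λ.trans
        (Λ.+-cong (weight-const v bs) (Λ.trans (×ᴸ-congʳ (4 ℕ.* size b) (const-* (x (var b)) (x (var b)))) (×-const (4 ℕ.* size b) _)))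
        (const-+ (Weight.weight commutativeRing (λ v → x v * x v) v bs) _)

  module _ (C : ComplexRing) {k : ℕ} (x : Fin k → ComplexRing.Carrier C) (z c : ComplexRing.Carrier C) where
    open ComplexRing C hiding (zero)
    open Evaluation C using (Unitary)
    open Matrices C x
    open At z c

    module _ (z-unitary : Unitary z) (c-unitary : Unitary c) (J⋆≈J : J ⋆ ≈ J) (real : ∀ v → x v ⋆ ≈ x v) where

      build-isWeighing : ∀ v bs → IsWeighing z-unitary c-unitary J⋆≈J real
        (Weight.weight commutativeRing (λ v → x v * x v) v bs) (build v bs)
      build-isWeighing v [] = base-isWeighing z-unitary c-unitary J⋆≈J real v
      build-isWeighing v (b ∷ bs) = extend-isWeighing z-unitary c-unitary J⋆≈J real b (build v bs) (build-isWeighing v bs)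

      padBy-isWeighing : ∀ {t h W} e (D : Pattern k t h) → IsWeighing z-unitary c-unitary J⋆≈J real W D →
        IsWeighing z-unitary c-unitary J⋆≈J real W (padBy e D)
      padBy-isWeighing zero D w = w
      padBy-isWeighing (suc e) D w = pad-isWeighing z-unitary c-unitary J⋆≈J real (padBy e D) (padBy-isWeighing e D w)

  AreReal : ∀ (K : ComplexRing) {k} → (Fin k → ComplexRing.Carrier K) → Set
  AreReal K x = ∀ v → x v ⋆ ≈ x v
    where open ComplexRing K

  module CoefficientGram (K : ComplexRing) {k : ℕ} (x : Fin k → ComplexRing.Carrier K)
    (real : AreReal K x) (v : Fin k) (bs : List (Block k)) (e : ℕ) where
    open ComplexRing K hiding (zero)
    open Matrices K x using (entry; δ; ∑; ∑-cong)
    open Sums commutativeRing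

    h t n′ : ℕ
    h = cellCount bs
    t = e ℕ.+ bits bs
    -- Chosen so that `4 ℕ.* suc h`, the order of the group, computes to `suc n′`.
    n′ = h ℕ.+ 3 ℕ.* suc h

    D : Pattern k t h
    D = padBy e (build v bs)

    open Cyclic n′
    open GroupRing starRing n′
    open GroupRingComplex K n′

    private
      module Λ = ComplexRing groupRingComplex
      module M = Matrices groupRingComplex (const ∘ x)
      module E = Evaluation groupRingComplex
      module Ex = Expansion groupRingComplex (const ∘ x) D z z-unitary
      module At = M.At z Ex.c
    open Algebra.Properties.Semiring.Exp Λ.semiring using (_^_; ^-homo-*)

    F : Vec Bool t → Vec Bool t → Elem
    F ρ σ g = entry (coefficient D g ρ) σ

    -- The same pattern is evaluated with scalars in the coefficient ring and with the corresponding
    -- constants in the group ring; `entry-const` links the two.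
    F≈matrix : ∀ ρ σ → Λ._≈_ (F ρ σ) (At.matrix z D ρ σ)
    F≈matrix ρ σ = Λ.sym (Λ.trans (Ex.matrix-expansion z-period ρ σ)
      (Λ.trans (Sums.sum-cong-≋ Λ.commutativeRing (λ g → Λ.*-congʳ {z ^ toℕ g} (entry-const x (coefficient D g ρ) σ)))
        (expand (F ρ σ))))

    c-unitary : E.Unitary Ex.c
    c-unitary = E.^-unitary (suc h) z-unitary

    J*J≈1 : Λ._≈_ (At.J ∗ At.J) Λ.1#
    J*J≈1 = Λ.trans (Λ.sym (Λ.*-cong (^-homo-* z p p) (^-homo-* z p p)))
      (Λ.trans (Λ.sym (^-homo-* z (p ℕ.+ p) (p ℕ.+ p)))
        (Λ.trans (Λ.reflexive (≡.cong (z ^_) (fourfold p))) z-period))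
      where
      p = suc h

    -- Both J and J⋆ are inverse to J.
    J⋆≈J : Λ._≈_ (star At.J) At.J
    J⋆≈J = Λ.trans (Λ.sym (Λ.*-identityˡ (star At.J))) (Λ.trans (Λ.*-congʳ {star At.J} (Λ.sym J*J≈1))
      (Λ.trans (Λ.*-assoc At.J At.J (star At.J))
        (Λ.trans (Λ.*-congˡ {At.J} (E.*-unitary {Ex.c} {Ex.c} c-unitary c-unitary)) (Λ.*-identityʳ At.J))))

    W : Carrier
    W = Weight.weight commutativeRing (λ v → x v * x v) v bs

    Wᴸ : Elem
    Wᴸ = Weight.weight Λ.commutativeRing (λ v → const (x v) ∗ const (x v)) v bs

    weighing : At.HasGram Wᴸ (At.matrix z D)
    weighing = proj₂ (padBy-isWeighing groupRingComplex (const ∘ x) z Ex.c z-unitary c-unitary J⋆≈J real′ {W = Wᴸ} e (build v bs)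
      (build-isWeighing groupRingComplex (const ∘ x) z Ex.c z-unitary c-unitary J⋆≈J real′ v bs) z z-unitary)
      where
      real′ : ∀ v → Λ._≈_ (star (const (x v))) (const (x v))
      real′ v = Λ.trans (const-⋆ (x v)) (const-cong (real v))

    F-gram : ∀ ρ ρ′ → Λ._≈_ (M.∑ t (λ σ → F ρ σ ∗ star (F ρ′ σ))) (const (W * δ ρ ρ′))
    F-gram ρ ρ′ = Λ.trans (M.∑-cong t (λ σ → Λ.*-cong {F ρ σ} {At.matrix z D ρ σ} {star (F ρ′ σ)} {star (At.matrix z D ρ′ σ)}
        (F≈matrix ρ σ) (Λ.⋆-cong {F ρ′ σ} {At.matrix z D ρ′ σ} (F≈matrix ρ′ σ))))
      (Λ.trans (weighing ρ ρ′) (Λ.trans (Λ.*-cong (weight-const x v bs) (δ-const x ρ ρ′)) (const-* W (δ ρ ρ′))))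

    ∑-sum : ∀ {m} s (f : Vec Bool s → Fin m → Carrier) → ∑ s (λ σ → sum (f σ)) ≈ sum (λ j → ∑ s (λ σ → f σ j))
    ∑-sum zero f = refl
    ∑-sum (suc s) f = trans (+-cong (∑-sum s (λ σ → f (false ∷ σ))) (∑-sum s (λ σ → f (true ∷ σ))))
      (sym (∑-distrib-+ (λ j → ∑ s (λ σ → f (false ∷ σ) j)) (λ j → ∑ s (λ σ → f (true ∷ σ) j))))

    -- This is the regular representation: the coefficient at j - g becomes the entry in row g and
    -- column j. The sum over j is then the coefficient of the product F F⋆ at g′ - g, and that
    -- product is a constant of the group ring.
    coefficient-gram : ∀ g g′ ρ ρ′ →
      sum (λ j → ∑ t (λ σ → F ρ σ (j ⊝ g) * F ρ′ σ (j ⊝ g′) ⋆)) ≈ basis g (W * δ ρ ρ′) g′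
    coefficient-gram g g′ ρ ρ′ = begin
      sum (λ j → ∑ t (λ σ → F ρ σ (j ⊝ g) * F ρ′ σ (j ⊝ g′) ⋆))
        ≈⟨ ∑-sum t (λ σ j → F ρ σ (j ⊝ g) * F ρ′ σ (j ⊝ g′) ⋆) ⟨
      ∑ t (λ σ → sum (λ j → F ρ σ (j ⊝ g) * F ρ′ σ (j ⊝ g′) ⋆))
        ≈⟨ ∑-cong t shift ⟩
      ∑ t (λ σ → (F ρ σ ∗ star (F ρ′ σ)) (g′ ⊝ g))
        ≡⟨ ∑-at t (λ σ → F ρ σ ∗ star (F ρ′ σ)) (g′ ⊝ g) ⟨
      M.∑ t (λ σ → F ρ σ ∗ star (F ρ′ σ)) (g′ ⊝ g)
        ≈⟨ F-gram ρ ρ′ (g′ ⊝ g) ⟩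
      basis zero (W * δ ρ ρ′) (g′ ⊝ g)
        ≡⟨ ≡.trans (basis-shift zero (W * δ ρ ρ′) g g′) (≡.cong (λ l → basis l (W * δ ρ ρ′) g′) (⊕-identityʳ g)) ⟩
      basis g (W * δ ρ ρ′) g′ ∎
      where
      open Relation.Binary.Reasoning.Setoid setoid
      index : ∀ j → neg ((g′ ⊝ g) ⊝ (j ⊝ g)) ≡ j ⊝ g′
      index j = ≡.trans (neg-⊝ (g′ ⊝ g) (j ⊝ g))
        (≡.trans (≡.sym (⊝-⊕-assoc j (g′ ⊝ g) g)) (≡.cong (j ⊝_) {(g′ ⊝ g) ⊕ g} {g′} (⊝-⊕ g′ g)))
      shift : ∀ σ → sum (λ j → F ρ σ (j ⊝ g) * F ρ′ σ (j ⊝ g′) ⋆) ≈ (F ρ σ ∗ star (F ρ′ σ)) (g′ ⊝ g)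
      shift σ = sym (trans
        (sum-reindex (λ j → F ρ σ j * F ρ′ σ (neg ((g′ ⊝ g) ⊝ j)) ⋆) (_⊝ g) (_⊕ g) (λ j → ⊕-⊝ j g) (λ j → ⊝-⊕ j g))
        (sum-cong-≋ λ j → *-congˡ {F ρ σ (j ⊝ g)} (reflexive (≡.cong (λ l → F ρ′ σ l ⋆) (index j)))))

-- From monomial rows over the group ring to real designs

module Designs where
  open GolayPairs
  open Patterns
  open import Data.List.Base using ([]; _∷_)
  open import Data.Vec.Base using ([]; _∷_)
  open import Defs using (Entry; +x; -x; evalEntry; identityMatrix; GramIdentity; OD)

  open Block
  open Monomial
  open Root

  -- The exponent of -1 in the Walsh matrix.
  dot : ∀ {s} → Vec Bool s → Vec Bool s → Bool
  dot [] [] = false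
  dot (a ∷ τ) (b ∷ κ) = (a ∧ b) xor dot τ κ

  signed : ∀ {k} → Bool → Fin k → Entry k
  signed false v = +x v
  signed true  v = -x v

  bit : Fin 2 → Bool
  bit 0F = false
  bit 1F = true

  bitString : ∀ s → Fin (2 ℕ.^ s) → Vec Bool s
  bitString zero i = []
  bitString (suc s) i = let q , r = remQuot {2} (2 ℕ.^ s) i in bit q ∷ bitString s r

  bit-injective : ∀ {q r} → bit q ≡ bit r → q ≡ r
  bit-injective {0F} {0F} _ = ≡.refl
  bit-injective {0F} {1F} ()
  bit-injective {1F} {0F} ()
  bit-injective {1F} {1F} _ = ≡.refl

  remQuot-injective : ∀ m n {i j : Fin (m ℕ.* n)} → remQuot {m} n i ≡ remQuot {m} n j → i ≡ j
  remQuot-injective m n {i} {j} e = ≡.trans (≡.sym (Finₚ.combine-remQuot {m} n i))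
    (≡.trans (≡.cong (λ (q , r) → combine q r) e) (Finₚ.combine-remQuot {m} n j))

  bitString-injective : ∀ s {i j} → bitString s i ≡ bitString s j → i ≡ j
  bitString-injective zero {0F} {0F} e = ≡.refl
  bitString-injective (suc s) e = remQuot-injective 2 (2 ℕ.^ s)
    (≡.cong₂ _,_ (bit-injective (Vecₚ.∷-injectiveˡ e)) (bitString-injective s (Vecₚ.∷-injectiveʳ e)))

  module BitSums (R : CommutativeRing 0ℓ 0ℓ) where
    open CommutativeRing R hiding (zero)
    open BooleanSums R
    open Signs R
    open Sums R
    open CombineSum R
    open IntegerSolver R
    open Algebra.Properties.Semiring.Mult semiring using (×-homo-+) renaming (_×_ to _×ᴿ_)

    sum-bitString : ∀ s (f : Vec Bool s → Carrier) → sum (f ∘ bitString s) ≈ ∑ s f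
    sum-bitString zero f = +-identityʳ _
    sum-bitString (suc s) f = trans (sum-combine 2 {2 ℕ.^ s} (f ∘ bitString (suc s)))
      (trans (+-cong (half 0F) (trans (+-identityʳ _) (half 1F))) refl)
      where
      half : ∀ q → sum (λ (r : Fin (2 ℕ.^ s)) → f (bitString (suc s) (combine {2} q r))) ≈ ∑ s (λ σ → f (bit q ∷ σ))
      half q = trans (sum-cong-≋ λ r → reflexive (≡.cong (λ (q , r) → f (bit q ∷ bitString s r)) (Finₚ.remQuot-combine q r)))
        (sum-bitString s (λ σ → f (bit q ∷ σ)))

    δ-same : ∀ {t} (ρ : Vec Bool t) → δ ρ ρ ≈ 1#
    δ-same [] = refl
    δ-same (false ∷ ρ) = trans (*-identityˡ _) (δ-same ρ)
    δ-same (true ∷ ρ)  = trans (*-identityˡ _) (δ-same ρ)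

    δ-other : ∀ {t} (ρ σ : Vec Bool t) → ρ ≢ σ → δ ρ σ ≈ 0#
    δ-other [] [] ne = contradiction ≡.refl ne
    δ-other (false ∷ ρ) (false ∷ σ) ne = trans (*-identityˡ _) (δ-other ρ σ (ne ∘ ≡.cong (false ∷_)))
    δ-other (false ∷ ρ) (true ∷ σ)  ne = zeroˡ _
    δ-other (true ∷ ρ)  (false ∷ σ) ne = zeroˡ _
    δ-other (true ∷ ρ)  (true ∷ σ)  ne = trans (*-identityˡ _) (δ-other ρ σ (ne ∘ ≡.cong (true ∷_)))

    walsh-orthogonal : ∀ s τ τ′ → ∑ s (λ κ → sgn (dot τ κ) * sgn (dot τ′ κ)) ≈ ((2 ℕ.^ s) ×ᴿ 1#) * δ τ τ′
    walsh-orthogonal zero [] [] = *-congʳ (sym (+-identityʳ 1#))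
    walsh-orthogonal (suc s) (a ∷ τ) (b ∷ τ′) = trans (+-cong (half false) (half true))
      (trans (total a b) (*-congʳ (sym (trans (reflexive (≡.cong (λ m → (2 ℕ.^ s ℕ.+ m) ×ᴿ 1#) (ℕₚ.+-identityʳ (2 ℕ.^ s)))) (×-homo-+ 1# (2 ℕ.^ s) (2 ℕ.^ s))))))
      where
      w = (2 ℕ.^ s) ×ᴿ 1#
      half : ∀ c → ∑ s (λ κ → sgn (dot (a ∷ τ) (c ∷ κ)) * sgn (dot (b ∷ τ′) (c ∷ κ))) ≈ sgn (a ∧ c) * sgn (b ∧ c) * (w * δ τ τ′)
      half c = trans (∑-cong s λ κ → trans (*-cong (sgn-xor (a ∧ c) (dot τ κ)) (sgn-xor (b ∧ c) (dot τ′ κ)))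
          (solve 4 (λ p q r t → p :* q :* (r :* t) := p :* r :* (q :* t)) refl (sgn (a ∧ c)) (sgn (dot τ κ)) (sgn (b ∧ c)) (sgn (dot τ′ κ))))
        (trans (∑-* s _ _) (*-congˡ (walsh-orthogonal s τ τ′)))
      eq : (a b : Bool) (w d : Polynomial 2) → _
      eq a b w d = Poly.sign (a ∧ false) :* Poly.sign (b ∧ false) :* (w :* d) :+ Poly.sign (a ∧ true) :* Poly.sign (b ∧ true) :* (w :* d)
          := (w :+ w) :* (Poly.δᵇ a b :* d)
      total : ∀ a b → sgn (a ∧ false) * sgn (b ∧ false) * (w * δ τ τ′) + sgn (a ∧ true) * sgn (b ∧ true) * (w * δ τ τ′)
            ≈ (w + w) * (δᵇ a b * δ τ τ′)
      total false false = solve 2 (eq false false) refl w (δ τ τ′)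
      total false true  = solve 2 (eq false true) refl w (δ τ τ′)
      total true  false = solve 2 (eq true false) refl w (δ τ τ′)
      total true  true  = solve 2 (eq true true) refl w (δ τ τ′)

  -- The entries of the 2 × 2 real matrix of a Gaussian number.
  module RealForm (R : CommutativeRing 0ℓ 0ℓ) where
    open CommutativeRing R hiding (zero)
    open BooleanSums R
    open Signs R
    open Sums R
    open IntegerSolver R
    open Algebra.Properties.AbelianGroup +-abelianGroup using (⁻¹-∙-comm; ε⁻¹≈ε)
    open GaussianComplex R
    private
      module G = ComplexRing gaussianComplex
      module GB = BooleanSums G.commutativeRing

    realForm : Bool → Bool → Carrier × Carrier → Carrier
    realForm false false (a , b) = a
    realForm false true  (a , b) = b
    realForm true  false (a , b) = - b
    realForm true  true  (a , b) = a

    realForm-cong : ∀ a b {x y} → x G.≈ y → realForm a b x ≈ realForm a b y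
    realForm-cong false false (p , q) = p
    realForm-cong false true  (p , q) = q
    realForm-cong true  false (p , q) = -‿cong q
    realForm-cong true  true  (p , q) = p

    realForm-+ : ∀ a b x y → realForm a b (x G.+ y) ≈ realForm a b x + realForm a b y
    realForm-+ false false x y = refl
    realForm-+ false true  x y = refl
    realForm-+ true  false x y = sym (⁻¹-∙-comm _ _)
    realForm-+ true  true  x y = refl

    realForm-0 : ∀ a b → realForm a b G.0# ≈ 0#
    realForm-0 false false = refl
    realForm-0 false true  = refl
    realForm-0 true  false = ε⁻¹≈ε
    realForm-0 true  true  = refl

    -- Conjugation transposes the real form, so inner products of its rows compute xy⋆.
    realForm-*⋆ : ∀ a b x y → realForm a false x * realForm b false y + realForm a true x * realForm b true y
                              ≈ realForm a b (x G.* y G.⋆)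
    realForm-*⋆ false false (p , q) (r , s) = solve 4 (λ p q r s → p :* r :+ q :* s := p :* r :- q :* (:- s)) refl p q r s
    realForm-*⋆ false true  (p , q) (r , s) = solve 4 (λ p q r s → p :* (:- s) :+ q :* r := p :* (:- s) :+ q :* r) refl p q r s
    realForm-*⋆ true  false (p , q) (r , s) = solve 4 (λ p q r s → (:- q) :* r :+ p :* s := :- (p :* (:- s) :+ q :* r)) refl p q r s
    realForm-*⋆ true  true  (p , q) (r , s) = solve 4 (λ p q r s → (:- q) :* (:- s) :+ p :* r := p :* r :- q :* (:- s)) refl p q r s

    realForm-sum : ∀ a b {m} (f : Fin m → Carrier × Carrier) →
      realForm a b (Sums.sum G.commutativeRing f) ≈ sum (λ j → realForm a b (f j))
    realForm-sum a b {zero} f = realForm-0 a b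
    realForm-sum a b {suc m} f = trans (realForm-+ a b _ _) (+-congˡ (realForm-sum a b (f ∘ suc)))

    realForm-∑ : ∀ a b t f → realForm a b (GB.∑ t f) ≈ ∑ t (λ σ → realForm a b (f σ))
    realForm-∑ a b zero f = refl
    realForm-∑ a b (suc t) f = trans (realForm-+ a b _ _) (+-cong (realForm-∑ a b t _) (realForm-∑ a b t _))

    fromReal : Carrier → Carrier × Carrier
    fromReal r = r , 0#

    fromReal-* : ∀ r s → fromReal r G.* fromReal s G.≈ fromReal (r * s)
    fromReal-* r s = solve 2 (λ r s → r :* s :- :0 :* :0 := r :* s) refl r s
                   , solve 2 (λ r s → r :* :0 :+ :0 :* s := :0) refl r s

    realForm-fromReal : ∀ a b r → realForm a b (fromReal r) ≈ δᵇ a b * r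
    realForm-fromReal false false r = sym (*-identityˡ r)
    realForm-fromReal false true  r = sym (zeroˡ r)
    realForm-fromReal true  false r = trans ε⁻¹≈ε (sym (zeroˡ r))
    realForm-fromReal true  true  r = sym (*-identityˡ r)

    δ-fromReal : ∀ {t} (ρ σ : Vec Bool t) → GB.δ ρ σ G.≈ fromReal (δ ρ σ)
    δ-fromReal [] [] = G.refl
    δ-fromReal (a ∷ ρ) (b ∷ σ) = G.trans (G.*-cong (δᵇ-fromReal a b) (δ-fromReal ρ σ)) (fromReal-* (δᵇ a b) (δ ρ σ))
      where
      δᵇ-fromReal : ∀ a b → Operations.δᵇ GB.operations a b G.≈ fromReal (δᵇ a b)
      δᵇ-fromReal false false = G.refl
      δᵇ-fromReal false true  = G.refl
      δᵇ-fromReal true  false = G.refl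
      δᵇ-fromReal true  true  = G.refl

    module _ {k} (x : Fin k → Carrier) where
      open Algebra.Properties.Semiring.Mult semiring using () renaming (_×_ to _×ᴿ_)
      open Algebra.Properties.Semiring.Mult G.semiring using () renaming (_×_ to _×ᴳ_; ×-congʳ to ×ᴳ-congʳ)
      private
        module E = Evaluation gaussianComplex
        module M = Matrices gaussianComplex (fromReal ∘ x)

      ×-fromReal : ∀ m r → m ×ᴳ fromReal r G.≈ fromReal (m ×ᴿ r)
      ×-fromReal zero r = G.refl
      ×-fromReal (suc m) r = refl {x = r} ⟨+⟩ ×-fromReal m r
        where
        _⟨+⟩_ : ∀ {r s y} → r ≈ r → y G.≈ fromReal s → fromReal r G.+ y G.≈ fromReal (r + s)
        _ ⟨+⟩ (p , q) = +-congˡ p , trans (+-identityˡ _) q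

      weight-fromReal : ∀ v bs → Weight.weight G.commutativeRing (λ v → fromReal (x v) G.* fromReal (x v)) v bs
                          G.≈ fromReal (Weight.weight R (λ v → x v * x v) v bs)
      weight-fromReal v [] = G.trans (×ᴳ-congʳ 4 (fromReal-* (x v) (x v))) (×-fromReal 4 _)
      weight-fromReal v (b ∷ bs) = G.trans
        (G.+-cong (weight-fromReal v bs) (G.trans (×ᴳ-congʳ (4 ℕ.* size b) (fromReal-* (x (var b)) (x (var b)))) (×-fromReal (4 ℕ.* size b) _)))
        (refl , +-identityˡ 0#)

      sgn-fromReal : ∀ s → E.sgn s G.≈ fromReal (sgn s)
      sgn-fromReal false = G.refl
      sgn-fromReal true  = refl , ε⁻¹≈ε

      -- A root of unity acts on the plane as a signed permutation of the two axes. Hence a monomial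
      -- row stays monomial, with one more bit in its column.
      realForm-entry : ∀ {t} (m : Monomial k t) b c σ →
        realForm b c (M.entry m σ)
          ≈ sgn (negative (unit m) xor (imaginary (unit m) ∧ b)) * x (var m) * δ ((b xor imaginary (unit m)) ∷ column m) (c ∷ σ)
      realForm-entry (monomial (root s im) v τ) b c σ =
        trans (realForm-cong b c (G.*-cong (G.*-congʳ (G.*-congʳ (sgn-fromReal s))) (δ-fromReal τ σ))) (trans (go im b c) (sym (*-congʳ (*-congʳ (sgn-xor s (im ∧ b))))))
        where
        d = δ τ σ
        y = x v
        eq : Polynomial 3 × Polynomial 3 → Polynomial 3 → Polynomial 3 → Polynomial 3 × Polynomial 3
        eq (p , q) y d = ((p :* y :- q :* :0) :* d :- (p :* :0 :+ q :* y) :* :0) , ((p :* y :- q :* :0) :* :0 :+ (p :* :0 :+ q :* y) :* d)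
        u₀ u₁ : Polynomial 3 → Polynomial 3 × Polynomial 3
        u₀ s = (s :* :1 :- :0 :* :0) , (s :* :0 :+ :0 :* :1)
        u₁ s = (s :* :0 :- :0 :* :1) , (s :* :1 :+ :0 :* :0)
        go : ∀ im b c → realForm b c (fromReal (sgn s) G.* E.power-of-i im G.* fromReal y G.* fromReal d)
               ≈ sgn s * sgn (im ∧ b) * y * (δᵇ (b xor im) c * d)
        go false false false = solve 3 (λ s y d → proj₁ (eq (u₀ s) y d) := s :* :1 :* y :* (:1 :* d)) refl (sgn s) y d
        go false false true  = solve 3 (λ s y d → proj₂ (eq (u₀ s) y d) := s :* :1 :* y :* (:0 :* d)) refl (sgn s) y d
        go false true  false = solve 3 (λ s y d → :- proj₂ (eq (u₀ s) y d) := s :* :1 :* y :* (:0 :* d)) refl (sgn s) y d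
        go false true  true  = solve 3 (λ s y d → proj₁ (eq (u₀ s) y d) := s :* :1 :* y :* (:1 :* d)) refl (sgn s) y d
        go true  false false = solve 3 (λ s y d → proj₁ (eq (u₁ s) y d) := s :* :1 :* y :* (:0 :* d)) refl (sgn s) y d
        go true  false true  = solve 3 (λ s y d → proj₂ (eq (u₁ s) y d) := s :* :1 :* y :* (:1 :* d)) refl (sgn s) y d
        go true  true  false = solve 3 (λ s y d → :- proj₂ (eq (u₁ s) y d) := s :* (:- :1) :* y :* (:1 :* d)) refl (sgn s) y d
        go true  true  true  = solve 3 (λ s y d → proj₁ (eq (u₁ s) y d) := s :* (:- :1) :* y :* (:0 :* d)) refl (sgn s) y d

  -- Comparing linear forms in free values y lets blocks with the same variable be merged and leaves
  -- the squares of the variables for later substitution.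
  WeightsAre : ∀ {k} → Fin k → List (Block k) → ℕ → (Fin k → ℕ) → Set₁
  WeightsAre v bs s u = ∀ (R : CommutativeRing 0ℓ 0ℓ) y →
    let open CommutativeRing R using (_≈_; semiring) in
    let open Algebra.Properties.Semiring.Mult semiring renaming (_×_ to _×ᴿ_) in
    Sums.sum R (λ i → u i ×ᴿ y i) ≈ s ×ᴿ Weight.weight R y v bs

  module RealDesign {k} (v : Fin k) (bs : List (Block k)) (e : ℕ) where
    h t n′ : ℕ
    h = cellCount bs
    t = e ℕ.+ bits bs
    n′ = h ℕ.+ 3 ℕ.* suc h

    D : Pattern k t h
    D = padBy e (build v bs)

    open Cyclic n′

    rowSign : Fin n → Vec Bool (suc t) → Bool
    rowSign g (b ∷ ρ) = let u = unit (coefficient D g ρ) in negative u xor (imaginary u ∧ b)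

    rowVariable : Fin n → Vec Bool (suc t) → Fin k
    rowVariable g (b ∷ ρ) = var (coefficient D g ρ)

    rowColumn : Fin n → Vec Bool (suc t) → Vec Bool (suc t)
    rowColumn g (b ∷ ρ) = let m = coefficient D g ρ in (b xor imaginary (unit m)) ∷ column m

    -- For the group difference d, the row has one nonzero entry, a signed variable in column
    -- `rowColumn d ρ`. Multiplication by the Walsh matrix replaces it by that signed variable times
    -- a full row of signs, so `0ₑ` never occurs.
    entryAt : Fin n × Vec Bool (suc t) → Fin n × Vec Bool (suc t) → Entry k
    entryAt (g , ρ) (j , κ) = let d = j ⊝ g in signed (rowSign d ρ xor dot (rowColumn d ρ) κ) (rowVariable d ρ)

    module _ (R : CommutativeRing 0ℓ 0ℓ) (x : Fin k → CommutativeRing.Carrier R) where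
      open CommutativeRing R hiding (zero)
      open BooleanSums R
      open Signs R
      open Sums R
      open BitSums R
      open RealForm R
      open IntegerSolver R
      open GaussianComplex R
      open Algebra.Properties.Ring ring using (-1*x≈-x)
      open Algebra.Properties.Semiring.Mult semiring using () renaming (_×_ to _×ᴿ_)
      open Relation.Binary.Reasoning.Setoid setoid
      private
        module G = ComplexRing gaussianComplex
        real : ∀ v → fromReal (x v) G.⋆ G.≈ fromReal (x v)
        real v = refl , trans (sym (+-identityˡ _)) (-‿inverseʳ 0#)
        module CG = CoefficientGram gaussianComplex (fromReal ∘ x) real v bs e

      rowValue : Fin n → Vec Bool (suc t) → Carrier
      rowValue g ρ = sgn (rowSign g ρ) * x (rowVariable g ρ)

      eval-signed : ∀ s v → evalEntry R x (signed s v) ≈ sgn s * x v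
      eval-signed false v = sym (*-identityˡ _)
      eval-signed true  v = sym (-1*x≈-x _)

      W : Carrier
      W = Weight.weight R (λ v → x v * x v) v bs

      scale : Carrier
      scale = (2 ℕ.^ suc t) ×ᴿ 1#

      rowEntry : Fin n → Vec Bool (suc t) → Vec Bool (suc t) → Carrier
      rowEntry d ρ κ = evalEntry R x (signed (rowSign d ρ xor dot (rowColumn d ρ) κ) (rowVariable d ρ))

      -- The rows of the Walsh matrix are orthogonal with equal norms, so multiplying by it on the
      -- right only scales inner products.
      row-walsh : ∀ d d′ ρ ρ′ →
        ∑ (suc t) (λ κ → rowEntry d ρ κ * rowEntry d′ ρ′ κ)
          ≈ scale * (rowValue d ρ * rowValue d′ ρ′ * δ (rowColumn d ρ) (rowColumn d′ ρ′))
      row-walsh d d′ ρ ρ′ = begin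
        ∑ (suc t) (λ κ → rowEntry d ρ κ * rowEntry d′ ρ′ κ)
          ≈⟨ ∑-cong (suc t) (λ κ → trans (*-cong (value d ρ κ) (value d′ ρ′ κ))
               (solve 4 (λ p q r s → p :* q :* (r :* s) := p :* r :* (q :* s)) refl (r) (sgn (dot τ κ)) (r′) (sgn (dot τ′ κ)))) ⟩
        ∑ (suc t) (λ κ → r * r′ * (sgn (dot τ κ) * sgn (dot τ′ κ)))
          ≈⟨ ∑-* (suc t) (r * r′) (λ κ → sgn (dot τ κ) * sgn (dot τ′ κ)) ⟩
        r * r′ * ∑ (suc t) (λ κ → sgn (dot τ κ) * sgn (dot τ′ κ))
          ≈⟨ *-congˡ (walsh-orthogonal (suc t) τ τ′) ⟩
        r * r′ * (scale * δ τ τ′)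
          ≈⟨ solve 3 (λ p q r → p :* (q :* r) := q :* (p :* r)) refl (r * r′) scale (δ τ τ′) ⟩
        scale * (r * r′ * δ τ τ′) ∎
        where
        r = rowValue d ρ
        r′ = rowValue d′ ρ′
        τ = rowColumn d ρ
        τ′ = rowColumn d′ ρ′
        value : ∀ d ρ κ → rowEntry d ρ κ
                  ≈ rowValue d ρ * sgn (dot (rowColumn d ρ) κ)
        value d ρ κ = trans (eval-signed (rowSign d ρ xor dot (rowColumn d ρ) κ) (rowVariable d ρ))
          (trans (*-congʳ (sgn-xor (rowSign d ρ) (dot (rowColumn d ρ) κ)))
            (solve 3 (λ a b c → a :* b :* c := a :* c :* b) refl (sgn (rowSign d ρ)) (sgn (dot (rowColumn d ρ) κ)) (x (rowVariable d ρ))))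

      row-product : ∀ d d′ b b′ ρ ρ′ →
        rowValue d (b ∷ ρ) * rowValue d′ (b′ ∷ ρ′) * δ (rowColumn d (b ∷ ρ)) (rowColumn d′ (b′ ∷ ρ′))
          ≈ realForm b b′ (BooleanSums.∑ G.commutativeRing t (λ σ → CG.F ρ σ d G.* CG.F ρ′ σ d′ G.⋆))
      row-product d d′ b b′ ρ ρ′ = sym (begin
        realForm b b′ (BooleanSums.∑ G.commutativeRing t (λ σ → CG.F ρ σ d G.* CG.F ρ′ σ d′ G.⋆))
          ≈⟨ realForm-∑ b b′ t (λ σ → CG.F ρ σ d G.* CG.F ρ′ σ d′ G.⋆) ⟩
        ∑ t (λ σ → realForm b b′ (CG.F ρ σ d G.* CG.F ρ′ σ d′ G.⋆))
          ≈⟨ ∑-cong t (λ σ → sym (realForm-*⋆ b b′ (CG.F ρ σ d) (CG.F ρ′ σ d′))) ⟩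
        ∑ t (λ σ → realForm b false (CG.F ρ σ d) * realForm b′ false (CG.F ρ′ σ d′) + realForm b true (CG.F ρ σ d) * realForm b′ true (CG.F ρ′ σ d′))
          ≈⟨ ∑-+ t _ _ ⟩
        ∑ t (λ σ → realForm b false (CG.F ρ σ d) * realForm b′ false (CG.F ρ′ σ d′)) + ∑ t (λ σ → realForm b true (CG.F ρ σ d) * realForm b′ true (CG.F ρ′ σ d′))
          ≈⟨ +-cong (∑-cong t (λ σ → factor false σ)) (∑-cong t (λ σ → factor true σ)) ⟩
        ∑ (suc t) (λ τ → r * r′ * (δ τ₀ τ * δ τ₀′ τ))
          ≈⟨ ∑-* (suc t) (r * r′) (λ τ → δ τ₀ τ * δ τ₀′ τ) ⟩
        r * r′ * ∑ (suc t) (λ τ → δ τ₀ τ * δ τ₀′ τ)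
          ≈⟨ *-congˡ (trans (∑-δ (suc t) τ₀ (δ τ₀′)) (reflexive (δ-sym τ₀′ τ₀))) ⟩
        r * r′ * δ τ₀ τ₀′ ∎)
        where
        r = rowValue d (b ∷ ρ)
        r′ = rowValue d′ (b′ ∷ ρ′)
        τ₀ = rowColumn d (b ∷ ρ)
        τ₀′ = rowColumn d′ (b′ ∷ ρ′)
        factor : ∀ c σ → realForm b c (CG.F ρ σ d) * realForm b′ c (CG.F ρ′ σ d′)
          ≈ r * r′ * (δ τ₀ (c ∷ σ) * δ τ₀′ (c ∷ σ))
        factor c σ = trans (*-cong (realForm-entry x (coefficient D d ρ) b c σ) (realForm-entry x (coefficient D d′ ρ′) b′ c σ))
          (solve 4 (λ p q r s → p :* q :* (r :* s) := p :* r :* (q :* s)) refl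
            (r) (δ τ₀ (c ∷ σ)) (r′) (δ τ₀′ (c ∷ σ)))

      entryAt-gram : ∀ g g′ ρ ρ′ →
        sum (λ j → ∑ (suc t) (λ κ → evalEntry R x (entryAt (g , ρ) (j , κ)) * evalEntry R x (entryAt (g′ , ρ′) (j , κ))))
          ≈ scale * (W * (basis g 1# g′ * δ ρ ρ′))
      entryAt-gram g g′ ρ@(b ∷ ρ₁) ρ′@(b′ ∷ ρ₁′) = begin
        sum (λ j → ∑ (suc t) (λ κ → evalEntry R x (entryAt (g , ρ) (j , κ)) * evalEntry R x (entryAt (g′ , ρ′) (j , κ))))
          ≈⟨ sum-cong-≋ (λ j → trans (row-walsh (j ⊝ g) (j ⊝ g′) ρ ρ′) (*-congˡ (row-product (j ⊝ g) (j ⊝ g′) b b′ ρ₁ ρ₁′))) ⟩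
        sum (λ j → scale * realForm b b′ (inner j))
          ≈⟨ *-distribˡ-sum scale (λ j → realForm b b′ (inner j)) ⟨
        scale * sum (λ j → realForm b b′ (inner j))
          ≈⟨ *-congˡ (realForm-sum b b′ inner) ⟨
        scale * realForm b b′ (Sums.sum G.commutativeRing inner)
          ≈⟨ *-congˡ (realForm-cong b b′ (CG.coefficient-gram g g′ ρ₁ ρ₁′)) ⟩
        scale * realForm b b′ (Sums.basis G.commutativeRing g (CG.W G.* GB.δ ρ₁ ρ₁′) g′)
          ≈⟨ *-congˡ last ⟩
        scale * (W * (basis g 1# g′ * δ ρ ρ′)) ∎
        where
        module GB = BooleanSums G.commutativeRing
        inner : Fin n → G.Carrier
        inner j = BooleanSums.∑ G.commutativeRing t (λ σ → CG.F ρ₁ σ (j ⊝ g) G.* CG.F ρ₁′ σ (j ⊝ g′) G.⋆)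
        last : realForm b b′ (Sums.basis G.commutativeRing g (CG.W G.* GB.δ ρ₁ ρ₁′) g′) ≈ W * (basis g 1# g′ * δ ρ ρ′)
        last with does (g Finₚ.≟ g′)
        ... | false = trans (realForm-0 b b′) (sym (trans (*-congˡ (zeroˡ _)) (zeroʳ _)))
        ... | true  = trans (realForm-cong b b′ (G.trans (G.*-cong (weight-fromReal x v bs) (δ-fromReal ρ₁ ρ₁′)) (fromReal-* W (δ ρ₁ ρ₁′))))
          (trans (realForm-fromReal b b′ (W * δ ρ₁ ρ₁′))
            (solve 3 (λ w e d → e :* (w :* d) := w :* (:1 :* (e :* d))) refl W (δᵇ b b′) (δ ρ₁ ρ₁′)))

    order : ℕ
    order = 4 ℕ.* suc h ℕ.* 2 ℕ.^ suc t

    decode : Fin order → Fin n × Vec Bool (suc t)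
    decode i = let g , r = remQuot {n} (2 ℕ.^ suc t) i in g , bitString (suc t) r

    decode-injective : ∀ {i j} → decode i ≡ decode j → i ≡ j
    decode-injective {i} {j} e = remQuot-injective n (2 ℕ.^ suc t)
      (≡.cong₂ _,_ (≡.cong proj₁ e) (bitString-injective (suc t) (≡.cong proj₂ e)))

    design : (u : Fin k → ℕ) → (∀ i → 1 ℕ.≤ u i) →
      WeightsAre v bs (2 ℕ.^ suc t) u →
      OD order u
    design u positive weights = record
      { positive = positive
      ; X = λ i j → entryAt (decode i) (decode j)
      ; gram = gram
      }
      where
      gram : ∀ (R : CommutativeRing 0ℓ 0ℓ) x → GramIdentity R u (λ i j → entryAt (decode i) (decode j)) x
      gram R x i j = begin
        sum (λ l → evalEntry R x (entryAt (decode i) (decode l)) * evalEntry R x (entryAt (decode j) (decode l)))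
          ≈⟨ sum-combine n {2 ℕ.^ suc t} (λ l → f (decode l)) ⟩
        sum (λ g → sum (λ r → f (decode (combine {n} g r))))
          ≈⟨ sum-cong-≋ (λ g → sum-cong-≋ (λ (r : Fin (2 ℕ.^ suc t)) → reflexive (≡.cong (λ (g , r) → f (g , bitString (suc t) r)) (Finₚ.remQuot-combine g r)))) ⟩
        sum (λ g → sum (λ r → f (g , bitString (suc t) r)))
          ≈⟨ sum-cong-≋ (λ g → sum-bitString (suc t) (λ κ → f (g , κ))) ⟩
        sum (λ g → ∑ (suc t) (λ κ → f (g , κ)))
          ≈⟨ entryAt-gram R x (proj₁ (decode i)) (proj₁ (decode j)) (proj₂ (decode i)) (proj₂ (decode j)) ⟩
        scale R x * (W R x * (basis (proj₁ (decode i)) 1# (proj₁ (decode j)) * δ (proj₂ (decode i)) (proj₂ (decode j))))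
          ≈⟨ *-assoc _ _ _ ⟨
        scale R x * W R x * (basis (proj₁ (decode i)) 1# (proj₁ (decode j)) * δ (proj₂ (decode i)) (proj₂ (decode j)))
          ≈⟨ *-cong total identity ⟩
        sum (λ t → u t ×ᴿ (x t * x t)) * identityMatrix R i j ∎
        where
        open CommutativeRing R hiding (zero)
        open BooleanSums R
        open Sums R
        open CombineSum R
        open BitSums R
        open Algebra.Properties.Semiring.Mult semiring using (×-assoc-*; ×-congʳ) renaming (_×_ to _×ᴿ_)
        open Relation.Binary.Reasoning.Setoid setoid
        f : Fin n × Vec Bool (suc t) → Carrier
        f c = evalEntry R x (entryAt (decode i) c) * evalEntry R x (entryAt (decode j) c)
        total : scale R x * W R x ≈ sum (λ t → u t ×ᴿ (x t * x t))
        total = trans (×-assoc-* (2 ℕ.^ suc t) 1# (W R x))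
          (trans (×-congʳ (2 ℕ.^ suc t) (*-identityˡ _)) (sym (weights R (λ t → x t * x t))))
        identity : basis (proj₁ (decode i)) 1# (proj₁ (decode j)) * δ (proj₂ (decode i)) (proj₂ (decode j)) ≈ identityMatrix R i j
        identity with i Finₚ.≟ j
        ... | yes ≡.refl = trans (*-cong (reflexive (basis-same (proj₁ (decode i)) 1#)) (δ-same (proj₂ (decode i)))) (*-identityˡ _)
        ... | no i≢j with proj₁ (decode i) Finₚ.≟ proj₁ (decode j)
        ...   | no _ = zeroˡ _
        ...   | yes e = trans (*-congˡ (δ-other _ _ λ e′ → i≢j (decode-injective (≡.cong₂ _,_ e e′)))) (zeroʳ _)

-- Sums of few Golay lengths

module GolaySums where
  open GolayPairs
  open import Data.List.Base using ([]; _∷_)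
  open import Data.Nat.Base using (_+_; _*_; _∸_; _^_; _≤_; _<_; _≡ᵇ_; _≤ᵇ_; z≤n; s≤s)
  open import Defs using (2^log; sumℕ; productℕ)

  Part : Set₁
  Part = ∃ GolayPair

  -- Indexed by predecessors, so that 2 * suc c is visibly nonzero.
  primitives : List (∃ λ c → GolayPair (suc c))
  primitives = (12 , golay₁₃) ∷ (10 , golay₁₁) ∷ (4 , golay₅) ∷ (2 , golay₃) ∷ (0 , golay₁) ∷ []

  -- A sufficient test: g is a product of m ↦ 2 m c applied to a primitive length.
  mutual
    isGolay : ℕ → ℕ → Bool
    isGolay zero g = false
    isGolay (suc fuel) g = peel fuel g primitives

    peel : ℕ → ℕ → List (∃ λ c → GolayPair (suc c)) → Bool
    peel fuel g [] = isPrimitive g primitives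
    peel fuel g ((c , _) ∷ cs) =
      if g % (2 * suc c) ≡ᵇ 0 then isGolay fuel (g / (2 * suc c)) else peel fuel g cs

    isPrimitive : ℕ → List (∃ λ c → GolayPair (suc c)) → Bool
    isPrimitive g [] = false
    isPrimitive g ((c , _) ∷ cs) = if g ≡ᵇ suc c then true else isPrimitive g cs

  mutual
    -- Keeping the test apart from the pair that it certifies means that large lengths are checked
    -- by Boolean computation, without building sequences of that length.
    golayPair : ∀ fuel g → T (isGolay fuel g) → GolayPair g
    golayPair (suc fuel) g = golayPair-peel fuel g primitives

    golayPair-peel : ∀ fuel g cs → T (peel fuel g cs) → GolayPair g
    golayPair-peel fuel g [] t = golayPair-primitive g primitives t
    golayPair-peel fuel g ((c , C) ∷ cs) t with g % (2 * suc c) ≡ᵇ 0 in e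
    ... | false = golayPair-peel fuel g cs t
    ... | true  = ≡.subst GolayPair (≡.sym quotient) (golayProduct (golayPair fuel q t) C)
      where
      q = g / (2 * suc c)
      quotient : g ≡ q * suc c + q * suc c
      quotient = begin
        g                                    ≡⟨ m≡m%n+[m/n]*n g (2 * suc c) ⟩
        g % (2 * suc c) + q * (2 * suc c)    ≡⟨ ≡.cong (_+ q * (2 * suc c)) (ℕₚ.≡ᵇ⇒≡ _ 0 (Equivalence.from T-≡ e)) ⟩
        q * (suc c + (suc c + 0))            ≡⟨ ≡.cong (λ m → q * (suc c + m)) (ℕₚ.+-identityʳ (suc c)) ⟩
        q * (suc c + suc c)                  ≡⟨ ℕₚ.*-distribˡ-+ q (suc c) (suc c) ⟩
        q * suc c + q * suc c                ∎
        where open ≡.≡-Reasoning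

    golayPair-primitive : ∀ g cs → T (isPrimitive g cs) → GolayPair g
    golayPair-primitive g ((c , C) ∷ cs) t with g ≡ᵇ suc c in e
    ... | true  = ≡.subst GolayPair (≡.sym (ℕₚ.≡ᵇ⇒≡ g (suc c) (Equivalence.from T-≡ e))) C
    ... | false = golayPair-primitive g cs t

  golay? : ℕ → Bool
  golay? g = isGolay g g

  total : List Part → ℕ
  total [] = 0
  total ((m , _) ∷ ps) = m + total ps

  GolaySum : ℕ → ℕ → Set₁
  GolaySum ℓ u = ∃ λ ps → total ps ≡ u × length ps ≤ ℓ

  Reaches : ℕ → ℕ → Set₁
  Reaches ℓ V = ∀ u → u < V → GolaySum ℓ u

  -- V is the reach of ℓ parts and r the reach so far of ℓ + 1 parts. A Golay length g ≤ r leaves no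
  -- gap below g, and all remainders below V are available, so the reach grows to g + V.
  cover : ℕ → ℕ → List ℕ → ℕ
  cover V r [] = r
  cover V r (g ∷ gs) = if golay? g ∧ (g ≤ᵇ r) then cover V (g + V) gs else r

  cover-reaches : ∀ {ℓ V} → Reaches ℓ V → ∀ r gs → Reaches (suc ℓ) r → Reaches (suc ℓ) (cover V r gs)
  cover-reaches below r [] reach = reach
  cover-reaches {ℓ} {V} below r (g ∷ gs) reach with golay? g in e | g ≤ᵇ r in e′
  ... | false | _     = reach
  ... | true  | false = reach
  ... | true  | true  = cover-reaches below (g + V) gs extended
    where
    extended : Reaches (suc ℓ) (g + V)
    extended u u<g+V with u ℕₚ.<? r
    ... | yes u<r = reach u u<r
    ... | no u≮r with below (u ∸ g) (≡.subst (u ∸ g <_) (ℕₚ.m+n∸m≡n g V) (ℕₚ.∸-monoˡ-< u<g+V g≤u))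
      where
      g≤u : g ≤ u
      g≤u = ℕₚ.≤-trans (ℕₚ.≤ᵇ⇒≤ g r (Equivalence.from T-≡ e′)) (ℕₚ.≮⇒≥ u≮r)
    ...   | ps , eq , len = ((g , golayPair g g (Equivalence.from T-≡ e)) ∷ ps) ,
            ≡.trans (≡.cong (g +_) eq) (ℕₚ.m+[n∸m]≡n (ℕₚ.≤-trans (ℕₚ.≤ᵇ⇒≤ g r (Equivalence.from T-≡ e′)) (ℕₚ.≮⇒≥ u≮r))) , s≤s len

  next-level : ∀ {ℓ V} → Reaches ℓ V → ∀ gs → Reaches (suc ℓ) (cover V V gs)
  next-level {V = V} below gs = cover-reaches below V gs λ u u<V →
    let ps , eq , len = below u u<V in ps , eq , ℕₚ.m≤n⇒m≤1+n len

  -- Tables of Golay lengths. Each entry is the largest one that the reach of the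
  -- preceding entries allows; the last table runs through the octave from 2^40.
  covers1 : List ℕ
  covers1 =
    1 ∷ 2 ∷ 3 ∷ 4 ∷ 5 ∷ 6 ∷ []

  covers2 : List ℕ
  covers2 =
    6 ∷ 13 ∷ 20 ∷ 26 ∷ 32 ∷ 36 ∷ 40 ∷ 44 ∷ 50 ∷ 52 ∷ []

  covers3 : List ℕ
  covers3 =
    52 ∷ 110 ∷ 160 ∷ 216 ∷ 264 ∷ 320 ∷ 360 ∷ 416 ∷ 468 ∷ 520 ∷ 576 ∷ 624 ∷ 676 ∷ 720 ∷ 768 ∷ 800 ∷
    832 ∷ 880 ∷ 936 ∷ 968 ∷ 1024 ∷ 1080 ∷ 1100 ∷ 1152 ∷ 1200 ∷ 1248 ∷ 1300 ∷ 1352 ∷ 1408 ∷ 1452 ∷ []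

  covers4 : List ℕ
  covers4 =
    1452 ∷ 2904 ∷ 4400 ∷ 5808 ∷ 7200 ∷ 8640 ∷ 10000 ∷ 11440 ∷ 12800 ∷ 14256 ∷ 15600 ∷ 16896 ∷
    18304 ∷ 19360 ∷ 20800 ∷ 22000 ∷ 23328 ∷ 24576 ∷ 26000 ∷ 27456 ∷ 28800 ∷ 30000 ∷ 31200 ∷ 32448 ∷
    33800 ∷ 35200 ∷ 36608 ∷ 38016 ∷ 38880 ∷ 40000 ∷ 41472 ∷ 42592 ∷ 44000 ∷ 45056 ∷ 46464 ∷ 47520 ∷
    48672 ∷ 50000 ∷ 51200 ∷ 52272 ∷ 53248 ∷ 54080 ∷ 55296 ∷ 56320 ∷ 57600 ∷ 58080 ∷ 59488 ∷ 60000 ∷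
    61440 ∷ 62920 ∷ 64000 ∷ 64896 ∷ 66000 ∷ 67392 ∷ 68640 ∷ 69696 ∷ 70400 ∷ []

  covers5 : List ℕ
  covers5 =
    70400 ∷ 140800 ∷ 211200 ∷ 281600 ∷ 352000 ∷ 422400 ∷ 494208 ∷ 563200 ∷ 633600 ∷ 704000 ∷
    774400 ∷ 844800 ∷ 915200 ∷ 983040 ∷ 1054560 ∷ 1126400 ∷ 1198080 ∷ 1267200 ∷ 1331200 ∷ 1399680 ∷
    1464320 ∷ 1536000 ∷ 1606176 ∷ 1672704 ∷ 1742400 ∷ 1812096 ∷ 1881792 ∷ 1946880 ∷ 2013440 ∷
    2080000 ∷ 2141568 ∷ 2211840 ∷ 2280960 ∷ 2342912 ∷ 2400000 ∷ 2471040 ∷ 2534400 ∷ 2600000 ∷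
    2662400 ∷ 2725888 ∷ 2787840 ∷ 2855424 ∷ 2920320 ∷ 2985984 ∷ 3045328 ∷ 3115008 ∷ 3168000 ∷
    3234816 ∷ 3294720 ∷ 3359232 ∷ 3421440 ∷ 3484800 ∷ 3538944 ∷ 3604480 ∷ 3660800 ∷ 3732480 ∷
    3801600 ∷ 3872000 ∷ 3932160 ∷ 4000000 ∷ 4056000 ∷ 4118400 ∷ 4181760 ∷ 4253392 ∷ 4320000 ∷
    4380480 ∷ 4447872 ∷ 4505600 ∷ 4576000 ∷ 4646400 ∷ 4685824 ∷ 4752000 ∷ 4800000 ∷ 4867200 ∷
    4915200 ∷ 4983264 ∷ 5038848 ∷ 5068800 ∷ 5132160 ∷ []

  covers6 : List ℕ
  covers6 =
    5200000 ∷ 10400000 ∷ 15600000 ∷ 20800000 ∷ 26000000 ∷ 31200000 ∷ 36391680 ∷ 41533440 ∷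
    46725120 ∷ 51916800 ∷ 57108480 ∷ 62300160 ∷ 67491840 ∷ 72483840 ∷ 77635584 ∷ 82798848 ∷
    88000000 ∷ 92928000 ∷ 98131968 ∷ 103088128 ∷ 108160000 ∷ 113246208 ∷ 117964800 ∷ 122880000 ∷
    128000000 ∷ 133120000 ∷ 138240000 ∷ 143327232 ∷ 148482048 ∷ 153600000 ∷ 158597120 ∷ 163592000 ∷
    168729600 ∷ 173056000 ∷ 177914880 ∷ 183040000 ∷ 188179200 ∷ 193336000 ∷ 198246400 ∷ 202800000 ∷
    208000000 ∷ 212992000 ∷ 218103808 ∷ 223027200 ∷ 228096000 ∷ 233280000 ∷ 237952000 ∷ 242970624 ∷
    247808000 ∷ 252996480 ∷ 257720320 ∷ 262828800 ∷ 267988864 ∷ 272629760 ∷ 276889600 ∷ 281600000 ∷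
    286654464 ∷ 291133440 ∷ 296120448 ∷ 301086720 ∷ 306244224 ∷ 311427072 ∷ 316368000 ∷ 321235200 ∷
    326177280 ∷ 331195392 ∷ 335923200 ∷ 340787200 ∷ 345600000 ∷ 350438400 ∷ 354418688 ∷ 359424000 ∷
    364455936 ∷ 369515520 ∷ 374400000 ∷ 379551744 ∷ []

  covers7 : List ℕ
  covers7 =
    384000000 ∷ 768000000 ∷ 1152000000 ∷ 1536000000 ∷ 1920000000 ∷ 2304000000 ∷ 2687385600 ∷
    3072000000 ∷ 3456000000 ∷ 3840000000 ∷ 4224000000 ∷ 4608000000 ∷ 4992000000 ∷ 5374771200 ∷
    5759303680 ∷ 6144000000 ∷ 6523545600 ∷ 6900940800 ∷ 7278336000 ∷ 7654293504 ∷ 8031810176 ∷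
    8410521600 ∷ 8788000000 ∷ 9152000000 ∷ 9518080000 ∷ 9898803200 ∷ 10279526400 ∷ 10660336128 ∷
    11041505280 ∷ 11421696000 ∷ 11796480000 ∷ 12180258816 ∷ 12563865600 ∷ 12939264000 ∷
    13312000000 ∷ 13687345152 ∷ 14060800000 ∷ 14417920000 ∷ 14802518016 ∷ 15185664000 ∷
    15552000000 ∷ 15925248000 ∷ 16308864000 ∷ 16652832768 ∷ 17036800000 ∷ 17419276160 ∷
    17791488000 ∷ 18166726656 ∷ 18534946560 ∷ 18919194624 ∷ 19302666240 ∷ 19680620544 ∷
    20045076480 ∷ 20416281600 ∷ 20800000000 ∷ 21136287744 ∷ 21499084800 ∷ 21867356160 ∷
    22241935872 ∷ 22614958080 ∷ 22999680000 ∷ 23362560000 ∷ 23721984000 ∷ 24095430528 ∷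
    24461180928 ∷ 24843386880 ∷ 25225592832 ∷ 25600000000 ∷ 25958400000 ∷ 26321817600 ∷
    26687232000 ∷ 27040000000 ∷ 27418560000 ∷ []

  covers8 : List ℕ
  covers8 =
    27754721280 ∷ 55509442560 ∷ 83264163840 ∷ 111018885120 ∷ 138773606400 ∷ 166528327680 ∷
    194330492928 ∷ 222037770240 ∷ 249792491520 ∷ 277547212800 ∷ 305301934080 ∷ 333056655360 ∷
    360811376640 ∷ 388602593280 ∷ 416320819200 ∷ 444075540480 ∷ 471859200000 ∷ 499584983040 ∷
    527280000000 ∷ 554963042304 ∷ 582266880000 ∷ 609157120000 ∷ 636741540864 ∷ 664535040000 ∷
    692224000000 ∷ 720000000000 ∷ 747601920000 ∷ 775113670656 ∷ 802897920000 ∷ 830668800000 ∷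
    858458456064 ∷ 886046720000 ∷ 913735680000 ∷ 941004979200 ∷ 968000000000 ∷ 995328000000 ∷
    1022361600000 ∷ 1049633095680 ∷ 1076546764800 ∷ []

  octave : List ℕ
  octave =
    1100753141760 ∷ 1102479206400 ∷ 1104150528000 ∷ 1106772885504 ∷ 1108674957312 ∷ 1110188851200 ∷
    1112096793600 ∷ 1114512556032 ∷ 1116691496960 ∷ 1117952409600 ∷ 1119744000000 ∷ 1121402880000 ∷
    1123200000000 ∷ 1124864000000 ∷ 1127268679680 ∷ 1129205975040 ∷ 1131926814720 ∷ 1134139801600 ∷
    1136662585344 ∷ 1138924800000 ∷ 1140612096000 ∷ 1142169600000 ∷ 1144611274752 ∷ 1146617856000 ∷
    1149341073408 ∷ 1152000000000 ∷ 1154596405248 ∷ 1156580665344 ∷ 1158159974400 ∷ 1160950579200 ∷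
    1162670505984 ∷ 1164533760000 ∷ 1167359491584 ∷ 1169858560000 ∷ 1171456000000 ∷ 1174238208000 ∷
    1175977820160 ∷ 1177862400000 ∷ 1180380377088 ∷ 1182449664000 ∷ 1184481792000 ∷ 1186236579840 ∷
    1188137600000 ∷ 1190677542912 ∷ 1192482570240 ∷ 1194393600000 ∷ 1197291786240 ∷ 1200000000000 ∷
    1202704588800 ∷ 1204486373376 ∷ 1207388602368 ∷ 1209323520000 ∷ 1211115110400 ∷ 1213056000000 ∷
    1214853120000 ∷ 1216800000000 ∷ 1218314240000 ∷ 1221207736320 ∷ 1223306472960 ∷ 1226254049280 ∷
    1228800000000 ∷ 1231718400000 ∷ 1233543168000 ∷ 1235663104000 ∷ 1238347284480 ∷ 1239995547648 ∷
    1242169344000 ∷ 1245119496192 ∷ 1248000000000 ∷ 1250812772352 ∷ 1253826625536 ∷ 1256386560000 ∷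
    1258400000000 ∷ 1261279641600 ∷ 1263447244800 ∷ 1265472000000 ∷ 1268177264640 ∷ 1268776960000 ∷
    1271790305280 ∷ 1274019840000 ∷ 1277111238656 ∷ 1280000000000 ∷ 1282884894720 ∷ 1285089628160 ∷
    1287687684096 ∷ 1289945088000 ∷ 1291856117760 ∷ 1293926400000 ∷ 1297066101760 ∷ 1300000000000 ∷
    1302929971200 ∷ 1306069401600 ∷ 1308736000000 ∷ 1311730827264 ∷ 1313985134592 ∷ 1317020964864 ∷
    1320000000000 ∷ 1322975047680 ∷ 1324980633600 ∷ 1327104000000 ∷ 1330255872000 ∷ 1332226621440 ∷
    1334516152320 ∷ 1336338432000 ∷ 1338318192640 ∷ 1341542891520 ∷ 1343692800000 ∷ 1345683456000 ∷
    1347840000000 ∷ 1350993707008 ∷ 1352722415616 ∷ 1355047170048 ∷ 1358312177664 ∷ 1361085440000 ∷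
    1363148800000 ∷ 1366386278400 ∷ 1368734515200 ∷ 1370928000000 ∷ 1372800000000 ∷ 1375941427200 ∷
    1377979858944 ∷ 1380188160000 ∷ 1383466106880 ∷ 1384448000000 ∷ 1387736064000 ∷ 1389791969280 ∷
    1393140695040 ∷ 1395864371200 ∷ 1398969335808 ∷ 1401753600000 ∷ 1404750200832 ∷ 1408000000000 ∷
    1411173384192 ∷ 1413598590976 ∷ 1417004679168 ∷ 1418939596800 ∷ 1421378150400 ∷ 1423483895808 ∷
    1426772711936 ∷ 1429150367744 ∷ 1430979084288 ∷ 1433272320000 ∷ 1436750143488 ∷ 1440000000000 ∷
    1443245506560 ∷ 1445725831680 ∷ 1447699968000 ∷ 1451188224000 ∷ 1453338132480 ∷ 1455667200000 ∷
    1457823744000 ∷ 1460160000000 ∷ 1463281459200 ∷ 1465449283584 ∷ 1467967767552 ∷ 1471504859136 ∷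
    1474560000000 ∷ 1478062080000 ∷ 1480251801600 ∷ 1482795724800 ∷ 1486016741376 ∷ 1487200000000 ∷
    1490603212800 ∷ 1492992000000 ∷ 1496614732800 ∷ 1499463680000 ∷ 1503024906240 ∷ 1505607966720 ∷
    1509235752960 ∷ 1511828488192 ∷ 1513893888000 ∷ 1516136693760 ∷ 1518566400000 ∷ 1521812717568 ∷
    1522892800000 ∷ 1526509670400 ∷ 1528823808000 ∷ 1532454764544 ∷ 1536000000000 ∷ 1539461873664 ∷
    1542107553792 ∷ 1544578880000 ∷ 1547934105600 ∷ 1550227341312 ∷ 1552711680000 ∷ 1556479322112 ∷
    1560000000000 ∷ 1563515965440 ∷ 1567283281920 ∷ 1570483200000 ∷ 1573840502784 ∷ 1576972800000 ∷
    1579309056000 ∷ 1581648773120 ∷ 1584000000000 ∷ 1587570057216 ∷ 1589976760320 ∷ 1592524800000 ∷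
    1596389048320 ∷ 1600000000000 ∷ 1603606118400 ∷ 1606362035200 ∷ 1609851469824 ∷ 1612431360000 ∷
    1616343911424 ∷ 1619804160000 ∷ 1622400000000 ∷ 1625868288000 ∷ 1628276981760 ∷ 1631075297280 ∷
    1635005399040 ∷ 1638400000000 ∷ 1642291200000 ∷ 1646276206080 ∷ 1649410048000 ∷ 1653327396864 ∷
    1656225792000 ∷ 1660159328256 ∷ 1664000000000 ∷ 1667750363136 ∷ 1671768834048 ∷ 1675182080000 ∷
    1679160637440 ∷ 1682104320000 ∷ 1686185932288 ∷ 1689600000000 ∷ 1690903019520 ∷ 1693808962560 ∷
    1697890222080 ∷ 1701356800000 ∷ 1704993878016 ∷ 1707982848000 ∷ 1710918144000 ∷ 1713254400000 ∷
    1716916912128 ∷ 1719926784000 ∷ 1724011610112 ∷ 1728000000000 ∷ 1731894607872 ∷ 1734870998016 ∷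
    1737239961600 ∷ 1741425868800 ∷ 1744830464000 ∷ 1748974436352 ∷ 1752192000000 ∷ 1756027953152 ∷
    1760000000000 ∷ 1763966730240 ∷ 1766998238720 ∷ 1771255848960 ∷ 1773674496000 ∷ 1776722688000 ∷
    1779354869760 ∷ 1781784576000 ∷ 1784640000000 ∷ 1788723855360 ∷ 1791590400000 ∷ 1795937679360 ∷
    1800000000000 ∷ 1804056883200 ∷ 1806729560064 ∷ 1811082903552 ∷ 1814623682560 ∷ 1816672665600 ∷
    1819364032512 ∷ 1822279680000 ∷ 1824979353600 ∷ 1827904000000 ∷ 1831811604480 ∷ 1834588569600 ∷
    1837465344000 ∷ 1840250880000 ∷ 1844621475840 ∷ 1847791595520 ∷ 1850314752000 ∷ 1853494656000 ∷
    1857616347136 ∷ 1859993321472 ∷ 1863254016000 ∷ 1866240000000 ∷ 1869004800000 ∷ 1873000267776 ∷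
    1876219158528 ∷ 1880739938304 ∷ 1884579840000 ∷ 1887436800000 ∷ 1891919462400 ∷ 1895170867200 ∷
    1898208000000 ∷ 1901020160000 ∷ 1903616000000 ∷ 1907972112384 ∷ 1911029760000 ∷ 1915666857984 ∷
    1920000000000 ∷ 1924327342080 ∷ 1927634442240 ∷ 1931531526144 ∷ 1936000000000 ∷ 1940363403264 ∷
    1943764992000 ∷ 1948381433856 ∷ 1951041945600 ∷ 1953932378112 ∷ 1957290356736 ∷ 1962006478848 ∷
    1966080000000 ∷ 1970749440000 ∷ 1975531447296 ∷ 1979760640000 ∷ 1984462571520 ∷ 1987470950400 ∷
    1990656000000 ∷ 1995486310400 ∷ 2000000000000 ∷ 2004507648000 ∷ 2007477288960 ∷ 2012314337280 ∷
    2015539200000 ∷ 2018525184000 ∷ 2021760000000 ∷ 2026490560512 ∷ 2030043136000 ∷ 2034864488448 ∷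
    2038844121600 ∷ 2043756748800 ∷ 2048000000000 ∷ 2052864000000 ∷ 2056143405056 ∷ 2059200000000 ∷
    2063912140800 ∷ 2066969788416 ∷ 2070282240000 ∷ 2075305762816 ∷ 2080000000000 ∷ 2084687953920 ∷
    2089711042560 ∷ 2093977600000 ∷ 2098454003712 ∷ 2102630400000 ∷ 2107125301248 ∷ 2112000000000 ∷
    2116760076288 ∷ 2120397886464 ∷ 2125507018752 ∷ 2129920000000 ∷ 2134978560000 ∷ 2138647680000 ∷
    2143725551616 ∷ 2147483648000 ∷ 2152583921664 ∷ 2156544000000 ∷ 2160000000000 ∷ 2164868259840 ∷
    2167824384000 ∷ 2171549952000 ∷ 2176782336000 ∷ 2181038080000 ∷ 2186218045440 ∷ 2189975224320 ∷
    2195034941440 ∷ []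

  reaches₀ : Reaches 0 1
  reaches₀ zero _ = [] , ≡.refl , z≤n
  reaches₀ (suc u) (s≤s ())

  -- Each bound is the last entry of its table plus the preceding reach; one part reaches 7 and two
  -- parts reach 59.
  reaches₃ : Reaches 3 1511
  reaches₃ = next-level (next-level (next-level reaches₀ covers1) covers2) covers3

  reaches₄ : Reaches 4 71911
  reaches₄ = next-level reaches₃ covers4

  reaches₅ : Reaches 5 5204071
  reaches₅ = next-level reaches₄ covers5

  reaches₆ : Reaches 6 384755815
  reaches₆ = next-level reaches₅ covers6

  -- The reach has to exceed 2^(104/3), about 2.727 * 10^10, where an eighth part becomes
  -- affordable. The margin is small.
  reaches₇ : Reaches 7 27803315815
  reaches₇ = next-level reaches₆ covers7

  -- This passes 2^40, about 1.0995 * 10^12, where `large-close` begins to apply.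
  reaches₈ : Reaches 8 1104350080615
  reaches₈ = next-level reaches₇ covers8

  -- Since 407^3 exceeds 2^26, one part that reduces u by the factor 407 pays for
  -- the increase of the number of parts by one.
  dense : ℕ → List ℕ → ℕ → Bool
  dense g [] end = golay? g ∧ (407 * (end ∸ g) ≤ᵇ g)
  dense g (g′ ∷ gs) end = (golay? g ∧ (407 * (g′ ∸ g) ≤ᵇ g)) ∧ dense g′ gs end

  -- The product with the pair of length 1 doubles a length, so a table for a single octave serves
  -- all higher octaves.
  golayDouble : ∀ j {g} → GolayPair g → GolayPair (2 ^ j * g)
  golayDouble zero {g} G = ≡.subst GolayPair (≡.sym (ℕₚ.+-identityʳ g)) G
  golayDouble (suc j) {g} G = ≡.subst GolayPair (eq (2 ^ j) g) (golayProduct (golayDouble j G) golay₁)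
    where
    eq : ∀ p g → p * g * 1 + p * g * 1 ≡ (2 * p) * g
    eq = solve-∀

  Close : ℕ → Set₁
  Close u = ∃ λ m → GolayPair m × m ≤ u × 407 * (u ∸ m) ≤ u

  -- As u lies below the next length, its remainder is less than the gap, and the gap scales by 2^j
  -- in the same way as the length itself.
  close : ∀ j {g g′ u} → T (golay? g ∧ (407 * (g′ ∸ g) ≤ᵇ g)) → 2 ^ j * g ≤ u → u < 2 ^ j * g′ → Close u
  close j {g} {g′} {u} t lower upper = 2 ^ j * g , golayDouble j (golayPair g g (proj₁ ts)) , lower , (begin
    407 * (u ∸ 2 ^ j * g)              ≤⟨ ℕₚ.*-monoʳ-≤ 407 (ℕₚ.∸-monoˡ-≤ (2 ^ j * g) (ℕₚ.<⇒≤ upper)) ⟩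
    407 * (2 ^ j * g′ ∸ 2 ^ j * g)     ≡⟨ ≡.cong (407 *_) (ℕₚ.*-distribˡ-∸ (2 ^ j) g′ g) ⟨
    407 * (2 ^ j * (g′ ∸ g))           ≡⟨ swap (2 ^ j) (g′ ∸ g) ⟩
    2 ^ j * (407 * (g′ ∸ g))           ≤⟨ ℕₚ.*-monoʳ-≤ (2 ^ j) (ℕₚ.≤ᵇ⇒≤ _ g (proj₂ ts)) ⟩
    2 ^ j * g                          ≤⟨ lower ⟩
    u                                  ∎)
    where
    open ℕₚ.≤-Reasoning
    ts = Equivalence.to (T-∧ {golay? g}) t
    swap : ∀ p d → 407 * (p * d) ≡ p * (407 * d)
    swap = solve-∀

  dense-close : ∀ j g gs end {u} → T (dense g gs end) → 2 ^ j * g ≤ u → u < 2 ^ j * end → Close u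
  dense-close j g [] end t lower upper = close j {g} {end} t lower upper
  dense-close j g (g′ ∷ gs) end {u} t lower upper with u ℕₚ.<? 2 ^ j * g′
  ... | yes u< = close j {g} {g′} (proj₁ (Equivalence.to (T-∧ {golay? g ∧ (407 * (g′ ∸ g) ≤ᵇ g)}) t)) lower u<
  ... | no u≮  = dense-close j g′ gs end (proj₂ (Equivalence.to (T-∧ {golay? g ∧ (407 * (g′ ∸ g) ≤ᵇ g)}) t)) (ℕₚ.≮⇒≥ u≮) upper

  -- The ends are 2^40 and 2^41; the lower one is itself a Golay length and serves as the first
  -- entry.
  octave-dense : T (dense 1099511627776 octave 2199023255552)
  octave-dense = tt

  n<2^n : ∀ n → n < 2 ^ n
  n<2^n zero = s≤s z≤n
  n<2^n (suc n) = ℕₚ.≤-trans (ℕₚ.+-mono-≤ (ℕₚ.≤-trans (s≤s z≤n) (n<2^n n)) (n<2^n n))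
    (ℕₚ.≤-reflexive (≡.cong (2 ^ n +_) (≡.sym (ℕₚ.+-identityʳ (2 ^ n)))))

  -- The search descends from an exponent n that is surely too large; u itself can be used, since u
  -- < 2^u.
  find-octave : ∀ n X u → X ≤ u → u < 2 ^ n * X → ∃ λ j → 2 ^ j * X ≤ u × u < 2 ^ j * (2 * X)
  find-octave zero X u lower upper = contradiction (ℕₚ.≤-trans upper (ℕₚ.≤-reflexive (ℕₚ.+-identityʳ X))) (ℕₚ.≤⇒≯ lower)
  find-octave (suc n) X u lower upper with u ℕₚ.<? 2 ^ n * X
  ... | yes u< = find-octave n X u lower u<
  ... | no u≮  = n , ℕₚ.≮⇒≥ u≮ , ≡.subst (u <_) (eq (2 ^ n) X) upper
    where
    eq : ∀ p X → (2 * p) * X ≡ p * (2 * X)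
    eq = solve-∀

  large-close : ∀ u → 1099511627776 ≤ u → Close u
  large-close u X≤u =
    let j , lower , upper = find-octave u 1099511627776 u X≤u
          (ℕₚ.≤-trans (n<2^n u) (ℕₚ.m≤m*n (2 ^ u) 1099511627776))
    in dense-close j 1099511627776 octave 2199023255552 octave-dense lower upper

  -- For e = 13, the number of parts is at most (3/26) log₂ u + 4. The exponent
  -- stays symbolic, since the type checker would unfold numerical powers of 2.
  Decomposition : ℕ → ℕ → Set₁
  Decomposition e u = ∃ λ ps → total ps ≡ u × 2 ^ (e * (2 * length ps)) ≤ 2^log u ^ 3 * 2 ^ (e * 8)

  cube-* : ∀ a b → (a * b) ^ 3 ≡ a ^ 3 * b ^ 3
  cube-* = expanded
    where
    expanded : ∀ a b → a * b * (a * b * (a * b * 1)) ≡ a * (a * (a * 1)) * (b * (b * (b * 1)))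
    expanded = solve-∀

  -- Four parts are free. For e = 13, another j of them require 26j ≤ 3 log u, and it suffices to
  -- test this at the lower end V of a range.
  few-parts : ∀ e j V u ℓ → 2 ^ (e * (2 * j)) ≤ V ^ 3 → V ≤ u → ℓ ≤ 4 + j →
              2 ^ (e * (2 * ℓ)) ≤ u ^ 3 * 2 ^ (e * 8)
  few-parts e j V u ℓ threshold V≤u ℓ≤ = begin
    2 ^ (e * (2 * ℓ))                  ≤⟨ ℕₚ.^-monoʳ-≤ 2 (ℕₚ.*-monoʳ-≤ e (ℕₚ.*-monoʳ-≤ 2 ℓ≤)) ⟩
    2 ^ (e * (2 * (4 + j)))            ≡⟨ ≡.cong (2 ^_) (split e j) ⟩
    2 ^ (e * (2 * j) + e * 8)          ≡⟨ ℕₚ.^-distribˡ-+-* 2 (e * (2 * j)) (e * 8) ⟩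
    2 ^ (e * (2 * j)) * 2 ^ (e * 8)    ≤⟨ ℕₚ.*-monoˡ-≤ (2 ^ (e * 8)) (ℕₚ.≤-trans threshold (ℕₚ.^-monoˡ-≤ 3 V≤u)) ⟩
    u ^ 3 * 2 ^ (e * 8)                ∎
    where
    open ℕₚ.≤-Reasoning
    split : ∀ e j → e * (2 * (4 + j)) ≡ e * (2 * j) + e * 8
    split = solve-∀

  -- In logarithms: log w ≤ log u - log q, while 3 log q ≥ 2e pays for the new part. For e = 13 the
  -- least such q is 407.
  one-more-part : ∀ e q u w ℓ E → 2 ^ (e * 2) ≤ q ^ 3 → q * w ≤ u →
    2 ^ (e * (2 * ℓ)) ≤ w ^ 3 * E → 2 ^ (e * (2 * suc ℓ)) ≤ u ^ 3 * E
  one-more-part e q u w ℓ E threshold near bound = begin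
    2 ^ (e * (2 * suc ℓ))                ≡⟨ ≡.cong (2 ^_) (split e ℓ) ⟩
    2 ^ (e * 2 + e * (2 * ℓ))            ≡⟨ ℕₚ.^-distribˡ-+-* 2 (e * 2) (e * (2 * ℓ)) ⟩
    2 ^ (e * 2) * 2 ^ (e * (2 * ℓ))      ≤⟨ ℕₚ.*-mono-≤ threshold bound ⟩
    q ^ 3 * (w ^ 3 * E)                  ≡⟨ ℕₚ.*-assoc (q ^ 3) (w ^ 3) E ⟨
    q ^ 3 * w ^ 3 * E                    ≡⟨ ≡.cong (_* E) (cube-* q w) ⟨
    (q * w) ^ 3 * E                      ≤⟨ ℕₚ.*-monoˡ-≤ E (ℕₚ.^-monoˡ-≤ 3 near) ⟩
    u ^ 3 * E                            ∎
    where
    open ℕₚ.≤-Reasoning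
    split : ∀ e ℓ → e * (2 * suc ℓ) ≡ e * 2 + e * (2 * ℓ)
    split = solve-∀

  ≤2^log : ∀ u → u ≤ 2^log u
  ≤2^log zero = z≤n
  ≤2^log (suc u) = ℕₚ.≤-refl

  decomposition-0 : ∀ e → Decomposition e 0
  decomposition-0 e = [] , ≡.refl , (begin
    2 ^ (e * 0)            ≡⟨ ≡.cong (2 ^_) (ℕₚ.*-zeroʳ e) ⟩
    1                      ≤⟨ ℕₚ.m^n>0 2 (e * 8) ⟩
    2 ^ (e * 8)            ≡⟨ ℕₚ.*-identityˡ (2 ^ (e * 8)) ⟨
    1 * 2 ^ (e * 8)        ∎)
    where open ℕₚ.≤-Reasoning

  from-reaches : ∀ e j {V V′} → T (2 ^ (e * (2 * j)) ≤ᵇ V ^ 3) → Reaches (4 + j) V′ →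
                 ∀ u → V ≤ u → u < V′ → Decomposition e u
  from-reaches e j {V} t reach u V≤u u<V′ with reach u u<V′
  ... | ps , eq , len = ps , eq ,
    few-parts e j V (2^log u) (length ps) (ℕₚ.≤ᵇ⇒≤ _ _ t) (ℕₚ.≤-trans V≤u (≤2^log u)) len

  decompose-close : ∀ e q u → T (2 ^ (e * 2) ≤ᵇ q ^ 3) → 2 ≤ q → q ≤ u →
    (∃ λ m → GolayPair m × m ≤ u × q * (u ∸ m) ≤ u) → (∀ {w} → w < u → Decomposition e w) → Decomposition e u
  decompose-close e q u t 2≤q q≤u (m , G , m≤u , near) rec with rec {u ∸ m} smaller
    where
    instance
      u≢0 : ℕ.NonZero u
      u≢0 = ℕ.>-nonZero (ℕₚ.≤-trans (s≤s z≤n) (ℕₚ.≤-trans 2≤q q≤u))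
    smaller : u ∸ m < u
    smaller = ℕₚ.≰⇒> λ u≤ → ℕₚ.<⇒≱ (≡.subst (u <_) (ℕₚ.*-comm u q) (ℕₚ.m<m*n u q 2≤q))
      (ℕₚ.≤-trans (ℕₚ.*-monoʳ-≤ q u≤) near)
  ... | ps , eq , bound = ((m , G) ∷ ps) , ≡.trans (≡.cong (m +_) eq) (ℕₚ.m+[n∸m]≡n m≤u) ,
    one-more-part e q (2^log u) (2^log (u ∸ m)) (length ps) (2 ^ (e * 8)) (ℕₚ.≤ᵇ⇒≤ _ _ t)
      (ℕₚ.≤-trans (near′ (u ∸ m) near) (≤2^log u)) bound
    where
    -- A remainder 0 enters the bound as 1, by the convention log 0 = 0; this case is where q ≤ u is
    -- needed.
    near′ : ∀ w → q * w ≤ u → q * 2^log w ≤ u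
    near′ zero _ = ℕₚ.≤-trans (ℕₚ.≤-reflexive (ℕₚ.*-identityʳ q)) q≤u
    near′ (suc w) p = p

  -- From 2^(26j/3) on, 4 + j parts are allowed: about 406, 165140, 6.71 * 10^7 and 2.73 * 10^10 for
  -- j = 1, 2, 3, 4. With one part fewer, the tables reach beyond each of these values. After the
  -- last table, one close Golay length is split off and the remainder is handled by recursion.
  decompose : ∀ u → Decomposition 13 u
  decompose = <-rec (Decomposition 13) step
    where
    step : ∀ u → (∀ {w} → w < u → Decomposition 13 w) → Decomposition 13 u
    step u rec with u ℕₚ.≟ 0
    ... | yes ≡.refl = decomposition-0 13
    ... | no u≢0 with u ℕₚ.<? 71911
    ...   | yes u< = from-reaches 13 0 {1} tt reaches₄ u (ℕₚ.n≢0⇒n>0 u≢0) u<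
    ...   | no u≥₄ with u ℕₚ.<? 5204071
    ...     | yes u< = from-reaches 13 1 {71911} tt reaches₅ u (ℕₚ.≮⇒≥ u≥₄) u<
    ...     | no u≥₅ with u ℕₚ.<? 384755815
    ...       | yes u< = from-reaches 13 2 {5204071} tt reaches₆ u (ℕₚ.≮⇒≥ u≥₅) u<
    ...       | no u≥₆ with u ℕₚ.<? 27803315815
    ...         | yes u< = from-reaches 13 3 {384755815} tt reaches₇ u (ℕₚ.≮⇒≥ u≥₆) u<
    ...         | no u≥₇ with u ℕₚ.<? 1104350080615
    ...           | yes u< = from-reaches 13 4 {27803315815} tt reaches₈ u (ℕₚ.≮⇒≥ u≥₇) u<
    ...           | no u≥₈ = decompose-close 13 407 u tt (ℕₚ.≤ᵇ⇒≤ 2 407 tt) (ℕₚ.≤-trans (ℕₚ.≤ᵇ⇒≤ 407 1104350080615 tt) X≤u)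
                               (large-close u (ℕₚ.≤-trans (ℕₚ.≤ᵇ⇒≤ 1099511627776 1104350080615 tt) X≤u)) rec
      where
      X≤u = ℕₚ.≮⇒≥ u≥₈

  parts-bound : ∀ e {l} (w : Fin l → ℕ) (ℓ : Fin l → ℕ) →
    (∀ i → 2 ^ (e * (2 * ℓ i)) ≤ 2^log (w i) ^ 3 * 2 ^ (e * 8)) →
    2 ^ (e * (2 * sumℕ ℓ)) ≤ productℕ (λ i → 2^log (w i)) ^ 3 * 2 ^ (e * (8 * l))
  parts-bound e {zero} w ℓ bound = ℕₚ.≤-reflexive (≡.trans (≡.cong (2 ^_) (ℕₚ.*-zeroʳ e))
    (≡.sym (≡.trans (ℕₚ.+-identityʳ _) (≡.cong (2 ^_) (ℕₚ.*-zeroʳ e)))))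
  parts-bound e {suc l} w ℓ bound = begin
    2 ^ (e * (2 * (ℓ zero + L)))                         ≡⟨ ≡.cong (2 ^_) (split e (ℓ zero) L) ⟩
    2 ^ (e * (2 * ℓ zero) + e * (2 * L))             ≡⟨ ℕₚ.^-distribˡ-+-* 2 (e * (2 * ℓ zero)) (e * (2 * L)) ⟩
    2 ^ (e * (2 * ℓ zero)) * 2 ^ (e * (2 * L))       ≤⟨ ℕₚ.*-mono-≤ (bound zero) (parts-bound e (w ∘ suc) (ℓ ∘ suc) (bound ∘ suc)) ⟩
    (A ^ 3 * a) * (B ^ 3 * b)                            ≡⟨ swap (A ^ 3) a (B ^ 3) b ⟩
    (A ^ 3 * B ^ 3) * (a * b)                            ≡⟨ ≡.cong₂ ℕ._*_ (cube-* A B) (ℕₚ.^-distribˡ-+-* 2 (e * 8) (e * (8 * l))) ⟨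
    (A * B) ^ 3 * 2 ^ (e * 8 + e * (8 * l))        ≡⟨ ≡.cong (λ m → (A * B) ^ 3 * 2 ^ m)
                                                                    (≡.trans (≡.cong (e *_) (ℕₚ.*-suc 8 l)) (ℕₚ.*-distribˡ-+ e 8 (8 * l))) ⟨
    (A * B) ^ 3 * 2 ^ (e * (8 * suc l))                ∎
    where
    open ℕₚ.≤-Reasoning
    L A B a b : ℕ
    L = sumℕ (ℓ ∘ suc)
    A = 2^log (w zero)
    B = productℕ (λ i → 2^log (w (suc i)))
    a = 2 ^ (e * 8)
    b = 2 ^ (e * (8 * l))
    split : ∀ e m L → e * (2 * (m + L)) ≡ e * (2 * m) + e * (2 * L)
    split = solve-∀
    swap : ∀ p q r s → (p * q) * (r * s) ≡ (p * r) * (q * s)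
    swap = solve-∀

  -- For e = 13, doubling (3/26) log w + 4 gives (3/13) log w + 8 for each of the l numbers; the
  -- summand 4 is the part of the exponent that does not depend on the pairs.
  exponent-bound : ∀ e {l} (w : Fin l → ℕ) (ℓ : Fin l → ℕ) →
    (∀ i → 2 ^ (e * (2 * ℓ i)) ≤ 2^log (w i) ^ 3 * 2 ^ (e * 8)) →
    2 ^ (e * (2 * sumℕ ℓ + 4)) ≤ productℕ (λ i → 2^log (w i)) ^ 3 * 2 ^ (e * (8 * l + 4))
  exponent-bound e {l} w ℓ bound = begin
    2 ^ (e * (2 * L + 4))                        ≡⟨ power (2 * L) ⟩
    2 ^ (e * (2 * L)) * 2 ^ (e * 4)            ≤⟨ ℕₚ.*-monoˡ-≤ (2 ^ (e * 4)) (parts-bound e w ℓ bound) ⟩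
    P ^ 3 * 2 ^ (e * (8 * l)) * 2 ^ (e * 4)  ≡⟨ ℕₚ.*-assoc (P ^ 3) _ _ ⟩
    P ^ 3 * (2 ^ (e * (8 * l)) * 2 ^ (e * 4)) ≡⟨ ≡.cong (P ^ 3 *_) (power (8 * l)) ⟨
    P ^ 3 * 2 ^ (e * (8 * l + 4))              ∎
    where
    open ℕₚ.≤-Reasoning
    L P : ℕ
    L = sumℕ ℓ
    P = productℕ (λ i → 2^log (w i))
    power : ∀ m → 2 ^ (e * (m + 4)) ≡ 2 ^ (e * m) * 2 ^ (e * 4)
    power m = ≡.trans (≡.cong (2 ^_) (ℕₚ.*-distribˡ-+ e m 4)) (ℕₚ.^-distribˡ-+-* 2 (e * m) (e * 4))

-- Assembling the pairs for all variables into one design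

module Assemble where
  open GolayPairs
  open Patterns
  open Designs
  open GolaySums
  open import Data.List.Base using ([]; _∷_; _++_)
  open import Data.Nat.Base using (_∸_; _^_; _≤_)
  open import Defs using (OD; sumℕ)

  toBlocks : ∀ {k} → Fin k → List Part → List (Block k)
  toBlocks v = List.map (λ (m , G) → block v G)

  blocks : ∀ {k l} → (Fin l → List Part) → (Fin l → Fin k) → List (Block k)
  blocks {l = zero} ps ι = []
  blocks {l = suc l} ps ι = toBlocks (ι zero) (ps zero) ++ blocks (ps ∘ suc) (ι ∘ suc)

  sumℕ-cong : ∀ {l} {f g : Fin l → ℕ} → (∀ i → f i ≡ g i) → sumℕ f ≡ sumℕ g
  sumℕ-cong {zero} e = ≡.refl
  sumℕ-cong {suc l} e = ≡.cong₂ ℕ._+_ (e zero) (sumℕ-cong (e ∘ suc))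

  bits-length : ∀ {k} (bs : List (Block k)) → bits bs ≡ suc (2 ℕ.* length bs)
  bits-length [] = ≡.refl
  bits-length (b ∷ bs) = ≡.trans (≡.cong (λ m → suc (suc m)) (bits-length bs)) (≡.cong suc (≡.sym (ℕₚ.*-suc 2 (length bs))))

  blocks-length : ∀ {k l} (ps : Fin l → List Part) (ι : Fin l → Fin k) → length (blocks ps ι) ≡ sumℕ (length ∘ ps)
  blocks-length {l = zero} ps ι = ≡.refl
  blocks-length {l = suc l} ps ι = ≡.trans (Listₚ.length-++ (toBlocks (ι zero) (ps zero)))
    (≡.cong₂ ℕ._+_ (Listₚ.length-map _ (ps zero)) (blocks-length (ps ∘ suc) (ι ∘ suc)))

  cellCount-++ : ∀ {k} (v : Fin k) ps bs → cellCount (toBlocks v ps ++ bs) ≡ total ps ℕ.+ cellCount bs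
  cellCount-++ v [] bs = ≡.refl
  cellCount-++ v ((m , G) ∷ ps) bs = ≡.trans (≡.cong (m ℕ.+_) (cellCount-++ v ps bs)) (≡.sym (ℕₚ.+-assoc m (total ps) _))

  blocks-cellCount : ∀ {k l} (ps : Fin l → List Part) (ι : Fin l → Fin k) → cellCount (blocks ps ι) ≡ sumℕ (total ∘ ps)
  blocks-cellCount {l = zero} ps ι = ≡.refl
  blocks-cellCount {l = suc l} ps ι = ≡.trans (cellCount-++ (ι zero) (ps zero) (blocks (ps ∘ suc) (ι ∘ suc)))
    (≡.cong (total (ps zero) ℕ.+_) (blocks-cellCount (ps ∘ suc) (ι ∘ suc)))

  module BlockWeights (R : CommutativeRing 0ℓ 0ℓ) {k : ℕ} (y : Fin k → CommutativeRing.Carrier R) where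
    open CommutativeRing R hiding (zero)
    open Sums R
    open Weight R y
    open IntegerSolver R
    open Algebra.Properties.Semiring.Mult semiring using (×-homo-+; ×-congʳ; ×-assocˡ) renaming (_×_ to _×ᴿ_)
    open Algebra.Properties.CommutativeMonoid.Mult +-commutativeMonoid using (×-distrib-+)
    open Relation.Binary.Reasoning.Setoid setoid

    weight-++ : ∀ v w ps bs → weight v (toBlocks w ps ++ bs) ≈ weight v bs + (4 ℕ.* total ps) ×ᴿ y w
    weight-++ v w [] bs = sym (+-identityʳ _)
    weight-++ v w ((m , G) ∷ ps) bs = begin
      weight v (toBlocks w ps ++ bs) + (4 ℕ.* m) ×ᴿ y w                      ≈⟨ +-congʳ (weight-++ v w ps bs) ⟩
      weight v bs + (4 ℕ.* total ps) ×ᴿ y w + (4 ℕ.* m) ×ᴿ y w               ≈⟨ solve 3 (λ a b c → a :+ b :+ c := a :+ (c :+ b)) refl _ _ _ ⟩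
      weight v bs + ((4 ℕ.* m) ×ᴿ y w + (4 ℕ.* total ps) ×ᴿ y w)             ≈⟨ +-congˡ (×-homo-+ (y w) (4 ℕ.* m) (4 ℕ.* total ps)) ⟨
      weight v bs + (4 ℕ.* m ℕ.+ 4 ℕ.* total ps) ×ᴿ y w
        ≡⟨ ≡.cong (λ j → weight v bs + j ×ᴿ y w) (ℕₚ.*-distribˡ-+ 4 m (total ps)) ⟨
      weight v bs + (4 ℕ.* (m ℕ.+ total ps)) ×ᴿ y w                          ∎

    weight-blocks : ∀ {l} v (ps : Fin l → List Part) (ι : Fin l → Fin k) →
      weight v (blocks ps ι) ≈ 4 ×ᴿ y v + sum (λ i → (4 ℕ.* total (ps i)) ×ᴿ y (ι i))
    weight-blocks {zero} v ps ι = sym (+-identityʳ _)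
    weight-blocks {suc l} v ps ι = trans (weight-++ v (ι zero) (ps zero) (blocks (ps ∘ suc) (ι ∘ suc)))
      (trans (+-congʳ (weight-blocks v (ps ∘ suc) (ι ∘ suc)))
        (solve 3 (λ a b c → a :+ b :+ c := a :+ (c :+ b)) refl _ _ _))

    sum-× : ∀ {l} m (f : Fin l → Carrier) → m ×ᴿ sum f ≈ sum (λ i → m ×ᴿ f i)
    sum-× {zero} m f = ×-zero m
      where
      ×-zero : ∀ m → m ×ᴿ 0# ≈ 0#
      ×-zero zero = refl
      ×-zero (suc m) = trans (+-identityˡ _) (×-zero m)
    sum-× {suc l} m f = trans (×-distrib-+ (f zero) (sum (f ∘ suc)) m) (+-congˡ (sum-× m (f ∘ suc)))

  module Assembly (k′ : ℕ) (u : Fin (suc k′) → ℕ) (u-positive : ∀ i → 1 ≤ u i) (w : Fin (suc k′) → ℕ)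
    (w-zero : suc (w zero) ≡ u zero) (w-suc : ∀ i → w (suc i) ≡ u (suc i))
    (ps : Fin (suc k′) → List Part) (ps-total : ∀ i → total (ps i) ≡ w i) where

    bs : List (Block (suc k′))
    bs = blocks ps (λ i → i)

    exponent : ℕ
    exponent = 2 ℕ.* sumℕ (length ∘ ps) ℕ.+ 4

    bits-bs : bits bs ≡ suc (2 ℕ.* sumℕ (length ∘ ps))
    bits-bs = ≡.trans (bits-length bs) (≡.cong (λ m → suc (2 ℕ.* m)) (blocks-length ps (λ i → i)))

    -- The center counts as one cell and makes up for the unit taken from the first entry of u.
    cells-bs : suc (cellCount bs) ≡ sumℕ u
    cells-bs = ≡.trans (≡.cong suc (≡.trans (blocks-cellCount ps (λ i → i)) (sumℕ-cong ps-total)))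
      (≡.cong₂ ℕ._+_ w-zero (sumℕ-cong w-suc))

    module _ (e : ℕ) where
      s : ℕ
      s = suc (e ℕ.+ bits bs)

      -- The factor `2 ^ s` is the order of the Walsh matrix, and 4 is the number of group elements
      -- in a cell. The padding e is what reaches all larger exponents.
      2^ : 2 ^ (e ℕ.+ exponent) ≡ 2 ^ s ℕ.* 4
      2^ = ≡.trans (≡.cong (2 ^_) (≡.trans (exponents e (sumℕ (length ∘ ps))) (≡.cong (λ b → suc (e ℕ.+ b) ℕ.+ 2) (≡.sym bits-bs))))
        (ℕₚ.^-distribˡ-+-* 2 s 2)
        where
        exponents : ∀ e L → e ℕ.+ (2 ℕ.* L ℕ.+ 4) ≡ suc (e ℕ.+ suc (2 ℕ.* L)) ℕ.+ 2
        exponents = solve-∀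

      weights : WeightsAre zero bs (2 ^ s) (λ i → 2 ^ (e ℕ.+ exponent) ℕ.* u i)
      weights R y = sym (begin
        (2 ^ s) ×ᴿ weight zero bs
          ≈⟨ ×-congʳ (2 ^ s) (trans (weight-blocks zero ps (λ i → i)) (sym (+-assoc _ _ _))) ⟩
        (2 ^ s) ×ᴿ (4 ×ᴿ y zero + (4 ℕ.* total (ps zero)) ×ᴿ y zero + sum (λ i → (4 ℕ.* total (ps (suc i))) ×ᴿ y (suc i)))
          ≈⟨ ×-congʳ (2 ^ s) (+-cong (trans (sym (×-homo-+ (y zero) 4 (4 ℕ.* total (ps zero)))) (reflexive (≡.cong (_×ᴿ y zero) first)))
               (sum-cong-≋ (λ i → reflexive (≡.cong (λ m → (4 ℕ.* m) ×ᴿ y (suc i)) (≡.trans (ps-total (suc i)) (w-suc i)))))) ⟩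
        (2 ^ s) ×ᴿ sum (λ i → (4 ℕ.* u i) ×ᴿ y i)
          ≈⟨ sum-× (2 ^ s) (λ i → (4 ℕ.* u i) ×ᴿ y i) ⟩
        sum (λ i → (2 ^ s) ×ᴿ ((4 ℕ.* u i) ×ᴿ y i))
          ≈⟨ sum-cong-≋ (λ i → trans (×-assocˡ (y i) (2 ^ s) (4 ℕ.* u i)) (reflexive (≡.cong (_×ᴿ y i)
               (≡.trans (≡.sym (ℕₚ.*-assoc (2 ^ s) 4 (u i))) (≡.cong (ℕ._* u i) (≡.sym 2^)))))) ⟩
        sum (λ i → (2 ^ (e ℕ.+ exponent) ℕ.* u i) ×ᴿ y i) ∎)
        where
        open CommutativeRing R hiding (zero)
        open Sums R
        open Weight R y
        open BlockWeights R y
        open Algebra.Properties.Semiring.Mult semiring using (×-homo-+; ×-congʳ; ×-assocˡ) renaming (_×_ to _×ᴿ_)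
        open Relation.Binary.Reasoning.Setoid setoid
        first : 4 ℕ.+ 4 ℕ.* total (ps zero) ≡ 4 ℕ.* u zero
        first = ≡.trans (≡.sym (ℕₚ.*-suc 4 (total (ps zero)))) (≡.cong (4 ℕ.*_) (≡.trans (≡.cong suc (ps-total zero)) w-zero))

      design : OD (2 ^ (e ℕ.+ exponent) ℕ.* sumℕ u) (λ i → 2 ^ (e ℕ.+ exponent) ℕ.* u i)
      design = ≡.subst (λ n → OD n (λ i → 2 ^ (e ℕ.+ exponent) ℕ.* u i)) order-eq
        (RealDesign.design zero bs e (λ i → 2 ^ (e ℕ.+ exponent) ℕ.* u i)
          (λ i → ℕₚ.*-mono-≤ (ℕₚ.m^n>0 2 (e ℕ.+ exponent)) (u-positive i)) weights)
        where
        rearrange : ∀ p t → 4 ℕ.* p ℕ.* t ≡ t ℕ.* 4 ℕ.* p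
        rearrange = solve-∀
        order-eq : 4 ℕ.* suc (cellCount bs) ℕ.* 2 ^ s ≡ 2 ^ (e ℕ.+ exponent) ℕ.* sumℕ u
        order-eq = ≡.trans (rearrange (suc (cellCount bs)) (2 ^ s)) (≡.cong₂ ℕ._*_ (≡.sym 2^) cells-bs)

    designs : ∀ n → exponent ≤ n → OD (2 ^ n ℕ.* sumℕ u) (λ i → 2 ^ n ℕ.* u i)
    designs n N≤n = ≡.subst (λ n → OD (2 ^ n ℕ.* sumℕ u) (λ i → 2 ^ n ℕ.* u i)) (ℕₚ.m∸n+n≡m N≤n) (design (n ∸ exponent))

open import Data.Fin.Base using (Fin; zero; suc)
open import Data.Integer.Base using () renaming (_≥_ to _≥ᶻ_)
open import Data.Nat.Base using (ℕ; suc; _+_; _*_; _∸_; _^_; _≤_; _≥_)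
open import Data.Product.Base using (∃; _×_)
open import Data.Vec.Functional using (Vector; _∷_; tail)
open import Defs
open GolaySums using (decompose; exponent-bound)
open Assemble using (module Assembly)

theorem9 : ∀ (k′ : ℕ) → let k = suc k′ in
    ∀ (u : Vector ℕ k) →
    (∀ i → 1 ≤ u i) →
    (∀ (i : Fin k′) → Δℓc (u zero) ≥ᶻ Δℓc (u (suc i))) →
    ∃ λ (N : ℕ) →
    (N ≤3/13∑log ((u zero ∸ 1) ∷ tail u) plus (8 * k + 4)) ×
    (∀ n → n ≥ N → OD (2 ^ n * sumℕ u) (λ i → 2 ^ n * u i))
theorem9 k′ u positive _ = exponent , exponent-bound 13 w (λ i → length (ps i)) (λ i → proj₂ (proj₂ (decompose (w i)))) , designs
  where
  w : Vector ℕ (suc k′)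
  w = (u zero ∸ 1) ∷ tail u
  ps = λ i → proj₁ (decompose (w i))
  open Assembly k′ u positive w (ℕₚ.m+[n∸m]≡n (positive zero)) (λ i → ≡.refl) ps (λ i → proj₁ (proj₂ (decompose (w i))))
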